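{- Let $n$ be a positive integer. All eigenvalues of the Fibonacci--Redheffer matrix $F_R(n)$ are real and simple (of algebraic multiplicity $1$). Furthermore, if $\lambda_1<\lambda_2<\cdots<\lambda_n$ are the eigenvalues of $F_R(n)$, then \[ \lambda_1<1,\qquad F_i<\lambda_i<F_{i+1}\ \ (i=2,3,\ldots,n-1),\qquad \lambda_n>F_n. \]
   Context: The Fibonacci numbers are $F_1=F_2=1$, $F_n=F_{n-1}+F_{n-2}$ for $n\ge 3$. The Fibonacci--Redheffer matrix $F_R(n)=[F_R(i,j)]_{i,j=1}^n$ is defined by $F_R(i,j)=1$ if $j=1$; $F_R(i,j)=F_i$ if $i\mid j$; and $F_R(i,j)=0$ otherwise.
   Formalization: The inequalities for the eigenvalues are stated for n ≥ 2 only, since for n = 1 the matrix is (1) with sole eigenvalue 1, so λ_1 < 1 and λ_n > F_n both fail; reality and simplicity are kept for all n ≥ 1. -}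

module Defs where

open import Algebra.Bundles.Raw using (RawRing)
open import Algebra.Definitions.RawSemiring using (sum) renaming (_^_ to pow)
open import Data.Bool.Base using (if_then_else_)
open import Data.Fin.Base using (Fin; zero; suc; toℕ; punchIn)
import Data.Fin.Base as Fin
import Data.Fin.Properties as Fin
import Data.Integer.Base as ℤ
open import Data.List.Base using (List; []; _∷_; map)
open import Data.Nat.Base as ℕ using (ℕ; zero; suc)
open import Data.Nat.Divisibility using (_∣?_)
import Data.Nat.Properties as ℕ
open import Data.Product.Base using (Σ-syntax; ∃-syntax; _×_; _,_)
open import Data.Rational.Base as ℚ using (ℚ; 0ℚ; 1ℚ; ½)
import Data.Rational.Properties as ℚ
open import Data.Rational.Solver using (module +-*-Solver)
open import Function.Bundles using (_⇔_)
open import Level using (Level; _⊔_; 0ℓ)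
open import Relation.Binary.PropositionalEquality using (_≡_; refl; sym; trans; cong; subst)
open import Relation.Nullary using (¬_; does)

private
  variable
    c ℓ : Level

------------------------------------------------------------------------
-- Real numbers: Cauchy sequences of rationals, considered up to _≈ℝ_

IsCauchy : (ℕ → ℚ) → Set
IsCauchy s = ∀ ε → 0ℚ ℚ.< ε →
  ∃[ N ] (∀ m n → N ℕ.≤ m → N ℕ.≤ n → ℚ.∣ s m ℚ.- s n ∣ ℚ.< ε)

record ℝ : Set where
  constructor mkℝ
  field
    seq    : ℕ → ℚ
    cauchy : IsCauchy seq

open ℝ public

infix 4 _≈ℝ_ _<ℝ_

_≈ℝ_ : ℝ → ℝ → Set
x ≈ℝ y = ∀ ε → 0ℚ ℚ.< ε → ∃[ N ] (∀ n → N ℕ.≤ n → ℚ.∣ seq x n ℚ.- seq y n ∣ ℚ.< ε)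

-- A uniform positive gap is required: eventual termwise inequality alone
-- would not be invariant under _≈ℝ_.
_<ℝ_ : ℝ → ℝ → Set
x <ℝ y = Σ[ ε ∈ ℚ ] 0ℚ ℚ.< ε × ∃[ N ] (∀ n → N ℕ.≤ n → seq x n ℚ.+ ε ℚ.< seq y n)

-- Only the sequences matter for _≈ℝ_ and _<ℝ_; keeping the Cauchy proofs
-- abstract stops the type checker from unfolding them.
abstract
  half-pos : ∀ ε → 0ℚ ℚ.< ε → 0ℚ ℚ.< ½ ℚ.* ε
  half-pos ε 0<ε = subst (ℚ._< ½ ℚ.* ε) (ℚ.*-zeroʳ ½) (ℚ.*-monoʳ-<-pos ½ 0<ε)

  halves : ∀ ε → ½ ℚ.* ε ℚ.+ ½ ℚ.* ε ≡ ε
  halves ε = trans (sym (ℚ.*-distribʳ-+ ε ½ ½)) (ℚ.*-identityˡ ε)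

  ≤-⊔ˡ : ∀ {M N k} → M ℕ.⊔ N ℕ.≤ k → M ℕ.≤ k
  ≤-⊔ˡ {M} {N} = ℕ.≤-trans (ℕ.m≤m⊔n M N)

  ≤-⊔ʳ : ∀ {M N k} → M ℕ.⊔ N ℕ.≤ k → N ℕ.≤ k
  ≤-⊔ʳ {M} {N} = ℕ.≤-trans (ℕ.m≤n⊔m M N)

  sum-< : ∀ p q ε → ℚ.∣ p ∣ ℚ.< ½ ℚ.* ε → ℚ.∣ q ∣ ℚ.< ½ ℚ.* ε → ℚ.∣ p ℚ.+ q ∣ ℚ.< ε
  sum-< p q ε p< q< = subst (ℚ.∣ p ℚ.+ q ∣ ℚ.<_) (halves ε)
    (ℚ.≤-<-trans (ℚ.∣p+q∣≤∣p∣+∣q∣ p q) (ℚ.+-mono-< p< q<))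

  const-cauchy : ∀ q → IsCauchy (λ _ → q)
  const-cauchy q ε 0<ε = 0 , λ _ _ _ _ → subst (λ t → ℚ.∣ t ∣ ℚ.< ε) (sym (ℚ.+-inverseʳ q)) 0<ε

  neg-cauchy : ∀ {s} → IsCauchy s → IsCauchy (λ n → ℚ.- s n)
  neg-cauchy {s} cs ε 0<ε with cs ε 0<ε
  ... | N , h = N , λ m n N≤m N≤n →
    subst (ℚ._< ε) (trans (sym (ℚ.∣-p∣≡∣p∣ (s m ℚ.- s n))) (cong ℚ.∣_∣ (ℚ.neg-distrib-+ (s m) (ℚ.- s n))))
      (h m n N≤m N≤n)

  +-cauchy : ∀ {s t} → IsCauchy s → IsCauchy t → IsCauchy (λ n → s n ℚ.+ t n)
  +-cauchy {s} {t} cs ct ε 0<ε with cs (½ ℚ.* ε) (half-pos ε 0<ε) | ct (½ ℚ.* ε) (half-pos ε 0<ε)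
  ... | M , f | N , g = M ℕ.⊔ N , λ m n ≤m ≤n →
    subst (λ u → ℚ.∣ u ∣ ℚ.< ε) (rearrange (s m) (s n) (t m) (t n))
      (sum-< (s m ℚ.- s n) (t m ℚ.- t n) ε
        (f m n (≤-⊔ˡ ≤m) (≤-⊔ˡ ≤n)) (g m n (≤-⊔ʳ {M} ≤m) (≤-⊔ʳ {M} ≤n)))
    where
    open +-*-Solver
    rearrange : ∀ a b c d → (a ℚ.- b) ℚ.+ (c ℚ.- d) ≡ (a ℚ.+ c) ℚ.- (b ℚ.+ d)
    rearrange = solve 4 (λ a b c d → (a :- b) :+ (c :- d) := (a :+ c) :- (b :+ d)) refl

  eventually-bounded : ∀ {s} → IsCauchy s →
    Σ[ B ∈ ℚ ] 0ℚ ℚ.< B × ∃[ N ] (∀ n → N ℕ.≤ n → ℚ.∣ s n ∣ ℚ.≤ B)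
  eventually-bounded {s} cs with cs 1ℚ (ℚ.positive⁻¹ 1ℚ)
  ... | N , h = 1ℚ ℚ.+ ℚ.∣ s N ∣ , ℚ.+-mono-<-≤ (ℚ.positive⁻¹ 1ℚ) (ℚ.0≤∣p∣ (s N)) , N , λ n N≤n →
    subst (λ u → ℚ.∣ u ∣ ℚ.≤ 1ℚ ℚ.+ ℚ.∣ s N ∣) (cancel (s n) (s N))
      (ℚ.≤-trans (ℚ.∣p+q∣≤∣p∣+∣q∣ (s n ℚ.- s N) (s N))
        (ℚ.+-monoˡ-≤ ℚ.∣ s N ∣ (ℚ.<⇒≤ (h n N N≤n ℕ.≤-refl))))
    where
    open +-*-Solver
    cancel : ∀ a b → (a ℚ.- b) ℚ.+ b ≡ a
    cancel = solve 2 (λ a b → (a :- b) :+ b := a) refl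

  scale : ∀ B ε → 0ℚ ℚ.< B → 0ℚ ℚ.< ε → Σ[ δ ∈ ℚ ] 0ℚ ℚ.< δ × B ℚ.* δ ≡ ε
  scale B ε 0<B 0<ε = B⁻¹ ℚ.* ε , 0<δ ,
    trans (sym (ℚ.*-assoc B B⁻¹ ε)) (trans (cong (ℚ._* ε) (ℚ.*-inverseʳ B)) (ℚ.*-identityˡ ε))
    where
    instance
      B-pos : ℚ.Positive B
      B-pos = ℚ.positive 0<B
      B-nonZero : ℚ.NonZero B
      B-nonZero = ℚ.pos⇒nonZero B
    B⁻¹ : ℚ
    B⁻¹ = ℚ.1/ B
    0<δ : 0ℚ ℚ.< B⁻¹ ℚ.* ε
    0<δ = subst (ℚ._< B⁻¹ ℚ.* ε) (ℚ.*-zeroʳ B⁻¹) (ℚ.*-monoʳ-<-pos B⁻¹ {{ℚ.1/pos⇒pos B}} 0<ε)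

  prod-< : ∀ B p q δ η → 0ℚ ℚ.< B → B ℚ.* δ ≡ η → ℚ.∣ p ∣ ℚ.≤ B → ℚ.∣ q ∣ ℚ.< δ → ℚ.∣ p ℚ.* q ∣ ℚ.< η
  prod-< B p q δ η 0<B eq p≤ q< = subst (ℚ._< η) (sym (ℚ.∣p*q∣≡∣p∣*∣q∣ p q))
    (ℚ.≤-<-trans (ℚ.*-monoʳ-≤-nonNeg ℚ.∣ q ∣ {{ℚ.∣-∣-nonNeg q}} p≤)
      (subst (B ℚ.* ℚ.∣ q ∣ ℚ.<_) eq (ℚ.*-monoʳ-<-pos B {{ℚ.positive 0<B}} q<)))

  *-rearrange : ∀ a b c d → a ℚ.* (c ℚ.- d) ℚ.+ d ℚ.* (a ℚ.- b) ≡ a ℚ.* c ℚ.- b ℚ.* d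
  *-rearrange = solve 4 (λ a b c d → a :* (c :- d) :+ d :* (a :- b) := a :* c :- b :* d) refl
    where open +-*-Solver

  *-close : ∀ B C δ γ ε a b c d → 0ℚ ℚ.< B → 0ℚ ℚ.< C → B ℚ.* δ ≡ ½ ℚ.* ε → C ℚ.* γ ≡ ½ ℚ.* ε →
    ℚ.∣ a ∣ ℚ.≤ B → ℚ.∣ d ∣ ℚ.≤ C → ℚ.∣ a ℚ.- b ∣ ℚ.< γ → ℚ.∣ c ℚ.- d ∣ ℚ.< δ →
    ℚ.∣ a ℚ.* c ℚ.- b ℚ.* d ∣ ℚ.< ε
  *-close B C δ γ ε a b c d 0<B 0<C Bδ Cγ a≤B d≤C ab cd =
    subst (λ u → ℚ.∣ u ∣ ℚ.< ε) (*-rearrange a b c d)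
      (sum-< (a ℚ.* (c ℚ.- d)) (d ℚ.* (a ℚ.- b)) ε
        (prod-< B a (c ℚ.- d) δ (½ ℚ.* ε) 0<B Bδ a≤B cd)
        (prod-< C d (a ℚ.- b) γ (½ ℚ.* ε) 0<C Cγ d≤C ab))

  *-cauchy : ∀ {s t} → IsCauchy s → IsCauchy t → IsCauchy (λ n → s n ℚ.* t n)
  *-cauchy {s} {t} cs ct ε 0<ε =
    let B , 0<B , M₁ , s≤B = eventually-bounded cs
        C , 0<C , M₂ , t≤C = eventually-bounded ct
        δ , 0<δ , Bδ       = scale B (½ ℚ.* ε) 0<B (half-pos ε 0<ε)
        γ , 0<γ , Cγ       = scale C (½ ℚ.* ε) 0<C (half-pos ε 0<ε)
        N₁ , f             = cs γ 0<γ
        N₂ , g             = ct δ 0<δ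
    in (M₁ ℕ.⊔ M₂) ℕ.⊔ (N₁ ℕ.⊔ N₂) , λ m n ≤m ≤n →
      *-close B C δ γ ε (s m) (s n) (t m) (t n) 0<B 0<C Bδ Cγ
        (s≤B m (≤-⊔ˡ {M₁} {M₂} (≤-⊔ˡ {M₁ ℕ.⊔ M₂} {N₁ ℕ.⊔ N₂} ≤m)))
        (t≤C n (≤-⊔ʳ {M₁} {M₂} (≤-⊔ˡ {M₁ ℕ.⊔ M₂} {N₁ ℕ.⊔ N₂} ≤n)))
        (f m n (≤-⊔ˡ {N₁} {N₂} (≤-⊔ʳ {M₁ ℕ.⊔ M₂} {N₁ ℕ.⊔ N₂} ≤m))
               (≤-⊔ˡ {N₁} {N₂} (≤-⊔ʳ {M₁ ℕ.⊔ M₂} {N₁ ℕ.⊔ N₂} ≤n)))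
        (g m n (≤-⊔ʳ {N₁} {N₂} (≤-⊔ʳ {M₁ ℕ.⊔ M₂} {N₁ ℕ.⊔ N₂} ≤m))
               (≤-⊔ʳ {N₁} {N₂} (≤-⊔ʳ {M₁ ℕ.⊔ M₂} {N₁ ℕ.⊔ N₂} ≤n)))

fromℚ : ℚ → ℝ
fromℚ q = mkℝ (λ _ → q) (const-cauchy q)

fromℕ : ℕ → ℝ
fromℕ n = fromℚ (ℤ.+ n ℚ./ 1)

ℝ-rawRing : RawRing 0ℓ 0ℓ
ℝ-rawRing = record
  { Carrier = ℝ
  ; _≈_     = _≈ℝ_
  ; _+_     = λ x y → mkℝ (λ n → seq x n ℚ.+ seq y n) (+-cauchy {seq x} {seq y} (cauchy x) (cauchy y))
  ; _*_     = λ x y → mkℝ (λ n → seq x n ℚ.* seq y n) (*-cauchy {seq x} {seq y} (cauchy x) (cauchy y))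
  ; -_      = λ x → mkℝ (λ n → ℚ.- seq x n) (neg-cauchy {seq x} (cauchy x))
  ; 0#      = fromℚ 0ℚ
  ; 1#      = fromℚ 1ℚ
  }

------------------------------------------------------------------------
-- Complex numbers

infix 6 _+i_

record ℂ : Set where
  constructor _+i_
  field
    re : ℝ
    im : ℝ

open ℂ public

ℝ→ℂ : ℝ → ℂ
ℝ→ℂ x = x +i fromℚ 0ℚ

infix 4 _≈ℂ_

_≈ℂ_ : ℂ → ℂ → Set
z ≈ℂ w = re z ≈ℝ re w × im z ≈ℝ im w

ℂ-rawRing : RawRing 0ℓ 0ℓ
ℂ-rawRing = record
  { Carrier = ℂ
  ; _≈_     = _≈ℂ_
  ; _+_     = λ z w → (re z + re w) +i (im z + im w)
  ; _*_     = λ z w → (re z * re w + - (im z * im w)) +i (re z * im w + im z * re w)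
  ; -_      = λ z → (- re z) +i (- im z)
  ; 0#      = ℝ→ℂ 0#
  ; 1#      = ℝ→ℂ 1#
  }
  where open RawRing ℝ-rawRing

IsReal : ℂ → Set
IsReal z = im z ≈ℝ fromℚ 0ℚ

------------------------------------------------------------------------
-- Polynomials: coefficient lists, constant term first. Trailing zeros are
-- allowed, so equality is coefficientwise.

module _ (R : RawRing c ℓ) where
  open RawRing R

  Polynomial : Set c
  Polynomial = List Carrier

  coeff : Polynomial → ℕ → Carrier
  coeff []      _       = 0#
  coeff (a ∷ p) zero    = a
  coeff (a ∷ p) (suc k) = coeff p k

  addₚ : Polynomial → Polynomial → Polynomial
  addₚ []      q       = q
  addₚ (a ∷ p) []      = a ∷ p
  addₚ (a ∷ p) (b ∷ q) = (a + b) ∷ addₚ p q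

  mulₚ : Polynomial → Polynomial → Polynomial
  mulₚ []      q = []
  mulₚ (a ∷ p) q = addₚ (map (a *_) q) (0# ∷ mulₚ p q)

  polynomialRawRing : RawRing c ℓ
  polynomialRawRing = record
    { Carrier = Polynomial
    ; _≈_     = λ p q → ∀ k → coeff p k ≈ coeff q k
    ; _+_     = addₚ
    ; _*_     = mulₚ
    ; -_      = map (-_)
    ; 0#      = []
    ; 1#      = 1# ∷ []
    }

  eval : Polynomial → Carrier → Carrier
  eval []      z = 0#
  eval (a ∷ p) z = a + z * eval p z

  HasRootMultiplicity : Polynomial → Carrier → ℕ → Set (c ⊔ ℓ)
  HasRootMultiplicity p z m =
    ∃[ q ] (p ≈ₚ pow rawSemiringₚ (- z ∷ 1# ∷ []) m *ₚ q × ¬ (eval q z ≈ 0#))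
    where
    open RawRing polynomialRawRing using ()
      renaming (_≈_ to _≈ₚ_; _*_ to _*ₚ_; rawSemiring to rawSemiringₚ)

------------------------------------------------------------------------
-- Matrices and eigenvalues

Matrix : Set c → ℕ → Set c
Matrix A n = Fin n → Fin n → A

module _ (R : RawRing c ℓ) where
  open RawRing R

  -- Laplace expansion along the first row.
  det : ∀ {n} → Matrix Carrier n → Carrier
  det {zero}  M = 1#
  det {suc n} M = sum rawSemiring λ j →
    pow rawSemiring (- 1#) (toℕ j) * (M zero j * det (λ k l → M (suc k) (punchIn j l)))

  -- Entries of X·I − M.
  charMatrix : ∀ {n} → Matrix Carrier n → Matrix (Polynomial R) n
  charMatrix M i j = - M i j ∷ (if does (i Fin.≟ j) then 1# else 0#) ∷ []

  mulVec : ∀ {n} → Matrix Carrier n → (Fin n → Carrier) → Fin n → Carrier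
  mulVec M v i = sum rawSemiring λ j → M i j * v j

  IsEigenvalue : ∀ {n} → Matrix Carrier n → Carrier → Set (c ⊔ ℓ)
  IsEigenvalue M z =
    ∃[ v ] (¬ (∀ i → v i ≈ 0#) × (∀ i → mulVec M v i ≈ z * v i))

charPoly : (R : RawRing c ℓ) → ∀ {n} → Matrix (RawRing.Carrier R) n → Polynomial R
charPoly R M = det (polynomialRawRing R) (charMatrix R M)

HasAlgebraicMultiplicity : (R : RawRing c ℓ) → ∀ {n} →
  Matrix (RawRing.Carrier R) n → RawRing.Carrier R → ℕ → Set (c ⊔ ℓ)
HasAlgebraicMultiplicity R M = HasRootMultiplicity R (charPoly R M)

-- x₁ < x₂ < ⋯ < xₙ are precisely the eigenvalues of M.
IncreasingEigenvalues : ∀ {n} → Matrix ℂ n → (Fin n → ℝ) → Set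
IncreasingEigenvalues M x =
  (∀ i j → i Fin.< j → x i <ℝ x j) ×
  (∀ z → IsEigenvalue ℂ-rawRing M z ⇔ (∃[ i ] z ≈ℂ ℝ→ℂ (x i)))

------------------------------------------------------------------------
-- The Fibonacci–Redheffer matrix

fib : ℕ → ℕ
fib 0             = 0
fib 1             = 1
fib (suc (suc n)) = fib (suc n) ℕ.+ fib n

-- The one-based row or column number of an index.
index : ∀ {n} → Fin n → ℕ
index i = suc (toℕ i)

fibonacciRedhefferEntry : ℕ → ℕ → ℕ
fibonacciRedhefferEntry i j =
  if does (j ℕ.≟ 1) then 1 else
  if does (i ∣? j) then fib i else 0

fibonacciRedheffer : ∀ n → Matrix ℂ n
fibonacciRedheffer n i j = ℝ→ℂ (fromℕ (fibonacciRedhefferEntry (index i) (index j)))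

{-# OPTIONS --safe #-}
module Submission where

-- Below its first row, z·I − M is upper triangular apart from the first column, so the cofactors of
-- the first row satisfy a simple recursion: they are the entries of an eigenvector whenever z is a
-- root of the characteristic polynomial χ, and conversely χ(z) kills every eigenvector for z. The
-- same recursion gives the sign of χ at the diagonal entries: F(q j) − F(j) ≥ 2^(q−1) F(j) makes the
-- contributions of the multiples of j a dominated geometric series, and as a result
-- (−1)^(n−i) χ(tᵢ) > 0 for t₀ < F₂ < ⋯ < Fₙ < tₙ, with t₀ and tₙ far enough to the left and right
-- and tᵢ = F(i+1) in between. Bisection yields a real root in each of the n gaps, and as χ is monic
-- of degree n it is the product of the corresponding linear factors.

-- Real numbers here have no decidable equality or order, and this shapes the proof. All signs are
-- computed at rational points, where comparison is decidable; as the real operations act termwise,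
-- the n-th term of χ(x) is χ of the n-th term of x. "Nonzero" is replaced by two positive notions:
-- `Away`, an eventual uniform lower bound for the absolute value, and its algebraic consequence
-- `Cancellable`, which stands in for division in the factorisation and in the multiplicity. Nothing
-- decides which root a complex z equals; but z is apart from at least one of any two distinct
-- roots, so a single candidate remains. The signs come from the following pattern. At x = F(i) with
-- i ≥ 2 the factor x - F(i) vanishes, so the leading cofactor is zero and χ(x) is minus the sum of
-- the other ones. The factors x - F(k) with k > i are negative and give these cofactors the sign
-- (-1)^(n-i); those with k < i are positive and change nothing. The divisibility entries right of
-- the diagonal can disturb the sign only in the rows k ≥ i, and this is where the growth of the
-- Fibonacci numbers is used.

open import Defs
open import Algebra.Bundles using (CommutativeRing; RawRing)
open import Algebra.Definitions.RawSemiring using (sum) renaming (_^_ to pow)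
import Algebra.Properties.Ring
import Algebra.Properties.Semiring.Sum
open import Data.Bool.Base using (if_then_else_; true; false)
open import Data.Fin.Base using (Fin; zero; suc; toℕ; punchIn)
import Data.Fin.Base as Fin
open import Data.Fin.Patterns using (0F; 1F)
import Data.Fin.Properties as Fin
import Data.Integer.Base as ℤ
import Data.Integer.Properties as ℤ
open import Data.List.Base using ([]; _∷_; map)
open import Data.Nat.Base as ℕ using (ℕ; zero; suc; z≤n; s≤s; _≤_; _<_)
open import Data.Nat.Divisibility using (_∣?_; _∣_; divides; ∣-refl; ∣⇒≤; 1∣_)
import Data.Nat.Properties as ℕ
open import Data.Nat.Solver using () renaming (module +-*-Solver to ℕS)
open import Data.Product.Base using (_×_; _,_; proj₁; proj₂; ∃-syntax; Σ-syntax)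
open import Data.Rational.Base as ℚ using (ℚ; 0ℚ; 1ℚ; ½; mkℚ)
import Data.Rational.Properties as ℚ
open import Data.Rational.Solver using () renaming (module +-*-Solver to ℚS)
import Data.Rational.Unnormalised.Base as ℚᵘ
import Data.Rational.Unnormalised.Properties as ℚᵘ
open import Data.Sum.Base as Sum using (_⊎_; inj₁; inj₂)
open import Function.Base using (_∘_)
open import Function.Bundles using (mk⇔; Equivalence)
open import Level using (_⊔_; 0ℓ)
open import Relation.Binary.Definitions using (tri<; tri≈; tri>)
open import Relation.Binary.PropositionalEquality as ≡ using (_≡_; _≢_)
import Relation.Binary.Reasoning.Setoid as SetoidReasoning
open import Relation.Nullary using (¬_; yes; no; does; contradiction)
open import Relation.Nullary.Decidable using (dec-true; dec-false)

open ℚS using (solve; _:+_; _:*_; :-_; _:-_; _:=_; con)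

-- Determinants of bordered triangular matrices

-- No compatibility with _≈_ is required: taking the n-th term of a Cauchy sequence qualifies.
record PreservesOperations {c₁ ℓ₁ c₂ ℓ₂} (R : RawRing c₁ ℓ₁) (S : RawRing c₂ ℓ₂)
  (f : RawRing.Carrier R → RawRing.Carrier S) : Set (c₁ ⊔ ℓ₂) where
  private
    module R = RawRing R
    module S = RawRing S
  field
    +-homo : ∀ x y → f (x R.+ y) S.≈ f x S.+ f y
    *-homo : ∀ x y → f (x R.* y) S.≈ f x S.* f y
    -‿homo : ∀ x → f (R.- x) S.≈ S.- f x
    0#-homo : f R.0# S.≈ S.0#
    1#-homo : f R.1# S.≈ S.1#

module Determinants {c ℓ} (CR : CommutativeRing c ℓ) where
  open CommutativeRing CR hiding (zero)
  open RawRing rawRing using (rawSemiring)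
  open Algebra.Properties.Ring ring
  open Algebra.Properties.Semiring.Sum semiring
    using (sum-cong-≋; sum-replicate-zero; sum-remove; *-distribˡ-sum; *-distribʳ-sum)
  open SetoidReasoning setoid

  R = rawRing

  -- Opaque, so that summands can be inferred by unification.
  opaque
    ∑ : ∀ {n} → (Fin n → Carrier) → Carrier
    ∑ = sum rawSemiring

    sum≡∑ : ∀ {n} (f : Fin n → Carrier) → sum rawSemiring f ≡ ∑ f
    sum≡∑ f = ≡.refl

    ∑-empty : (f : Fin 0 → Carrier) → ∑ f ≡ 0#
    ∑-empty f = ≡.refl

    ∑-suc : ∀ {n} (f : Fin (suc n) → Carrier) → ∑ f ≡ f zero + ∑ (f ∘ suc)
    ∑-suc f = ≡.refl

    ∑-cong : ∀ {n} {f g : Fin n → Carrier} → (∀ i → f i ≈ g i) → ∑ f ≈ ∑ g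
    ∑-cong f≈g = sum-cong-≋ f≈g

    ∑-zero : ∀ {n} {f : Fin n → Carrier} → (∀ i → f i ≈ 0#) → ∑ f ≈ 0#
    ∑-zero {n} f≈0 = trans (sum-cong-≋ f≈0) (sum-replicate-zero n)

    ∑-remove : ∀ {n} i (f : Fin (suc n) → Carrier) → ∑ f ≈ f i + ∑ (λ l → f (punchIn i l))
    ∑-remove i f = sum-remove {i = i} f

    *-distribˡ-∑ : ∀ {n} x (f : Fin n → Carrier) → x * ∑ f ≈ ∑ λ i → x * f i
    *-distribˡ-∑ = *-distribˡ-sum

    *-distribʳ-∑ : ∀ {n} x (f : Fin n → Carrier) → ∑ f * x ≈ ∑ λ i → f i * x
    *-distribʳ-∑ = *-distribʳ-sum

  -- Constructive substitute for being nonzero: the negation of `z ≈ 0#` would not allow a factor to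
  -- be removed from an equation.
  Cancellable : Carrier → Set _
  Cancellable z = ∀ w → z * w ≈ 0# → w ≈ 0#

  sign : ℕ → Carrier
  sign = pow rawSemiring (- 1#)

  x*yz≈y*xz : ∀ x y z → x * (y * z) ≈ y * (x * z)
  x*yz≈y*xz x y z = begin
    x * (y * z) ≈⟨ *-assoc x y z ⟨
    (x * y) * z ≈⟨ *-congʳ (*-comm x y) ⟩
    (y * x) * z ≈⟨ *-assoc y x z ⟩
    y * (x * z) ∎

  sign-shift : ∀ k x → sign (suc k) * x ≈ - (sign k * x)
  sign-shift k x = begin
    (- 1# * sign k) * x ≈⟨ *-assoc _ _ _ ⟩
    - 1# * (sign k * x) ≈⟨ -1*x≈-x _ ⟩
    - (sign k * x)      ∎

  *-zero-factorʳ : ∀ x y → y ≈ 0# → x * y ≈ 0#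
  *-zero-factorʳ x y y≈0 = trans (*-congˡ y≈0) (zeroʳ x)

  *-zero-factorˡ : ∀ x y → x ≈ 0# → x * y ≈ 0#
  *-zero-factorˡ x y x≈0 = trans (*-congʳ x≈0) (zeroˡ y)

  det-expand : ∀ {n} (M : Matrix Carrier (suc n)) →
    det R M ≈ ∑ λ j → sign (toℕ j) * (M zero j * det R (λ k l → M (suc k) (punchIn j l)))
  det-expand M = reflexive (sum≡∑ _)

  mulVec≈∑ : ∀ {n} (M : Matrix Carrier n) v i → mulVec R M v i ≈ ∑ λ j → M i j * v j
  mulVec≈∑ M v i = reflexive (sum≡∑ λ j → M i j * v j)

  det-cong : ∀ {n} {M N : Matrix Carrier n} → (∀ i j → M i j ≈ N i j) → det R M ≈ det R N
  det-cong {zero}  M≈N = refl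
  det-cong {suc n} {M} {N} M≈N = trans (det-expand M) (trans
    (∑-cong λ j → *-congˡ (*-cong (M≈N zero j) (det-cong λ k l → M≈N (suc k) (punchIn j l))))
    (sym (det-expand N)))

  det-zero-column : ∀ {n} (M : Matrix Carrier n) (c : Fin n) → (∀ k → M k c ≈ 0#) → det R M ≈ 0#
  det-zero-column {suc n} M c M≈0 = trans (det-expand M) (∑-zero λ j → *-zero-factorʳ _ _ (term j))
    where
    term : ∀ j → M zero j * det R (λ k l → M (suc k) (punchIn j l)) ≈ 0#
    term j with j Fin.≟ c
    ... | yes ≡.refl = *-zero-factorˡ _ _ (M≈0 zero)
    ... | no j≢c = *-zero-factorʳ _ _ (det-zero-column (λ k l → M (suc k) (punchIn j l)) (Fin.punchOut j≢c) λ k →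
      trans (reflexive (≡.cong (M (suc k)) (Fin.punchIn-punchOut j≢c))) (M≈0 (suc k)))

  term-zero : ∀ {n} x y (M : Matrix Carrier n) (c : Fin n) → (∀ k → M k c ≈ 0#) → x * (y * det R M) ≈ 0#
  term-zero x y M c M≈0 = *-zero-factorʳ _ _ (*-zero-factorʳ _ _ (det-zero-column M c M≈0))

  -- All rows but the first of a square matrix.
  Bordered : ℕ → Set c
  Bordered m = Fin m → Fin (suc m) → Carrier

  -- Column 0 is the unrestricted border; the diagonal of the triangular part is `G k (suc k)`.
  IsTriangular : ∀ {m} → Bordered m → Set ℓ
  IsTriangular G = ∀ k l → l Fin.< k → G k (suc l) ≈ 0#

  -- Row 0 goes together with its diagonal column 1, so the border stays in column 0 and the
  -- remaining diagonal is preserved.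
  shrink : ∀ {m} → Bordered (suc m) → Bordered m
  shrink G k l = G (suc k) (punchIn 1F l)

  shrink-triangular : ∀ {m} (G : Bordered (suc m)) → IsTriangular G → IsTriangular (shrink G)
  shrink-triangular G tri k l l<k = tri (suc k) (suc l) (s≤s l<k)

  -- Closed recursion for the signed minors of a triangular `G`. Below row 0, column 1 is zero; if
  -- it is kept, only its top entry contributes and splits off as a factor. If it is the deleted
  -- column, the minor is expanded along row 0, whose minors are those of `shrink G`.
  cofactor : ∀ {m} → Bordered m → Fin (suc m) → Carrier
  cofactor {zero}  G _            = 1#
  cofactor {suc m} G 0F           = G 0F 1F * cofactor (shrink G) 0F
  cofactor {suc m} G 1F           = - ∑ λ l → G 0F (punchIn 1F l) * cofactor (shrink G) l
  cofactor {suc m} G (suc (suc j)) = G 0F 1F * cofactor (shrink G) (suc j)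

  cofactor-punchIn : ∀ {m} (G : Bordered (suc m)) l →
    cofactor G (punchIn 1F l) ≈ G 0F 1F * cofactor (shrink G) l
  cofactor-punchIn G zero    = refl
  cofactor-punchIn G (suc l) = refl

  minor : ∀ {m} → Bordered m → Fin (suc m) → Carrier
  minor G j = det R λ k l → G k (punchIn j l)

  signed-minor : ∀ {m} (G : Bordered m) → IsTriangular G → ∀ j →
    sign (toℕ j) * minor G j ≈ cofactor G j
  signed-minor {zero}  G tri zero = *-identityˡ 1#
  signed-minor {suc m} G tri zero = begin
    1# * minor G 0F                              ≈⟨ *-identityˡ _ ⟩
    minor G 0F                                   ≈⟨ trans (det-expand (λ k l → G k (suc l))) (reflexive (∑-suc _)) ⟩
    1# * (G 0F 1F * minor (shrink G) 0F) + _     ≈⟨ +-cong (*-identityˡ _) (∑-zero vanish) ⟩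
    G 0F 1F * minor (shrink G) 0F + 0#           ≈⟨ +-identityʳ _ ⟩
    G 0F 1F * minor (shrink G) 0F                ≈⟨ *-congˡ (*-identityˡ _) ⟨
    G 0F 1F * (1# * minor (shrink G) 0F)         ≈⟨ *-congˡ (signed-minor (shrink G) (shrink-triangular G tri) 0F) ⟩
    G 0F 1F * cofactor (shrink G) 0F             ∎
    where
    vanish : ∀ (l : Fin m) → sign (suc (toℕ l)) *
      (G 0F (suc (suc l)) * det R (λ k r → G (suc k) (suc (punchIn (suc l) r)))) ≈ 0#
    -- Both clauses agree; the split only shows that `Fin m` is inhabited, so that column `0F` of
    -- the minor exists.
    vanish l@zero    = term-zero _ _ (λ k r → G (suc k) (suc (punchIn (suc l) r))) 0F λ k → tri (suc k) 0F (s≤s z≤n)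
    vanish l@(suc _) = term-zero _ _ (λ k r → G (suc k) (suc (punchIn (suc l) r))) 0F λ k → tri (suc k) 0F (s≤s z≤n)
  signed-minor {suc m} G tri 1F = begin
    (- 1# * 1#) * minor G 1F                                                ≈⟨ sign-shift 0 _ ⟩
    - (1# * minor G 1F)                                                     ≈⟨ -‿cong (*-identityˡ _) ⟩
    - minor G 1F                                                            ≈⟨ -‿cong (det-expand (λ k l → G k (punchIn 1F l))) ⟩
    - ∑ (λ l → sign (toℕ l) * (G 0F (punchIn 1F l) * minor (shrink G) l))  ≈⟨ -‿cong (∑-cong λ l →
      trans (x*yz≈y*xz _ _ _) (*-congˡ (signed-minor (shrink G) (shrink-triangular G tri) l))) ⟩
    cofactor G 1F                                                           ∎
  signed-minor {suc (suc m)} G tri j@(suc (suc j′)) = begin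
    sign (toℕ j) * minor G j
      ≈⟨ *-congˡ (trans (det-expand (λ k l → G k (punchIn j l))) (trans (reflexive (∑-suc _)) (+-congˡ (reflexive (∑-suc _))))) ⟩
    sign (toℕ j) * (_ + (_ + _))
      ≈⟨ *-congˡ (+-cong head≈0 (+-congˡ (∑-zero tail≈0))) ⟩
    sign (toℕ j) * (0# + ((- 1# * 1#) * (G 0F 1F * minor₁) + 0#))
      ≈⟨ *-congˡ (trans (+-identityˡ _) (trans (+-identityʳ _) (sign-shift 0 _))) ⟩
    sign (toℕ j) * - (1# * (G 0F 1F * minor₁))
      ≈⟨ *-congˡ (-‿cong (trans (*-identityˡ _) (*-congˡ (det-cong same)))) ⟩
    sign (toℕ j) * - (G 0F 1F * minor (shrink G) (suc j′))
      -- The surviving column stands at position 1 of the expansion and carries a minus; this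
      -- offsets the passage from `j` to `suc j′` in the shrunk matrix.
      ≈⟨ sign-shift (toℕ (suc j′)) _ ⟩
    - (sign (toℕ (suc j′)) * - (G 0F 1F * minor (shrink G) (suc j′)))
      ≈⟨ -‿distribʳ-* _ _ ⟩
    sign (toℕ (suc j′)) * - - (G 0F 1F * minor (shrink G) (suc j′))
      ≈⟨ *-congˡ (-‿involutive _) ⟩
    sign (toℕ (suc j′)) * (G 0F 1F * minor (shrink G) (suc j′))
      ≈⟨ x*yz≈y*xz _ _ _ ⟩
    G 0F 1F * (sign (toℕ (suc j′)) * minor (shrink G) (suc j′))
      ≈⟨ *-congˡ (signed-minor (shrink G) (shrink-triangular G tri) (suc j′)) ⟩
    cofactor G j ∎
    where
    minor₁ : Carrier
    minor₁ = det R λ k r → G (suc k) (punchIn j (punchIn 1F r))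
    same : ∀ k r → G (suc k) (punchIn j (punchIn 1F r)) ≈ shrink G k (punchIn (suc j′) r)
    same k zero    = refl
    same k (suc r) = refl
    head≈0 : 1# * (G 0F 0F * det R (λ k r → G (suc k) (punchIn j (suc r)))) ≈ 0#
    head≈0 = term-zero _ _ (λ k r → G (suc k) (punchIn j (suc r))) 0F λ k → tri (suc k) 0F (s≤s z≤n)
    tail≈0 : ∀ (l : Fin m) → sign (suc (suc (toℕ l))) * (G 0F (punchIn j (suc (suc l))) *
      det R (λ k r → G (suc k) (punchIn j (punchIn (suc (suc l)) r)))) ≈ 0#
    tail≈0 l@zero    = term-zero _ _ (λ k r → G (suc k) (punchIn j (punchIn (suc (suc l)) r))) 1F λ k → tri (suc k) 0F (s≤s z≤n)
    tail≈0 l@(suc _) = term-zero _ _ (λ k r → G (suc k) (punchIn j (punchIn (suc (suc l)) r))) 1F λ k → tri (suc k) 0F (s≤s z≤n)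

  lowerRows : ∀ {m} → Matrix Carrier (suc m) → Bordered m
  lowerRows N k = N (suc k)

  det-cofactor : ∀ {m} (N : Matrix Carrier (suc m)) → IsTriangular (lowerRows N) →
    det R N ≈ ∑ λ j → N zero j * cofactor (lowerRows N) j
  det-cofactor N tri = trans (det-expand N) (∑-cong λ j →
    trans (x*yz≈y*xz _ _ _) (*-congˡ (signed-minor (lowerRows N) tri j)))

  -- The entry at column 1 is made to cancel the rest of row 0. The rows below have a zero in that
  -- column and see only a multiple of the cofactors of `shrink G`.
  cofactor-annihilated : ∀ {m} (G : Bordered m) → IsTriangular G → ∀ k →
    ∑ (λ j → G k j * cofactor G j) ≈ 0#
  cofactor-annihilated {suc m} G tri zero = begin
    ∑ (λ j → G 0F j * cofactor G j)
      ≈⟨ ∑-remove 1F (λ j → G 0F j * cofactor G j) ⟩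
    G 0F 1F * - S + ∑ (λ l → G 0F (punchIn 1F l) * cofactor G (punchIn 1F l))
      ≈⟨ +-cong (sym (-‿distribʳ-* _ _)) (∑-cong λ l →
           trans (*-congˡ (cofactor-punchIn G l)) (x*yz≈y*xz _ _ _)) ⟩
    - (G 0F 1F * S) + ∑ (λ l → G 0F 1F * (G 0F (punchIn 1F l) * cofactor (shrink G) l))
      ≈⟨ +-congˡ (*-distribˡ-∑ (G 0F 1F) _) ⟨
    - (G 0F 1F * S) + G 0F 1F * S
      ≈⟨ -‿inverseˡ _ ⟩
    0# ∎
    where
    S = ∑ λ l → G 0F (punchIn 1F l) * cofactor (shrink G) l
  cofactor-annihilated {suc m} G tri (suc k) = begin
    ∑ (λ j → G (suc k) j * cofactor G j)
      ≈⟨ ∑-remove 1F (λ j → G (suc k) j * cofactor G j) ⟩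
    G (suc k) 1F * cofactor G 1F + ∑ (λ l → shrink G k l * cofactor G (punchIn 1F l))
      ≈⟨ +-cong (*-zero-factorˡ _ _ (tri (suc k) 0F (s≤s z≤n))) (∑-cong λ l →
           trans (*-congˡ (cofactor-punchIn G l)) (x*yz≈y*xz _ _ _)) ⟩
    0# + ∑ (λ l → G 0F 1F * (shrink G k l * cofactor (shrink G) l))
      ≈⟨ +-identityˡ _ ⟩
    ∑ (λ l → G 0F 1F * (shrink G k l * cofactor (shrink G) l))
      ≈⟨ *-distribˡ-∑ (G 0F 1F) _ ⟨
    G 0F 1F * ∑ (λ l → shrink G k l * cofactor (shrink G) l)
      ≈⟨ *-zero-factorʳ _ _ (cofactor-annihilated (shrink G) (shrink-triangular G tri) k) ⟩
    0# ∎

  punchIn₁-view : ∀ {m} (P : Fin (suc (suc m)) → Set ℓ) → P 1F → (∀ l → P (punchIn 1F l)) → ∀ j → P j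
  punchIn₁-view P p₁ p zero          = p zero
  punchIn₁-view P p₁ p (suc zero)    = p₁
  punchIn₁-view P p₁ p (suc (suc j)) = p (suc j)

  -- The kernel is a line spanned by the cofactors, in cross-multiplied form because cofactors may
  -- vanish and cannot be divided by. Without coordinate 1, `v` lies in the kernel of `shrink G`;
  -- row 0 then expresses `G 0F 1F` times coordinate 1 through the others.
  kernel-proportional : ∀ {m} (G : Bordered m) → IsTriangular G → (v : Fin (suc m) → Carrier) →
    (∀ k → ∑ (λ j → G k j * v j) ≈ 0#) → ∀ i j → v i * cofactor G j ≈ v j * cofactor G i
  kernel-proportional {zero}  G tri v Gv≈0 zero zero = refl
  kernel-proportional {suc m} G tri v Gv≈0 =
    punchIn₁-view _ (punchIn₁-view _ refl first)
      λ i → punchIn₁-view _ (sym (first i)) (rest i)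
    where
    v′ : Fin (suc m) → Carrier
    v′ l = v (punchIn 1F l)
    G′ = shrink G
    tri′ = shrink-triangular G tri
    IH : ∀ i j → v′ i * cofactor G′ j ≈ v′ j * cofactor G′ i
    IH = kernel-proportional G′ tri′ v′ λ k → begin
      ∑ (λ l → G′ k l * v′ l)
        ≈⟨ +-identityˡ _ ⟨
      0# + ∑ (λ l → G′ k l * v′ l)
        ≈⟨ +-congʳ (*-zero-factorˡ _ _ (tri (suc k) 0F (s≤s z≤n))) ⟨
      G (suc k) 1F * v 1F + ∑ (λ l → G′ k l * v′ l)
        ≈⟨ ∑-remove 1F (λ j → G (suc k) j * v j) ⟨
      ∑ (λ j → G (suc k) j * v j)
        ≈⟨ Gv≈0 (suc k) ⟩
      0# ∎
    row₀ : v 1F * G 0F 1F ≈ - ∑ (λ l → G 0F (punchIn 1F l) * v′ l)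
    row₀ = trans (*-comm _ _) (+-inverseˡ-unique _ _
      (trans (sym (∑-remove 1F (λ j → G 0F j * v j))) (Gv≈0 0F)))
    rest : ∀ i j → v′ i * cofactor G (punchIn 1F j) ≈ v′ j * cofactor G (punchIn 1F i)
    rest i j = begin
      v′ i * cofactor G (punchIn 1F j)      ≈⟨ *-congˡ (cofactor-punchIn G j) ⟩
      v′ i * (G 0F 1F * cofactor G′ j)      ≈⟨ x*yz≈y*xz _ _ _ ⟩
      G 0F 1F * (v′ i * cofactor G′ j)      ≈⟨ *-congˡ (IH i j) ⟩
      G 0F 1F * (v′ j * cofactor G′ i)      ≈⟨ x*yz≈y*xz _ _ _ ⟩
      v′ j * (G 0F 1F * cofactor G′ i)      ≈⟨ *-congˡ (cofactor-punchIn G i) ⟨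
      v′ j * cofactor G (punchIn 1F i)      ∎
    first : ∀ j → v 1F * cofactor G (punchIn 1F j) ≈ v′ j * cofactor G 1F
    first j = begin
      v 1F * cofactor G (punchIn 1F j)      ≈⟨ *-congˡ (cofactor-punchIn G j) ⟩
      v 1F * (G 0F 1F * cofactor G′ j)      ≈⟨ *-assoc _ _ _ ⟨
      v 1F * G 0F 1F * cofactor G′ j        ≈⟨ *-congʳ row₀ ⟩
      - ∑ (λ l → G 0F (punchIn 1F l) * v′ l) * cofactor G′ j
        ≈⟨ -‿distribˡ-* _ _ ⟨
      - (∑ (λ l → G 0F (punchIn 1F l) * v′ l) * cofactor G′ j)
        ≈⟨ -‿cong (*-distribʳ-∑ (cofactor G′ j) _) ⟩
      - ∑ (λ l → G 0F (punchIn 1F l) * v′ l * cofactor G′ j)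
        ≈⟨ -‿cong (∑-cong λ l → trans (*-assoc _ _ _) (trans (*-congˡ (IH l j)) (x*yz≈y*xz _ _ _))) ⟩
      - ∑ (λ l → v′ j * (G 0F (punchIn 1F l) * cofactor G′ l))
        ≈⟨ -‿cong (*-distribˡ-∑ (v′ j) _) ⟨
      - (v′ j * ∑ (λ l → G 0F (punchIn 1F l) * cofactor G′ l))
        ≈⟨ -‿distribʳ-* _ _ ⟩
      v′ j * cofactor G 1F ∎

  -- In the expansion of the determinant times `v i`, proportionality exchanges `v i * C j` for
  -- `v j * C i`. What is left is `C i` times the first row applied to `v`.
  det-kernel : ∀ {m} (N : Matrix Carrier (suc m)) → IsTriangular (lowerRows N) → (v : Fin (suc m) → Carrier) →
    (∀ i → mulVec R N v i ≈ 0#) → ∀ i → det R N * v i ≈ 0#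
  det-kernel N tri v mulVec≈0 i = begin
    det R N * v i                                    ≈⟨ *-congʳ (det-cofactor N tri) ⟩
    ∑ (λ j → N zero j * C j) * v i                  ≈⟨ *-distribʳ-∑ (v i) _ ⟩
    ∑ (λ j → N zero j * C j * v i)                  ≈⟨ ∑-cong (λ j → begin
      N zero j * C j * v i      ≈⟨ *-assoc _ _ _ ⟩
      N zero j * (C j * v i)    ≈⟨ *-congˡ (*-comm _ _) ⟩
      N zero j * (v i * C j)    ≈⟨ *-congˡ (kernel-proportional (lowerRows N) tri v (λ k → Nv≈0 (suc k)) i j) ⟩
      N zero j * (v j * C i)    ≈⟨ *-assoc _ _ _ ⟨
      N zero j * v j * C i      ∎) ⟩
    ∑ (λ j → N zero j * v j * C i)                  ≈⟨ *-distribʳ-∑ (C i) _ ⟨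
    ∑ (λ j → N zero j * v j) * C i                  ≈⟨ *-zero-factorˡ _ _ (Nv≈0 zero) ⟩
    0#                                               ∎
    where
    C = cofactor (lowerRows N)
    Nv≈0 : ∀ i → ∑ (λ j → N i j * v j) ≈ 0#
    Nv≈0 i = trans (sym (mulVec≈∑ N v i)) (mulVec≈0 i)

  mulVec-cofactor : ∀ {m} (N : Matrix Carrier (suc m)) → IsTriangular (lowerRows N) →
    det R N ≈ 0# → ∀ i → mulVec R N (cofactor (lowerRows N)) i ≈ 0#
  mulVec-cofactor N tri det≈0 zero    = trans (mulVec≈∑ N (cofactor (lowerRows N)) zero)
    (trans (sym (det-cofactor N tri)) det≈0)
  mulVec-cofactor N tri det≈0 (suc k) = trans (mulVec≈∑ N (cofactor (lowerRows N)) (suc k))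
    (cofactor-annihilated (lowerRows N) tri k)

-- Determinants under maps that preserve the operations

module _ {c₁ ℓ₁ c₂ ℓ₂} (R : RawRing c₁ ℓ₁) (CS : CommutativeRing c₂ ℓ₂)
  {f : RawRing.Carrier R → CommutativeRing.Carrier CS}
  (f-natural : PreservesOperations R (CommutativeRing.rawRing CS) f) where
  private
    module R = RawRing R
    module S = CommutativeRing CS
  open PreservesOperations f-natural

  sum-natural : ∀ {n} (t : Fin n → R.Carrier) → f (sum R.rawSemiring t) S.≈ sum (RawRing.rawSemiring S.rawRing) (f ∘ t)
  sum-natural {zero}  t = 0#-homo
  sum-natural {suc n} t = S.trans (+-homo _ _) (S.+-congˡ (sum-natural (t ∘ suc)))

  sign-natural : ∀ k → f (pow R.rawSemiring (R.- R.1#) k) S.≈ pow (RawRing.rawSemiring S.rawRing) (S.- S.1#) k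
  sign-natural zero    = 1#-homo
  sign-natural (suc k) = S.trans (*-homo _ _)
    (S.*-cong (S.trans (-‿homo _) (S.-‿cong 1#-homo)) (sign-natural k))

  -- Serves for evaluation of polynomials, for passing to the n-th term of real sequences and for
  -- the embedding of ℝ in ℂ.
  det-natural : ∀ {n} (M : Matrix R.Carrier n) → f (det R M) S.≈ det S.rawRing (λ i j → f (M i j))
  det-natural {zero}  M = 1#-homo
  det-natural {suc n} M = begin
    f (det R M)
      ≈⟨ sum-natural (λ j → pow R.rawSemiring (R.- R.1#) (toℕ j) R.* (M zero j R.* det R (minor j))) ⟩
    sum (RawRing.rawSemiring S.rawRing) (λ j → f (pow R.rawSemiring (R.- R.1#) (toℕ j) R.* (M zero j R.* det R (minor j))))
      ≡⟨ D.sum≡∑ _ ⟩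
    D.∑ (λ j → f (pow R.rawSemiring (R.- R.1#) (toℕ j) R.* (M zero j R.* det R (minor j))))
      ≈⟨ D.∑-cong (λ j → S.trans (*-homo _ _) (S.*-cong (sign-natural (toℕ j))
           (S.trans (*-homo _ _) (S.*-congˡ (det-natural (minor j)))))) ⟩
    D.∑ (λ j → D.sign (toℕ j) S.* (f (M zero j) S.* det S.rawRing (λ k l → f (minor j k l))))
      ≈⟨ D.det-expand (λ i j → f (M i j)) ⟨
    det S.rawRing (λ i j → f (M i j)) ∎
    where
    module D = Determinants CS
    open SetoidReasoning S.setoid
    minor : Fin (suc n) → Matrix R.Carrier n
    minor j k l = M (suc k) (punchIn j l)

-- Polynomials

module Polynomials {c ℓ} (CR : CommutativeRing c ℓ) where
  open CommutativeRing CR hiding (zero)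
  open RawRing rawRing using (rawSemiring)
  open Algebra.Properties.Ring ring
  open SetoidReasoning setoid
  module D = Determinants CR
  open D using (Cancellable; *-zero-factorˡ; *-zero-factorʳ; x*yz≈y*xz)

  Poly = Polynomial rawRing
  _[_] = coeff rawRing
  _+ₚ_ = addₚ rawRing
  _*ₚ_ = mulₚ rawRing
  infix 4 _≈ₚ_
  infixl 6 _+ₚ_
  infixl 7 _*ₚ_
  _≈ₚ_ : Poly → Poly → Set ℓ
  p ≈ₚ q = ∀ k → p [ k ] ≈ q [ k ]

  +-interchange : ∀ w x y z → (w + x) + (y + z) ≈ (w + y) + (x + z)
  +-interchange w x y z = begin
    (w + x) + (y + z) ≈⟨ +-assoc w x (y + z) ⟩
    w + (x + (y + z)) ≈⟨ +-congˡ (+-assoc x y z) ⟨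
    w + ((x + y) + z) ≈⟨ +-congˡ (+-congʳ (+-comm x y)) ⟩
    w + ((y + x) + z) ≈⟨ +-congˡ (+-assoc y x z) ⟩
    w + (y + (x + z)) ≈⟨ +-assoc w y (x + z) ⟨
    (w + y) + (x + z) ∎

  -- The Cauchy product of coefficient sequences; the ring laws are easier to prove for it, as
  -- sequences have no trailing zeros to care about.
  conv : (ℕ → Carrier) → (ℕ → Carrier) → ℕ → Carrier
  conv f g zero    = f 0 * g 0
  conv f g (suc k) = f 0 * g (suc k) + conv (f ∘ suc) g k

  conv-cong : ∀ {f f′ g g′} → (∀ k → f k ≈ f′ k) → (∀ k → g k ≈ g′ k) → ∀ k → conv f g k ≈ conv f′ g′ k
  conv-cong f≈ g≈ zero    = *-cong (f≈ 0) (g≈ 0)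
  conv-cong f≈ g≈ (suc k) = +-cong (*-cong (f≈ 0) (g≈ (suc k))) (conv-cong (f≈ ∘ suc) g≈ k)

  conv-zeroˡ : ∀ {f} g → (∀ k → f k ≈ 0#) → ∀ k → conv f g k ≈ 0#
  conv-zeroˡ g f≈0 zero    = *-zero-factorˡ _ _ (f≈0 0)
  conv-zeroˡ g f≈0 (suc k) = trans (+-cong (*-zero-factorˡ _ _ (f≈0 0)) (conv-zeroˡ g (f≈0 ∘ suc) k)) (+-identityˡ 0#)

  conv-distribʳ : ∀ h f g k → conv (λ i → f i + g i) h k ≈ conv f h k + conv g h k
  conv-distribʳ h f g zero    = distribʳ _ _ _
  conv-distribʳ h f g (suc k) =
    trans (+-cong (distribʳ _ _ _) (conv-distribʳ h (f ∘ suc) (g ∘ suc) k)) (+-interchange _ _ _ _)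

  conv-scaleˡ : ∀ a f g k → conv (λ i → a * f i) g k ≈ a * conv f g k
  conv-scaleˡ a f g zero    = *-assoc _ _ _
  conv-scaleˡ a f g (suc k) =
    trans (+-cong (*-assoc _ _ _) (conv-scaleˡ a (f ∘ suc) g k)) (sym (distribˡ _ _ _))

  -- Peels off the last summand instead of the first, which lets commutativity go through by
  -- induction on the index.
  conv-sucʳ : ∀ f g k → conv f g (suc k) ≈ conv f (g ∘ suc) k + f (suc k) * g 0
  conv-sucʳ f g zero    = refl
  conv-sucʳ f g (suc k) = trans (+-congˡ (conv-sucʳ (f ∘ suc) g k)) (sym (+-assoc _ _ _))

  conv-comm : ∀ f g k → conv f g k ≈ conv g f k
  conv-comm f g zero    = *-comm _ _
  conv-comm f g (suc k) = begin
    f 0 * g (suc k) + conv (f ∘ suc) g k ≈⟨ +-cong (*-comm _ _) (conv-comm (f ∘ suc) g k) ⟩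
    g (suc k) * f 0 + conv g (f ∘ suc) k ≈⟨ +-comm _ _ ⟩
    conv g (f ∘ suc) k + g (suc k) * f 0 ≈⟨ conv-sucʳ g f k ⟨
    conv g f (suc k)                     ∎

  conv-assoc : ∀ f g h k → conv (conv f g) h k ≈ conv f (conv g h) k
  conv-assoc f g h zero    = *-assoc _ _ _
  conv-assoc f g h (suc k) = begin
    f 0 * g 0 * h (suc k) + conv (λ i → f 0 * g (suc i) + conv (f ∘ suc) g i) h k
      ≈⟨ +-cong (*-assoc _ _ _) (conv-distribʳ h (λ i → f 0 * g (suc i)) (conv (f ∘ suc) g) k) ⟩
    f 0 * (g 0 * h (suc k)) + (conv (λ i → f 0 * g (suc i)) h k + conv (conv (f ∘ suc) g) h k)
      ≈⟨ +-congˡ (+-cong (conv-scaleˡ (f 0) (g ∘ suc) h k) (conv-assoc (f ∘ suc) g h k)) ⟩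
    f 0 * (g 0 * h (suc k)) + (f 0 * conv (g ∘ suc) h k + conv (f ∘ suc) (conv g h) k)
      ≈⟨ +-assoc _ _ _ ⟨
    f 0 * (g 0 * h (suc k)) + f 0 * conv (g ∘ suc) h k + conv (f ∘ suc) (conv g h) k
      ≈⟨ +-congʳ (distribˡ _ _ _) ⟨
    conv f (conv g h) (suc k) ∎

  coeff-add : ∀ p q k → (p +ₚ q) [ k ] ≈ p [ k ] + q [ k ]
  coeff-add []      q       k       = sym (+-identityˡ _)
  coeff-add (a ∷ p) []      k       = sym (+-identityʳ _)
  coeff-add (a ∷ p) (b ∷ q) zero    = refl
  coeff-add (a ∷ p) (b ∷ q) (suc k) = coeff-add p q k

  coeff-scale : ∀ a p k → map (a *_) p [ k ] ≈ a * p [ k ]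
  coeff-scale a []      k       = sym (zeroʳ a)
  coeff-scale a (b ∷ p) zero    = refl
  coeff-scale a (b ∷ p) (suc k) = coeff-scale a p k

  coeff-neg : ∀ p k → map (-_) p [ k ] ≈ - p [ k ]
  coeff-neg []      k       = sym -0#≈0#
  coeff-neg (b ∷ p) zero    = refl
  coeff-neg (b ∷ p) (suc k) = coeff-neg p k

  coeff-mul : ∀ p q k → (p *ₚ q) [ k ] ≈ conv (p [_]) (q [_]) k
  coeff-mul []      q k       = sym (conv-zeroˡ (q [_]) (λ _ → refl) k)
  coeff-mul (a ∷ p) q zero    = trans (coeff-add (map (a *_) q) (0# ∷ p *ₚ q) 0)
    (trans (+-identityʳ _) (coeff-scale a q 0))
  coeff-mul (a ∷ p) q (suc k) = trans (coeff-add (map (a *_) q) (0# ∷ p *ₚ q) (suc k))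
    (+-cong (coeff-scale a q (suc k)) (coeff-mul p q k))

  -- Makes the determinant lemmas applicable to the characteristic matrix itself; the degree count
  -- for χ needs its cofactors as polynomials.
  polynomialRing : CommutativeRing c ℓ
  polynomialRing = record
    { Carrier = Poly
    ; _≈_ = _≈ₚ_
    ; _+_ = _+ₚ_
    ; _*_ = _*ₚ_
    ; -_ = map (-_)
    ; 0# = []
    ; 1# = 1# ∷ []
    ; isCommutativeRing = record
      { isRing = record
        { +-isAbelianGroup = record
          { isGroup = record
            { isMonoid = record
              { isSemigroup = record
                { isMagma = record
                  { isEquivalence = record
                    { refl = λ _ → refl ; sym = λ e k → sym (e k) ; trans = λ e f k → trans (e k) (f k) }
                  ; ∙-cong = λ {p} {p′} {q} {q′} e f k → begin
                      (p +ₚ q) [ k ]       ≈⟨ coeff-add p q k ⟩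
                      p [ k ] + q [ k ]    ≈⟨ +-cong (e k) (f k) ⟩
                      p′ [ k ] + q′ [ k ]  ≈⟨ coeff-add p′ q′ k ⟨
                      (p′ +ₚ q′) [ k ]     ∎
                  }
                ; assoc = λ p q r k → begin
                    ((p +ₚ q) +ₚ r) [ k ]           ≈⟨ coeff-add (p +ₚ q) r k ⟩
                    (p +ₚ q) [ k ] + r [ k ]        ≈⟨ +-congʳ (coeff-add p q k) ⟩
                    p [ k ] + q [ k ] + r [ k ]     ≈⟨ +-assoc _ _ _ ⟩
                    p [ k ] + (q [ k ] + r [ k ])   ≈⟨ +-congˡ (coeff-add q r k) ⟨
                    p [ k ] + (q +ₚ r) [ k ]        ≈⟨ coeff-add p (q +ₚ r) k ⟨
                    (p +ₚ (q +ₚ r)) [ k ]           ∎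
                }
              ; identity = (λ p k → refl) , λ p k → trans (coeff-add p [] k) (+-identityʳ _)
              }
            ; inverse =
                (λ p k → trans (coeff-add (map (-_) p) p k) (trans (+-congʳ (coeff-neg p k)) (-‿inverseˡ _)))
              , (λ p k → trans (coeff-add p (map (-_) p) k) (trans (+-congˡ (coeff-neg p k)) (-‿inverseʳ _)))
            ; ⁻¹-cong = λ {p} {q} e k → trans (coeff-neg p k) (trans (-‿cong (e k)) (sym (coeff-neg q k)))
            }
          ; comm = λ p q k → trans (coeff-add p q k) (trans (+-comm _ _) (sym (coeff-add q p k)))
          }
        ; *-cong = λ {p} {p′} {q} {q′} → *ₚ-cong {p} {p′} {q} {q′}
        ; *-assoc = λ p q r k → begin
            ((p *ₚ q) *ₚ r) [ k ]                          ≈⟨ coeff-mul (p *ₚ q) r k ⟩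
            conv ((p *ₚ q) [_]) (r [_]) k                  ≈⟨ conv-cong (coeff-mul p q) (λ _ → refl) k ⟩
            conv (conv (p [_]) (q [_])) (r [_]) k          ≈⟨ conv-assoc (p [_]) (q [_]) (r [_]) k ⟩
            conv (p [_]) (conv (q [_]) (r [_])) k          ≈⟨ conv-cong (λ _ → refl) (coeff-mul q r) k ⟨
            conv (p [_]) ((q *ₚ r) [_]) k                  ≈⟨ coeff-mul p (q *ₚ r) k ⟨
            (p *ₚ (q *ₚ r)) [ k ]                          ∎
        ; *-identity = *ₚ-identityˡ , λ p k → trans (*ₚ-comm p (1# ∷ []) k) (*ₚ-identityˡ p k)
        ; distrib =
            (λ p q r k → begin
              (p *ₚ (q +ₚ r)) [ k ]             ≈⟨ *ₚ-comm p (q +ₚ r) k ⟩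
              ((q +ₚ r) *ₚ p) [ k ]             ≈⟨ *ₚ-distribʳ p q r k ⟩
              (q *ₚ p +ₚ r *ₚ p) [ k ]          ≈⟨ coeff-add (q *ₚ p) (r *ₚ p) k ⟩
              (q *ₚ p) [ k ] + (r *ₚ p) [ k ]   ≈⟨ +-cong (*ₚ-comm q p k) (*ₚ-comm r p k) ⟩
              (p *ₚ q) [ k ] + (p *ₚ r) [ k ]   ≈⟨ coeff-add (p *ₚ q) (p *ₚ r) k ⟨
              (p *ₚ q +ₚ p *ₚ r) [ k ]          ∎)
          , *ₚ-distribʳ
        }
      ; *-comm = *ₚ-comm
      }
    }
    where
    *ₚ-cong : ∀ {p p′ q q′} → p ≈ₚ p′ → q ≈ₚ q′ → p *ₚ q ≈ₚ p′ *ₚ q′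
    *ₚ-cong {p} {p′} {q} {q′} e f k = trans (coeff-mul p q k) (trans (conv-cong e f k) (sym (coeff-mul p′ q′ k)))

    *ₚ-comm : ∀ p q → p *ₚ q ≈ₚ q *ₚ p
    *ₚ-comm p q k = trans (coeff-mul p q k) (trans (conv-comm (p [_]) (q [_]) k) (sym (coeff-mul q p k)))

    *ₚ-identityˡ : ∀ p → (1# ∷ []) *ₚ p ≈ₚ p
    *ₚ-identityˡ p zero    = trans (coeff-mul (1# ∷ []) p 0) (*-identityˡ _)
    *ₚ-identityˡ p (suc k) = trans (coeff-mul (1# ∷ []) p (suc k))
      (trans (+-cong (*-identityˡ _) (conv-zeroˡ (p [_]) (λ _ → refl) k)) (+-identityʳ _))

    *ₚ-distribʳ : ∀ r p q → (p +ₚ q) *ₚ r ≈ₚ p *ₚ r +ₚ q *ₚ r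
    *ₚ-distribʳ r p q k = begin
      ((p +ₚ q) *ₚ r) [ k ]                              ≈⟨ coeff-mul (p +ₚ q) r k ⟩
      conv ((p +ₚ q) [_]) (r [_]) k                      ≈⟨ conv-cong (coeff-add p q) (λ _ → refl) k ⟩
      conv (λ i → p [ i ] + q [ i ]) (r [_]) k           ≈⟨ conv-distribʳ (r [_]) (p [_]) (q [_]) k ⟩
      conv (p [_]) (r [_]) k + conv (q [_]) (r [_]) k    ≈⟨ +-cong (coeff-mul p r k) (coeff-mul q r k) ⟨
      (p *ₚ r) [ k ] + (q *ₚ r) [ k ]                    ≈⟨ coeff-add (p *ₚ r) (q *ₚ r) k ⟨
      (p *ₚ r +ₚ q *ₚ r) [ k ]                           ∎

  module P = CommutativeRing polynomialRing
  module DP = Determinants polynomialRing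

  ⟦_⟧ : Poly → Carrier → Carrier
  ⟦_⟧ = eval rawRing

  eval-zero : ∀ p z → p ≈ₚ [] → ⟦ p ⟧ z ≈ 0#
  eval-zero []      z p≈0 = refl
  eval-zero (a ∷ p) z p≈0 =
    trans (+-cong (p≈0 0) (*-zero-factorʳ _ _ (eval-zero p z (p≈0 ∘ suc)))) (+-identityˡ 0#)

  eval-cong : ∀ p q {z w} → p ≈ₚ q → z ≈ w → ⟦ p ⟧ z ≈ ⟦ q ⟧ w
  eval-cong []      q       p≈q z≈w = sym (eval-zero q _ λ k → sym (p≈q k))
  eval-cong (a ∷ p) []      p≈q z≈w = eval-zero (a ∷ p) _ p≈q
  eval-cong (a ∷ p) (b ∷ q) p≈q z≈w = +-cong (p≈q 0) (*-cong z≈w (eval-cong p q (p≈q ∘ suc) z≈w))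

  eval-add : ∀ p q z → ⟦ p +ₚ q ⟧ z ≈ ⟦ p ⟧ z + ⟦ q ⟧ z
  eval-add []      q       z = sym (+-identityˡ _)
  eval-add (a ∷ p) []      z = sym (+-identityʳ _)
  eval-add (a ∷ p) (b ∷ q) z = begin
    a + b + z * ⟦ p +ₚ q ⟧ z                 ≈⟨ +-congˡ (*-congˡ (eval-add p q z)) ⟩
    a + b + z * (⟦ p ⟧ z + ⟦ q ⟧ z)          ≈⟨ +-congˡ (distribˡ _ _ _) ⟩
    a + b + (z * ⟦ p ⟧ z + z * ⟦ q ⟧ z)      ≈⟨ +-interchange _ _ _ _ ⟩
    a + z * ⟦ p ⟧ z + (b + z * ⟦ q ⟧ z)      ∎

  eval-scale : ∀ a p z → ⟦ map (a *_) p ⟧ z ≈ a * ⟦ p ⟧ z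
  eval-scale a []      z = sym (zeroʳ a)
  eval-scale a (b ∷ p) z = begin
    a * b + z * ⟦ map (a *_) p ⟧ z   ≈⟨ +-congˡ (*-congˡ (eval-scale a p z)) ⟩
    a * b + z * (a * ⟦ p ⟧ z)        ≈⟨ +-congˡ (x*yz≈y*xz _ _ _) ⟩
    a * b + a * (z * ⟦ p ⟧ z)        ≈⟨ distribˡ _ _ _ ⟨
    a * (b + z * ⟦ p ⟧ z)            ∎

  eval-mul : ∀ p q z → ⟦ p *ₚ q ⟧ z ≈ ⟦ p ⟧ z * ⟦ q ⟧ z
  eval-mul []      q z = sym (zeroˡ _)
  eval-mul (a ∷ p) q z = begin
    ⟦ map (a *_) q +ₚ (0# ∷ p *ₚ q) ⟧ z              ≈⟨ eval-add (map (a *_) q) (0# ∷ p *ₚ q) z ⟩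
    ⟦ map (a *_) q ⟧ z + (0# + z * ⟦ p *ₚ q ⟧ z)     ≈⟨ +-cong (eval-scale a q z) (+-identityˡ _) ⟩
    a * ⟦ q ⟧ z + z * ⟦ p *ₚ q ⟧ z                   ≈⟨ +-congˡ (*-congˡ (eval-mul p q z)) ⟩
    a * ⟦ q ⟧ z + z * (⟦ p ⟧ z * ⟦ q ⟧ z)            ≈⟨ +-congˡ (*-assoc _ _ _) ⟨
    a * ⟦ q ⟧ z + z * ⟦ p ⟧ z * ⟦ q ⟧ z              ≈⟨ distribʳ _ _ _ ⟨
    (a + z * ⟦ p ⟧ z) * ⟦ q ⟧ z                      ∎

  eval-neg : ∀ p z → ⟦ map (-_) p ⟧ z ≈ - ⟦ p ⟧ z
  eval-neg []      z = sym -0#≈0#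
  eval-neg (a ∷ p) z = begin
    - a + z * ⟦ map (-_) p ⟧ z    ≈⟨ +-congˡ (*-congˡ (eval-neg p z)) ⟩
    - a + z * - ⟦ p ⟧ z           ≈⟨ +-congˡ (-‿distribʳ-* _ _) ⟨
    - a + - (z * ⟦ p ⟧ z)         ≈⟨ -‿+-comm _ _ ⟩
    - (a + z * ⟦ p ⟧ z)           ∎

  eval-natural : ∀ z → PreservesOperations (polynomialRawRing rawRing) rawRing (λ p → ⟦ p ⟧ z)
  eval-natural z = record
    { +-homo = λ p q → eval-add p q z
    ; *-homo = λ p q → eval-mul p q z
    ; -‿homo = λ p → eval-neg p z
    ; 0#-homo = refl
    ; 1#-homo = trans (+-congˡ (zeroʳ z)) (+-identityʳ 1#)
    }

  X-_ : Carrier → Poly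
  X- z = - z ∷ 1# ∷ []

  eval-X- : ∀ z w → ⟦ X- z ⟧ w ≈ w - z
  eval-X- z w = begin
    - z + w * (1# + w * 0#)  ≈⟨ +-congˡ (*-congˡ (trans (+-congˡ (zeroʳ w)) (+-identityʳ 1#))) ⟩
    - z + w * 1#             ≈⟨ +-congˡ (*-identityʳ w) ⟩
    - z + w                  ≈⟨ +-comm _ _ ⟩
    w - z                    ∎

  DegreeBelow : ℕ → Poly → Set ℓ
  DegreeBelow n p = ∀ k → n ℕ.≤ k → p [ k ] ≈ 0#

  Monic : ℕ → Poly → Set ℓ
  Monic n p = p [ n ] ≈ 1# × DegreeBelow (suc n) p

  coeff-linear-mul : ∀ p q → DegreeBelow 2 p → ∀ k →
    (p *ₚ q) [ suc k ] ≈ p [ 0 ] * q [ suc k ] + p [ 1 ] * q [ k ]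
  coeff-linear-mul p q deg k = trans (coeff-mul p q (suc k)) (+-congˡ (tail k))
    where
    tail : ∀ k → conv (λ i → p [ suc i ]) (q [_]) k ≈ p [ 1 ] * q [ k ]
    tail zero    = refl
    tail (suc k) = trans (+-congˡ (conv-zeroˡ (q [_]) (λ i → deg (suc (suc i)) (s≤s (s≤s z≤n))) k)) (+-identityʳ _)

  constant-mul-degree : ∀ p q n → DegreeBelow 1 p → DegreeBelow n q → DegreeBelow n (p *ₚ q)
  constant-mul-degree p q n dp dq zero    n≤0 = trans (coeff-mul p q 0) (*-zero-factorʳ _ _ (dq 0 n≤0))
  constant-mul-degree p q n dp dq (suc k) n≤k = trans
    (coeff-linear-mul p q (λ i 2≤i → dp i (ℕ.≤-trans (ℕ.n≤1+n 1) 2≤i)) k)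
    (trans (+-cong (*-zero-factorʳ _ _ (dq (suc k) n≤k)) (*-zero-factorˡ _ _ (dp 1 ℕ.≤-refl))) (+-identityˡ 0#))

  linear-mul-degree : ∀ p q n → Monic 1 p → DegreeBelow n q → DegreeBelow (suc n) (p *ₚ q)
  linear-mul-degree p q n (_ , dp) dq (suc k) (s≤s n≤k) = trans (coeff-linear-mul p q dp k)
    (trans (+-cong (*-zero-factorʳ _ _ (dq (suc k) (ℕ.≤-trans n≤k (ℕ.n≤1+n k)))) (*-zero-factorʳ _ _ (dq k n≤k))) (+-identityˡ 0#))

  linear-mul-monic : ∀ p q n → Monic 1 p → Monic n q → Monic (suc n) (p *ₚ q)
  linear-mul-monic p q n mp@(p₁ , dp) (qₙ , dq) = leading , linear-mul-degree p q (suc n) mp dq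
    where
    leading : (p *ₚ q) [ suc n ] ≈ 1#
    leading = begin
      (p *ₚ q) [ suc n ]                        ≈⟨ coeff-linear-mul p q dp n ⟩
      p [ 0 ] * q [ suc n ] + p [ 1 ] * q [ n ] ≈⟨ +-cong (*-zero-factorʳ _ _ (dq (suc n) ℕ.≤-refl)) (*-cong p₁ qₙ) ⟩
      0# + 1# * 1#                              ≈⟨ +-identityˡ _ ⟩
      1# * 1#                                   ≈⟨ *-identityˡ _ ⟩
      1#                                        ∎

  degree-weaken : ∀ {m n} p → m ℕ.≤ n → DegreeBelow m p → DegreeBelow n p
  degree-weaken p m≤n dp k n≤k = dp k (ℕ.≤-trans m≤n n≤k)

  add-degree : ∀ p q n → DegreeBelow n p → DegreeBelow n q → DegreeBelow n (p +ₚ q)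
  add-degree p q n dp dq k n≤k = trans (coeff-add p q k) (trans (+-cong (dp k n≤k) (dq k n≤k)) (+-identityˡ 0#))

  neg-degree : ∀ p n → DegreeBelow n p → DegreeBelow n (map (-_) p)
  neg-degree p n dp k n≤k = trans (coeff-neg p k) (trans (-‿cong (dp k n≤k)) -0#≈0#)

  sum-degree : ∀ {m} (f : Fin m → Poly) n → (∀ i → DegreeBelow n (f i)) → DegreeBelow n (DP.∑ f)
  sum-degree {zero}  f n df = ≡.subst (DegreeBelow n) (≡.sym (DP.∑-empty f)) λ _ _ → refl
  sum-degree {suc m} f n df = ≡.subst (DegreeBelow n) (≡.sym (DP.∑-suc f))
    (add-degree (f zero) (DP.∑ (f ∘ suc)) n (df zero) (sum-degree (f ∘ suc) n (df ∘ suc)))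

  add-monic : ∀ p q n → Monic n p → DegreeBelow n q → Monic n (p +ₚ q)
  add-monic p q n (pₙ , dp) dq =
    trans (coeff-add p q n) (trans (+-cong pₙ (dq n ℕ.≤-refl)) (+-identityʳ 1#)) ,
    add-degree p q (suc n) dp (degree-weaken q (ℕ.n≤1+n n) dq)

  monic-cong : ∀ p q n → p ≈ₚ q → Monic n p → Monic n q
  monic-cong p q n p≈q (pₙ , dp) = trans (sym (p≈q n)) pₙ , λ k n<k → trans (sym (p≈q k)) (dp k n<k)

  -- Only diagonal entries contain the variable. Each recursion step multiplies the leading cofactor
  -- by one of them, so it stays monic, whereas the cofactor of column 1 is a combination of smaller
  -- cofactors with constant coefficients.
  cofactor-degree : ∀ {m} (G : DP.Bordered m) → (∀ k → Monic 1 (G k (suc k))) →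
    (∀ k l → l ≢ suc k → DegreeBelow 1 (G k l)) →
    Monic m (DP.cofactor G zero) × (∀ j → DegreeBelow m (DP.cofactor G (suc j)))
  cofactor-degree {zero}  G diag off = (refl , λ { (suc k) _ → refl }) , λ ()
  cofactor-degree {suc m} G diag off = linear-mul-monic (G 0F 1F) (C′ 0F) m (diag 0F) (proj₁ IH) , below
    where
    C′ = DP.cofactor (DP.shrink G)
    off′ : ∀ k l → l ≢ suc k → DegreeBelow 1 (DP.shrink G k l)
    off′ k zero    l≢ = off (suc k) zero λ ()
    off′ k (suc l) l≢ = off (suc k) (suc (suc l)) (l≢ ∘ Fin.suc-injective)
    IH = cofactor-degree (DP.shrink G) (diag ∘ suc) off′
    C′-degree : ∀ l → DegreeBelow (suc m) (C′ l)
    C′-degree zero    = proj₂ (proj₁ IH)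
    C′-degree (suc l) = degree-weaken (C′ (suc l)) (ℕ.n≤1+n m) (proj₂ IH l)
    below : ∀ j → DegreeBelow (suc m) (DP.cofactor G (suc j))
    below zero    = neg-degree (DP.∑ λ l → G 0F (punchIn 1F l) *ₚ C′ l) (suc m) (sum-degree _ (suc m) λ l →
      constant-mul-degree (G 0F (punchIn 1F l)) (C′ l) (suc m) (off 0F _ (Fin.punchInᵢ≢i 1F l)) (C′-degree l))
    below (suc j) = linear-mul-degree (G 0F 1F) (C′ (suc j)) m (diag 0F) (proj₂ IH j)

  -- Horner's scheme: the intermediate values in the evaluation at `z` are the coefficients of the
  -- quotient by X - z.
  quotient : Poly → Carrier → Poly
  quotient []      z = []
  quotient (a ∷ p) z = ⟦ p ⟧ z ∷ quotient p z

  X-monic : ∀ z → Monic 1 (X- z)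
  X-monic z = refl , λ { (suc (suc k)) _ → refl ; (suc zero) (s≤s ()) }

  division : ∀ p z → p ≈ₚ (X- z) *ₚ quotient p z +ₚ (⟦ p ⟧ z ∷ [])
  division []      z zero    = sym (trans (coeff-add ((X- z) *ₚ []) (0# ∷ []) 0)
    (trans (+-identityʳ _) (trans (coeff-mul (X- z) [] 0) (zeroʳ _))))
  division []      z (suc k) = sym (trans (coeff-add ((X- z) *ₚ []) (0# ∷ []) (suc k))
    (trans (+-identityʳ _) (trans (coeff-linear-mul (X- z) [] (proj₂ (X-monic z)) k)
      (trans (+-cong (zeroʳ _) (zeroʳ _)) (+-identityʳ 0#)))))
  division (a ∷ p) z zero    = sym (begin
    ((X- z) *ₚ Q +ₚ (a + z * e ∷ [])) [ 0 ]      ≈⟨ coeff-add ((X- z) *ₚ Q) (a + z * e ∷ []) 0 ⟩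
    ((X- z) *ₚ Q) [ 0 ] + (a + z * e)            ≈⟨ +-cong (coeff-mul (X- z) Q 0) (+-comm _ _) ⟩
    - z * e + (z * e + a)                        ≈⟨ +-assoc _ _ _ ⟨
    - z * e + z * e + a                          ≈⟨ +-congʳ (+-congʳ (-‿distribˡ-* z e)) ⟨
    - (z * e) + z * e + a                        ≈⟨ +-congʳ (-‿inverseˡ _) ⟩
    0# + a                                       ≈⟨ +-identityˡ a ⟩
    a                                            ∎)
    where
    e = ⟦ p ⟧ z
    Q = quotient (a ∷ p) z
  division (a ∷ p) z (suc k) = sym (begin
    ((X- z) *ₚ Q +ₚ (⟦ a ∷ p ⟧ z ∷ [])) [ suc k ]  ≈⟨ coeff-add ((X- z) *ₚ Q) (⟦ a ∷ p ⟧ z ∷ []) (suc k) ⟩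
    ((X- z) *ₚ Q) [ suc k ] + 0#                   ≈⟨ +-identityʳ _ ⟩
    ((X- z) *ₚ Q) [ suc k ]                        ≈⟨ coeff-linear-mul (X- z) Q (proj₂ (X-monic z)) k ⟩
    - z * q [ k ] + 1# * Q [ k ]                   ≈⟨ tail k ⟩
    ((X- z) *ₚ q) [ k ] + (e ∷ []) [ k ]           ≈⟨ coeff-add ((X- z) *ₚ q) (e ∷ []) k ⟨
    ((X- z) *ₚ q +ₚ (e ∷ [])) [ k ]                ≈⟨ division p z k ⟨
    p [ k ]                                        ∎)
    where
    e = ⟦ p ⟧ z
    q = quotient p z
    Q = e ∷ q
    tail : ∀ k → - z * q [ k ] + 1# * Q [ k ] ≈ ((X- z) *ₚ q) [ k ] + (e ∷ []) [ k ]
    tail zero    = +-cong (sym (coeff-mul (X- z) q 0)) (*-identityˡ e)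
    tail (suc k) = trans (sym (coeff-linear-mul (X- z) q (proj₂ (X-monic z)) k)) (sym (+-identityʳ _))

  division-eval : ∀ p z w → ⟦ p ⟧ w ≈ (w - z) * ⟦ quotient p z ⟧ w + ⟦ p ⟧ z
  division-eval p z w = begin
    ⟦ p ⟧ w
      ≈⟨ eval-cong p ((X- z) *ₚ quotient p z +ₚ (⟦ p ⟧ z ∷ [])) (division p z) refl ⟩
    ⟦ (X- z) *ₚ quotient p z +ₚ (⟦ p ⟧ z ∷ []) ⟧ w
      ≈⟨ eval-add ((X- z) *ₚ quotient p z) (⟦ p ⟧ z ∷ []) w ⟩
    ⟦ (X- z) *ₚ quotient p z ⟧ w + (⟦ p ⟧ z + w * 0#)
      ≈⟨ +-cong (eval-mul (X- z) (quotient p z) w) (trans (+-congˡ (zeroʳ w)) (+-identityʳ _)) ⟩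
    ⟦ X- z ⟧ w * ⟦ quotient p z ⟧ w + ⟦ p ⟧ z
      ≈⟨ +-congʳ (*-congʳ (eval-X- z w)) ⟩
    (w - z) * ⟦ quotient p z ⟧ w + ⟦ p ⟧ z ∎

  factor : ∀ p z → ⟦ p ⟧ z ≈ 0# → p ≈ₚ (X- z) *ₚ quotient p z
  factor p z root k = begin
    p [ k ]                                                  ≈⟨ division p z k ⟩
    ((X- z) *ₚ quotient p z +ₚ (⟦ p ⟧ z ∷ [])) [ k ]         ≈⟨ coeff-add ((X- z) *ₚ quotient p z) (⟦ p ⟧ z ∷ []) k ⟩
    ((X- z) *ₚ quotient p z) [ k ] + (⟦ p ⟧ z ∷ []) [ k ]    ≈⟨ +-congˡ (constant k) ⟩
    ((X- z) *ₚ quotient p z) [ k ] + 0#                      ≈⟨ +-identityʳ _ ⟩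
    ((X- z) *ₚ quotient p z) [ k ]                           ∎
    where
    constant : ∀ k → (⟦ p ⟧ z ∷ []) [ k ] ≈ 0#
    constant zero    = root
    constant (suc k) = refl

  eval-monic₀ : ∀ p z → Monic 0 p → ⟦ p ⟧ z ≈ 1#
  eval-monic₀ []      z (p₀ , _)  = p₀
  eval-monic₀ (a ∷ p) z (p₀ , dp) =
    trans (+-cong p₀ (*-zero-factorʳ _ _ (eval-zero p z λ k → dp (suc k) (s≤s z≤n)))) (+-identityʳ 1#)

  quotient-zero : ∀ p z → p ≈ₚ [] → quotient p z ≈ₚ []
  quotient-zero []      z p≈0 k       = refl
  quotient-zero (a ∷ p) z p≈0 zero    = eval-zero p z (p≈0 ∘ suc)
  quotient-zero (a ∷ p) z p≈0 (suc k) = quotient-zero p z (p≈0 ∘ suc) k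

  quotient-monic : ∀ p z n → Monic (suc n) p → Monic n (quotient p z)
  quotient-monic []      z n       (pₙ , _)  = pₙ , λ _ _ → refl
  quotient-monic (a ∷ p) z zero    (pₙ , dp) = eval-monic₀ p z (pₙ , λ k 0<k → dp (suc k) (s≤s 0<k)) ,
    λ { (suc k) _ → below p (λ i 0<i → dp (suc i) (s≤s 0<i)) k }
    where
    below : ∀ p → DegreeBelow 1 p → quotient p z ≈ₚ []
    below []      dp k       = refl
    below (a ∷ p) dp zero    = eval-zero p z λ k → dp (suc k) (s≤s z≤n)
    below (a ∷ p) dp (suc k) = quotient-zero p z (λ k → dp (suc k) (s≤s z≤n)) k
  quotient-monic (a ∷ p) z (suc n) (pₙ , dp) with quotient-monic p z n (pₙ , λ k n<k → dp (suc k) (s≤s n<k))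
  ... | qₙ , dq = qₙ , λ { (suc k) (s≤s n<k) → dq k n<k }

  ∏[X-_] : ∀ {n} → (Fin n → Carrier) → Poly
  ∏[X-_] {zero}  x = 1# ∷ []
  ∏[X-_] {suc n} x = (X- x zero) *ₚ ∏[X- x ∘ suc ]

  ∏-remove : ∀ {n} (x : Fin (suc n) → Carrier) i → ∏[X- x ] ≈ₚ (X- x i) *ₚ ∏[X- (λ j → x (punchIn i j)) ]
  ∏-remove         x zero    k = refl
  ∏-remove {suc n} x (suc i) k = trans
    (P.*-cong {X- x zero} {X- x zero} {∏[X- x ∘ suc ]} {(X- x (suc i)) *ₚ ∏[X- (λ j → x (suc (punchIn i j))) ]}
      (λ _ → refl) (∏-remove (x ∘ suc) i) k)
    (DP.x*yz≈y*xz (X- x zero) (X- x (suc i)) ∏[X- (λ j → x (suc (punchIn i j))) ] k)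

  eval-∏-cancellable : ∀ {n} (x : Fin n → Carrier) z → (∀ i → Cancellable (z - x i)) → Cancellable (⟦ ∏[X- x ] ⟧ z)
  eval-∏-cancellable {zero}  x z z#x w e = trans (sym (trans (*-congʳ (PreservesOperations.1#-homo (eval-natural z))) (*-identityˡ w))) e
  eval-∏-cancellable {suc n} x z z#x w e = eval-∏-cancellable (x ∘ suc) z (z#x ∘ suc) w (z#x zero _ (begin
    (z - x zero) * (⟦ ∏[X- x ∘ suc ] ⟧ z * w)     ≈⟨ *-assoc _ _ _ ⟨
    (z - x zero) * ⟦ ∏[X- x ∘ suc ] ⟧ z * w       ≈⟨ *-congʳ (*-congʳ (eval-X- (x zero) z)) ⟨
    ⟦ X- x zero ⟧ z * ⟦ ∏[X- x ∘ suc ] ⟧ z * w    ≈⟨ *-congʳ (eval-mul (X- x zero) ∏[X- x ∘ suc ] z) ⟨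
    ⟦ ∏[X- x ] ⟧ z * w                            ≈⟨ e ⟩
    0#                                            ∎))

  -- After X - `x zero` is split off, the quotient vanishes at every other `x j`, because the factor
  -- `x j - x zero` can be cancelled. Monicity passes to the quotients, so the last one is the
  -- constant 1.
  splitting : ∀ n p → Monic n p → (x : Fin n → Carrier) → (∀ i → ⟦ p ⟧ (x i) ≈ 0#) →
    (∀ i j → i Fin.< j → Cancellable (x j - x i)) → p ≈ₚ ∏[X- x ]
  splitting zero    p (p₀ , dp) x roots x#x zero    = p₀
  splitting zero    p (p₀ , dp) x roots x#x (suc k) = dp (suc k) (s≤s z≤n)
  splitting (suc n) p monic     x roots x#x k       = trans (factor p (x zero) (roots zero) k)
    (P.*-cong {X- x zero} {X- x zero} {q} {∏[X- x ∘ suc ]} (λ _ → refl)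
      (splitting n q (quotient-monic p (x zero) n monic) (x ∘ suc) q-roots λ i j i<j → x#x (suc i) (suc j) (s≤s i<j)) k)
    where
    q = quotient p (x zero)
    q-roots : ∀ i → ⟦ q ⟧ (x (suc i)) ≈ 0#
    q-roots i = x#x zero (suc i) (s≤s z≤n) _ (begin
      (x (suc i) - x zero) * ⟦ q ⟧ (x (suc i))                    ≈⟨ +-identityʳ _ ⟨
      (x (suc i) - x zero) * ⟦ q ⟧ (x (suc i)) + 0#               ≈⟨ +-congˡ (roots zero) ⟨
      (x (suc i) - x zero) * ⟦ q ⟧ (x (suc i)) + ⟦ p ⟧ (x zero)   ≈⟨ division-eval p (x zero) (x (suc i)) ⟨
      ⟦ p ⟧ (x (suc i))                                           ≈⟨ roots (suc i) ⟩
      0#                                                          ∎)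

  δ : ∀ {n} → Fin n → Fin n → Carrier
  δ i j = if does (i Fin.≟ j) then 1# else 0#

  δ-diagonal : ∀ {n} (i : Fin n) → δ i i ≡ 1#
  δ-diagonal i = ≡.cong (if_then 1# else 0#) (dec-true (i Fin.≟ i) ≡.refl)

  δ-off : ∀ {n} {i j : Fin n} → i ≢ j → δ i j ≡ 0#
  δ-off {i = i} {j} i≢j = ≡.cong (if_then 1# else 0#) (dec-false (i Fin.≟ j) i≢j)

  -- The matrix z·I − M, in the form in which it arises from the characteristic matrix.
  shifted : ∀ {n} → Matrix Carrier n → Carrier → Matrix Carrier n
  shifted M z i j = ⟦ charMatrix rawRing M i j ⟧ z

  shifted-entry : ∀ {n} (M : Matrix Carrier n) z i j → shifted M z i j ≈ z * δ i j - M i j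
  shifted-entry M z i j = begin
    - M i j + z * (δ i j + z * 0#)  ≈⟨ +-congˡ (*-congˡ (trans (+-congˡ (zeroʳ z)) (+-identityʳ _))) ⟩
    - M i j + z * δ i j             ≈⟨ +-comm _ _ ⟩
    z * δ i j - M i j               ∎

  shifted-diagonal : ∀ {n} (M : Matrix Carrier n) z i → shifted M z i i ≈ z - M i i
  shifted-diagonal M z i = trans (shifted-entry M z i i)
    (+-congʳ (trans (*-congˡ (reflexive (δ-diagonal i))) (*-identityʳ z)))

  shifted-off : ∀ {n} (M : Matrix Carrier n) z {i j} → i ≢ j → shifted M z i j ≈ - M i j
  shifted-off M z {i} {j} i≢j = trans (shifted-entry M z i j)
    (trans (+-congʳ (*-zero-factorʳ _ _ (reflexive (δ-off i≢j)))) (+-identityˡ _))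

  eval-charPoly : ∀ {n} (M : Matrix Carrier n) z → ⟦ charPoly rawRing M ⟧ z ≈ det rawRing (shifted M z)
  eval-charPoly M z = det-natural (polynomialRawRing rawRing) CR (eval-natural z) (charMatrix rawRing M)

  mulVec-shifted : ∀ {n} (M : Matrix Carrier n) z v i →
    mulVec rawRing (shifted M z) v i ≈ z * v i - mulVec rawRing M v i
  mulVec-shifted {suc n} M z v i = begin
    mulVec rawRing (shifted M z) v i
      ≈⟨ D.mulVec≈∑ (shifted M z) v i ⟩
    D.∑ (λ j → shifted M z i j * v j)
      ≈⟨ D.∑-remove i _ ⟩
    shifted M z i i * v i + D.∑ (λ l → shifted M z i (punchIn i l) * v (punchIn i l))
      ≈⟨ +-cong (*-congʳ (shifted-diagonal M z i)) (D.∑-cong λ l → trans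
           (*-congʳ (trans (shifted-off M z (λ i≡ → Fin.punchInᵢ≢i i l (≡.sym i≡))) (sym (-1*x≈-x _)))) (*-assoc _ _ _)) ⟩
    (z - M i i) * v i + D.∑ (λ l → - 1# * (M i (punchIn i l) * v (punchIn i l)))
      ≈⟨ +-cong ([y-z]x≈yx-zx _ _ _) (sym (D.*-distribˡ-∑ (- 1#) _)) ⟩
    z * v i - M i i * v i + - 1# * D.∑ (λ l → M i (punchIn i l) * v (punchIn i l))
      ≈⟨ +-assoc _ _ _ ⟩
    z * v i + (- (M i i * v i) + - 1# * D.∑ (λ l → M i (punchIn i l) * v (punchIn i l)))
      ≈⟨ +-congˡ (trans (+-congˡ (-1*x≈-x _)) (-‿+-comm _ _)) ⟩
    z * v i - (M i i * v i + D.∑ (λ l → M i (punchIn i l) * v (punchIn i l)))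
      ≈⟨ +-congˡ (-‿cong (D.∑-remove i (λ j → M i j * v j))) ⟨
    z * v i - D.∑ (λ j → M i j * v j)
      ≈⟨ +-congˡ (-‿cong (D.mulVec≈∑ M v i)) ⟨
    z * v i - mulVec rawRing M v i ∎

  module _ {m} (M : Matrix Carrier (suc m)) (M-triangular : D.IsTriangular (D.lowerRows M)) where
    private
      toFin≢ : ∀ {k l : Fin m} → l Fin.< k → Fin.suc k ≢ suc l
      toFin≢ l<k ≡.refl = ℕ.<-irrefl ≡.refl l<k

    shifted-triangular : ∀ z → D.IsTriangular (D.lowerRows (shifted M z))
    shifted-triangular z k l l<k =
      trans (shifted-off M z (toFin≢ l<k)) (trans (-‿cong (M-triangular k l l<k)) -0#≈0#)

    charMatrix-triangular : DP.IsTriangular (DP.lowerRows (charMatrix rawRing M))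
    charMatrix-triangular k l l<k zero          = trans (-‿cong (M-triangular k l l<k)) -0#≈0#
    charMatrix-triangular k l l<k (suc zero)    = reflexive (δ-off (toFin≢ l<k))
    charMatrix-triangular k l l<k (suc (suc i)) = refl

    -- In the expansion along the first row only the corner entry times the leading cofactor reaches
    -- degree `suc m`; every other product is a constant times something of lower degree.
    charPoly-monic : Monic (suc m) (charPoly rawRing M)
    charPoly-monic = monic-cong expansion (charPoly rawRing M) (suc m) (λ k → sym (expand k))
      (add-monic (N zero zero *ₚ C zero) (DP.∑ λ j → N zero (suc j) *ₚ C (suc j)) (suc m)
        (linear-mul-monic (N zero zero) (C zero) m (diagonal zero) (proj₁ C-degree))
        (sum-degree _ (suc m) λ j → constant-mul-degree (N zero (suc j)) (C (suc j)) (suc m) (off (λ ()))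
          (degree-weaken (C (suc j)) (ℕ.n≤1+n m) (proj₂ C-degree j))))
      where
      N = charMatrix rawRing M
      C = DP.cofactor (DP.lowerRows N)
      expansion = N zero zero *ₚ C zero +ₚ (DP.∑ λ j → N zero (suc j) *ₚ C (suc j))
      expand : charPoly rawRing M ≈ₚ expansion
      expand k = trans (DP.det-cofactor N charMatrix-triangular k)
        (reflexive (≡.cong (_[ k ]) (DP.∑-suc λ j → N zero j *ₚ C j)))
      diagonal : ∀ i → Monic 1 (N i i)
      diagonal i = reflexive (δ-diagonal i) , λ { (suc zero) (s≤s ()) ; (suc (suc k)) _ → refl }
      off : ∀ {i j} → i ≢ j → DegreeBelow 1 (N i j)
      off i≢j (suc zero)    _ = reflexive (δ-off i≢j)
      off i≢j (suc (suc k)) _ = refl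
      C-degree = cofactor-degree (DP.lowerRows N) (diagonal ∘ suc) λ k l l≢ → off (λ k≡l → l≢ (≡.sym k≡l))

    -- Used to exclude eigenvalues: where χ(z) is cancellable, every such `v` is zero.
    eigenvector-annihilated : ∀ z v → (∀ i → mulVec rawRing M v i ≈ z * v i) →
      ∀ i → ⟦ charPoly rawRing M ⟧ z * v i ≈ 0#
    eigenvector-annihilated z v Mv≈zv i = trans (*-congʳ (eval-charPoly M z))
      (D.det-kernel (shifted M z) (shifted-triangular z) v (λ k → begin
        mulVec rawRing (shifted M z) v k    ≈⟨ mulVec-shifted M z v k ⟩
        z * v k - mulVec rawRing M v k      ≈⟨ +-congˡ (-‿cong (Mv≈zv k)) ⟩
        z * v k - z * v k                   ≈⟨ -‿inverseʳ _ ⟩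
        0#                                  ∎) i)

    cofactor₀-cancellable : ∀ {m} (G : D.Bordered m) → (∀ k → Cancellable (G k (suc k))) → Cancellable (D.cofactor G zero)
    cofactor₀-cancellable {zero}  G diag w e = trans (sym (*-identityˡ w)) e
    cofactor₀-cancellable {suc m} G diag w e =
      cofactor₀-cancellable (D.shrink G) (diag ∘ suc) w (diag zero _ (trans (sym (*-assoc _ _ _)) e))

    -- The cofactor vector is an eigenvector. It is not zero because its first entry is the product
    -- of the differences between `z` and the diagonal entries below the first row, hence
    -- cancellable.
    root-isEigenvalue : ¬ (1# ≈ 0#) → ∀ z → (∀ k → Cancellable (z - M (suc k) (suc k))) →
      ⟦ charPoly rawRing M ⟧ z ≈ 0# → IsEigenvalue rawRing M z
    root-isEigenvalue 1≉0 z z#M root = C ,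
      (λ C≈0 → 1≉0 (cofactor₀-cancellable (D.lowerRows (shifted M z))
        (λ k w e → z#M k w (trans (*-congʳ (sym (shifted-diagonal M z (suc k)))) e)) 1#
        (*-zero-factorˡ _ _ (C≈0 zero)))) ,
      λ i → sym (x∙y⁻¹≈ε⇒x≈y _ _ (trans (sym (mulVec-shifted M z C i))
        (D.mulVec-cofactor (shifted M z) (shifted-triangular z) (trans (sym (eval-charPoly M z)) root) i)))
      where
      C = D.cofactor (D.lowerRows (shifted M z))

-- Rational inequalities, real and complex numbers

0≤q-p : ∀ {p q} → p ℚ.≤ q → 0ℚ ℚ.≤ q ℚ.- p
0≤q-p {p} {q} p≤q = ≡.subst (ℚ._≤ q ℚ.- p) (ℚ.+-inverseʳ p) (ℚ.+-monoˡ-≤ (ℚ.- p) p≤q)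

0<q-p : ∀ {p q} → p ℚ.< q → 0ℚ ℚ.< q ℚ.- p
0<q-p {p} {q} p<q = ≡.subst (ℚ._< q ℚ.- p) (ℚ.+-inverseʳ p) (ℚ.+-monoˡ-< (ℚ.- p) p<q)

-- Linear inequalities are proved by exhibiting the difference q − p as a nonnegative r; the
-- required equation is then left to the ring solver.
≤-by : ∀ {p q} r → 0ℚ ℚ.≤ r → p ℚ.+ r ≡ q → p ℚ.≤ q
≤-by {p} r 0≤r eq = ≡.subst₂ ℚ._≤_ (ℚ.+-identityʳ p) eq (ℚ.+-monoʳ-≤ p 0≤r)

<-by : ∀ {p q} r → 0ℚ ℚ.< r → p ℚ.+ r ≡ q → p ℚ.< q
<-by {p} r 0<r eq = ≡.subst₂ ℚ._<_ (ℚ.+-identityʳ p) eq (ℚ.+-monoʳ-< p 0<r)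

0≤+ : ∀ {p q} → 0ℚ ℚ.≤ p → 0ℚ ℚ.≤ q → 0ℚ ℚ.≤ p ℚ.+ q
0≤+ = ℚ.+-mono-≤

0<+ : ∀ {p q} → 0ℚ ℚ.< p → 0ℚ ℚ.≤ q → 0ℚ ℚ.< p ℚ.+ q
0<+ = ℚ.+-mono-<-≤

0≤* : ∀ {p q} → 0ℚ ℚ.≤ p → 0ℚ ℚ.≤ q → 0ℚ ℚ.≤ p ℚ.* q
0≤* {p} {q} 0≤p 0≤q = ≡.subst (ℚ._≤ p ℚ.* q) (ℚ.*-zeroʳ p) (ℚ.*-monoˡ-≤-nonNeg p {{ℚ.nonNegative 0≤p}} 0≤q)

0<* : ∀ {p q} → 0ℚ ℚ.< p → 0ℚ ℚ.< q → 0ℚ ℚ.< p ℚ.* q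
0<* {p} {q} 0<p 0<q = ≡.subst (ℚ._< p ℚ.* q) (ℚ.*-zeroʳ p) (ℚ.*-monoʳ-<-pos p {{ℚ.positive 0<p}} 0<q)

p≤∣p∣ : ∀ p → p ℚ.≤ ℚ.∣ p ∣
p≤∣p∣ p with ℚ.≤-total 0ℚ p
... | inj₁ 0≤p = ℚ.≤-reflexive (≡.sym (ℚ.0≤p⇒∣p∣≡p 0≤p))
... | inj₂ p≤0 = ℚ.≤-trans p≤0 (ℚ.0≤∣p∣ p)

-p≤∣p∣ : ∀ p → ℚ.- p ℚ.≤ ℚ.∣ p ∣
-p≤∣p∣ p = ≡.subst (ℚ.- p ℚ.≤_) (ℚ.∣-p∣≡∣p∣ p) (p≤∣p∣ (ℚ.- p))

∣p∣≤ : ∀ {p q} → p ℚ.≤ q → ℚ.- p ℚ.≤ q → ℚ.∣ p ∣ ℚ.≤ q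
∣p∣≤ {p} {q} p≤q -p≤q with ℚ.∣p∣≡p∨∣p∣≡-p p
... | inj₁ eq = ≡.subst (ℚ._≤ q) (≡.sym eq) p≤q
... | inj₂ eq = ≡.subst (ℚ._≤ q) (≡.sym eq) -p≤q

p*p≡∣p∣*∣p∣ : ∀ p → p ℚ.* p ≡ ℚ.∣ p ∣ ℚ.* ℚ.∣ p ∣
p*p≡∣p∣*∣p∣ p with ℚ.∣p∣≡p∨∣p∣≡-p p
... | inj₁ eq = ≡.sym (≡.cong₂ ℚ._*_ eq eq)
... | inj₂ eq = ≡.trans (ℚS.solve 1 (λ p → p ℚS.:* p ℚS.:= (ℚS.:- p) ℚS.:* (ℚS.:- p)) ≡.refl p) (≡.sym (≡.cong₂ ℚ._*_ eq eq))

0≤p*p : ∀ p → 0ℚ ℚ.≤ p ℚ.* p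
0≤p*p p = ≡.subst (0ℚ ℚ.≤_) (≡.sym (p*p≡∣p∣*∣p∣ p)) (0≤* (ℚ.0≤∣p∣ p) (ℚ.0≤∣p∣ p))

infix 4 _∼_

-- `_≈ℝ_` on bare sequences: it applies to termwise expressions such as χ of the terms of `x`
-- without a Cauchy proof for them.
_∼_ : (ℕ → ℚ) → (ℕ → ℚ) → Set
s ∼ t = ∀ ε → 0ℚ ℚ.< ε → ∃[ N ] (∀ n → N ℕ.≤ n → ℚ.∣ s n ℚ.- t n ∣ ℚ.< ε)

∼-reflexive : ∀ {s t} → (∀ n → s n ≡ t n) → s ∼ t
∼-reflexive {s} {t} s≡t ε 0<ε = 0 , λ n _ → ≡.subst (ℚ._< ε)
  (≡.cong ℚ.∣_∣ (≡.trans (≡.sym (ℚ.+-inverseʳ (t n))) (≡.cong (ℚ._- t n) (≡.sym (s≡t n))))) 0<ε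

∼-sym : ∀ {s t} → s ∼ t → t ∼ s
∼-sym {s} {t} e ε 0<ε with e ε 0<ε
... | N , h = N , λ n N≤n → ≡.subst (ℚ._< ε)
  (≡.trans (≡.sym (ℚ.∣-p∣≡∣p∣ (s n ℚ.- t n))) (≡.cong ℚ.∣_∣ (flip (s n) (t n)))) (h n N≤n)
  where
  flip : ∀ a b → ℚ.- (a ℚ.- b) ≡ b ℚ.- a
  flip = ℚS.solve 2 (λ a b → ℚS.:- (a ℚS.:- b) ℚS.:= b ℚS.:- a) ≡.refl

∼-trans : ∀ {s t u} → s ∼ t → t ∼ u → s ∼ u
∼-trans {s} {t} {u} e f ε 0<ε with e (½ ℚ.* ε) (half-pos ε 0<ε) | f (½ ℚ.* ε) (half-pos ε 0<ε)
... | M , g | N , h = M ℕ.⊔ N , λ n ≤n → ≡.subst (λ v → ℚ.∣ v ∣ ℚ.< ε) (telescope (s n) (t n) (u n))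
  (sum-< (s n ℚ.- t n) (t n ℚ.- u n) ε (g n (≤-⊔ˡ ≤n)) (h n (≤-⊔ʳ {M} ≤n)))
  where
  telescope : ∀ a b c → (a ℚ.- b) ℚ.+ (b ℚ.- c) ≡ a ℚ.- c
  telescope = ℚS.solve 3 (λ a b c → (a ℚS.:- b) ℚS.:+ (b ℚS.:- c) ℚS.:= a ℚS.:- c) ≡.refl

∼-+ : ∀ {s s′ t t′} → s ∼ s′ → t ∼ t′ → (λ n → s n ℚ.+ t n) ∼ (λ n → s′ n ℚ.+ t′ n)
∼-+ {s} {s′} {t} {t′} e f ε 0<ε with e (½ ℚ.* ε) (half-pos ε 0<ε) | f (½ ℚ.* ε) (half-pos ε 0<ε)
... | M , g | N , h = M ℕ.⊔ N , λ n ≤n → ≡.subst (λ v → ℚ.∣ v ∣ ℚ.< ε) (rearrange (s n) (s′ n) (t n) (t′ n))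
  (sum-< (s n ℚ.- s′ n) (t n ℚ.- t′ n) ε (g n (≤-⊔ˡ ≤n)) (h n (≤-⊔ʳ {M} ≤n)))
  where
  rearrange : ∀ a b c d → (a ℚ.- b) ℚ.+ (c ℚ.- d) ≡ (a ℚ.+ c) ℚ.- (b ℚ.+ d)
  rearrange = ℚS.solve 4 (λ a b c d → (a ℚS.:- b) ℚS.:+ (c ℚS.:- d) ℚS.:= (a ℚS.:+ c) ℚS.:- (b ℚS.:+ d)) ≡.refl

∼-neg : ∀ {s t} → s ∼ t → (λ n → ℚ.- s n) ∼ (λ n → ℚ.- t n)
∼-neg {s} {t} e ε 0<ε with e ε 0<ε
... | N , h = N , λ n N≤n → ≡.subst (ℚ._< ε)
  (≡.trans (≡.sym (ℚ.∣-p∣≡∣p∣ (s n ℚ.- t n))) (≡.cong ℚ.∣_∣ (ℚ.neg-distrib-+ (s n) (ℚ.- t n)))) (h n N≤n)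

∼-* : ∀ {s s′ t t′} → IsCauchy s → IsCauchy t′ → s ∼ s′ → t ∼ t′ → (λ n → s n ℚ.* t n) ∼ (λ n → s′ n ℚ.* t′ n)
∼-* {s} {s′} {t} {t′} cs ct′ e f ε 0<ε =
  let B , 0<B , M₁ , s≤B = eventually-bounded cs
      C , 0<C , M₂ , t≤C = eventually-bounded ct′
      δ , 0<δ , Bδ       = scale B (½ ℚ.* ε) 0<B (half-pos ε 0<ε)
      γ , 0<γ , Cγ       = scale C (½ ℚ.* ε) 0<C (half-pos ε 0<ε)
      N₁ , g             = e γ 0<γ
      N₂ , h             = f δ 0<δ
  in (M₁ ℕ.⊔ M₂) ℕ.⊔ (N₁ ℕ.⊔ N₂) , λ n ≤n →
    let ≤M = ≤-⊔ˡ {M₁ ℕ.⊔ M₂} {N₁ ℕ.⊔ N₂} ≤n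
        ≤N = ≤-⊔ʳ {M₁ ℕ.⊔ M₂} {N₁ ℕ.⊔ N₂} ≤n
    in *-close B C δ γ ε (s n) (s′ n) (t n) (t′ n) 0<B 0<C Bδ Cγ
      (s≤B n (≤-⊔ˡ {M₁} {M₂} ≤M)) (t≤C n (≤-⊔ʳ {M₁} {M₂} ≤M))
      (g n (≤-⊔ˡ {N₁} {N₂} ≤N)) (h n (≤-⊔ʳ {N₁} {N₂} ≤N))

ℝ-ring : CommutativeRing 0ℓ 0ℓ
ℝ-ring = record
  { RawRing ℝ-rawRing
  ; isCommutativeRing = record
    { isRing = record
      { +-isAbelianGroup = record
        { isGroup = record
          { isMonoid = record
            { isSemigroup = record
              { isMagma = record
                { isEquivalence = record
                  { refl = λ {x} → ∼-reflexive {seq x} λ _ → ≡.refl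
                  ; sym = λ {x} {y} → ∼-sym {seq x} {seq y}
                  ; trans = λ {x} {y} {z} → ∼-trans {seq x} {seq y} {seq z}
                  }
                ; ∙-cong = λ {x} {x′} {y} {y′} → ∼-+ {seq x} {seq x′} {seq y} {seq y′}
                }
              ; assoc = λ x y z → ∼-reflexive λ n → ℚ.+-assoc (seq x n) (seq y n) (seq z n)
              }
            ; identity = (λ x → ∼-reflexive λ n → ℚ.+-identityˡ (seq x n))
                       , (λ x → ∼-reflexive λ n → ℚ.+-identityʳ (seq x n))
            }
          ; inverse = (λ x → ∼-reflexive λ n → ℚ.+-inverseˡ (seq x n))
                    , (λ x → ∼-reflexive λ n → ℚ.+-inverseʳ (seq x n))
          ; ⁻¹-cong = λ {x} {y} → ∼-neg {seq x} {seq y}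
          }
        ; comm = λ x y → ∼-reflexive λ n → ℚ.+-comm (seq x n) (seq y n)
        }
      ; *-cong = λ {x} {x′} {y} {y′} → ∼-* {seq x} {seq x′} {seq y} {seq y′} (cauchy x) (cauchy y′)
      ; *-assoc = λ x y z → ∼-reflexive λ n → ℚ.*-assoc (seq x n) (seq y n) (seq z n)
      ; *-identity = (λ x → ∼-reflexive λ n → ℚ.*-identityˡ (seq x n))
                   , (λ x → ∼-reflexive λ n → ℚ.*-identityʳ (seq x n))
      ; distrib = (λ x y z → ∼-reflexive λ n → ℚ.*-distribˡ-+ (seq x n) (seq y n) (seq z n))
                , (λ x y z → ∼-reflexive λ n → ℚ.*-distribʳ-+ (seq x n) (seq y n) (seq z n))
      }
    ; *-comm = λ x y → ∼-reflexive λ n → ℚ.*-comm (seq x n) (seq y n)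
    }
  }

module ℝ-ring = CommutativeRing ℝ-ring

∼-reflexive² : ∀ {s t s′ t′} → (∀ n → s n ≡ t n) → (∀ n → s′ n ≡ t′ n) → (s ∼ t) × (s′ ∼ t′)
∼-reflexive² e f = ∼-reflexive e , ∼-reflexive f

ℂ-ring : CommutativeRing 0ℓ 0ℓ
ℂ-ring = record
  { RawRing ℂ-rawRing
  ; isCommutativeRing = record
    { isRing = record
      { +-isAbelianGroup = record
        { isGroup = record
          { isMonoid = record
            { isSemigroup = record
              { isMagma = record
                { isEquivalence = record
                  { refl = λ {z} → ℝ-ring.refl {re z} , ℝ-ring.refl {im z}
                  ; sym = λ {z} {w} (e , f) → ℝ-ring.sym {re z} {re w} e , ℝ-ring.sym {im z} {im w} f
                  ; trans = λ {z} {w} {u} (e , f) (e′ , f′) →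
                      ℝ-ring.trans {re z} {re w} {re u} e e′ , ℝ-ring.trans {im z} {im w} {im u} f f′
                  }
                ; ∙-cong = λ {z} {z′} {w} {w′} (e , f) (e′ , f′) →
                    ℝ-ring.+-cong {re z} {re z′} {re w} {re w′} e e′ , ℝ-ring.+-cong {im z} {im z′} {im w} {im w′} f f′
                }
              ; assoc = λ z w u → ∼-reflexive² (λ n → ℚ.+-assoc (seq (re z) n) _ _) (λ n → ℚ.+-assoc (seq (im z) n) _ _)
              }
            ; identity = (λ z → ∼-reflexive² (λ n → ℚ.+-identityˡ (seq (re z) n)) (λ n → ℚ.+-identityˡ (seq (im z) n)))
                       , (λ z → ∼-reflexive² (λ n → ℚ.+-identityʳ (seq (re z) n)) (λ n → ℚ.+-identityʳ (seq (im z) n)))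
            }
          ; inverse = (λ z → ∼-reflexive² (λ n → ℚ.+-inverseˡ (seq (re z) n)) (λ n → ℚ.+-inverseˡ (seq (im z) n)))
                    , (λ z → ∼-reflexive² (λ n → ℚ.+-inverseʳ (seq (re z) n)) (λ n → ℚ.+-inverseʳ (seq (im z) n)))
          ; ⁻¹-cong = λ {z} {w} (e , f) → ℝ-ring.-‿cong {re z} {re w} e , ℝ-ring.-‿cong {im z} {im w} f
          }
        ; comm = λ z w → ∼-reflexive² (λ n → ℚ.+-comm (seq (re z) n) _) (λ n → ℚ.+-comm (seq (im z) n) _)
        }
      ; *-cong = λ {z} {z′} {w} {w′} → *-cong {z} {z′} {w} {w′}
      ; *-assoc = λ z w u → ∼-reflexive²
          (λ n → assoc-re (seq (re z) n) (seq (im z) n) (seq (re w) n) (seq (im w) n) (seq (re u) n) (seq (im u) n))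
          (λ n → assoc-im (seq (re z) n) (seq (im z) n) (seq (re w) n) (seq (im w) n) (seq (re u) n) (seq (im u) n))
      ; *-identity = (λ z → ∼-reflexive² (λ n → id-re (seq (re z) n) (seq (im z) n)) (λ n → id-im (seq (re z) n) (seq (im z) n)))
                   , (λ z → ∼-reflexive² (λ n → id-re′ (seq (re z) n) (seq (im z) n)) (λ n → id-im′ (seq (re z) n) (seq (im z) n)))
      ; distrib = (λ z w u → ∼-reflexive²
          (λ n → distˡ-re (seq (re z) n) (seq (im z) n) (seq (re w) n) (seq (im w) n) (seq (re u) n) (seq (im u) n))
          (λ n → distˡ-im (seq (re z) n) (seq (im z) n) (seq (re w) n) (seq (im w) n) (seq (re u) n) (seq (im u) n)))
        , (λ z w u → ∼-reflexive²
          (λ n → distʳ-re (seq (re z) n) (seq (im z) n) (seq (re w) n) (seq (im w) n) (seq (re u) n) (seq (im u) n))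
          (λ n → distʳ-im (seq (re z) n) (seq (im z) n) (seq (re w) n) (seq (im w) n) (seq (re u) n) (seq (im u) n)))
      }
    ; *-comm = λ z w → ∼-reflexive²
        (λ n → comm-re (seq (re z) n) (seq (im z) n) (seq (re w) n) (seq (im w) n))
        (λ n → comm-im (seq (re z) n) (seq (im z) n) (seq (re w) n) (seq (im w) n))
    }
  }
  where
  open RawRing ℂ-rawRing using (_*_)
  open ℚS using (solve; _:+_; _:*_; :-_; _:=_; con)
  *-cong : ∀ {z z′ w w′} → z ≈ℂ z′ → w ≈ℂ w′ → z * w ≈ℂ z′ * w′
  *-cong {a +i b} {a′ +i b′} {c +i d} {c′ +i d′} (e , f) (e′ , f′) =
    ℝ-ring.+-cong {a ℝ-ring.* c} {a′ ℝ-ring.* c′} {ℝ-ring.- (b ℝ-ring.* d)} {ℝ-ring.- (b′ ℝ-ring.* d′)}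
      (ℝ-ring.*-cong {a} {a′} {c} {c′} e e′)
      (ℝ-ring.-‿cong {b ℝ-ring.* d} {b′ ℝ-ring.* d′} (ℝ-ring.*-cong {b} {b′} {d} {d′} f f′)) ,
    ℝ-ring.+-cong {a ℝ-ring.* d} {a′ ℝ-ring.* d′} {b ℝ-ring.* c} {b′ ℝ-ring.* c′}
      (ℝ-ring.*-cong {a} {a′} {d} {d′} e f′) (ℝ-ring.*-cong {b} {b′} {c} {c′} f e′)
  assoc-re = solve 6 (λ a b c d e f →
    (a :* c :+ :- (b :* d)) :* e :+ :- ((a :* d :+ b :* c) :* f) :=
    a :* (c :* e :+ :- (d :* f)) :+ :- (b :* (c :* f :+ d :* e))) ≡.refl
  assoc-im = solve 6 (λ a b c d e f →
    (a :* c :+ :- (b :* d)) :* f :+ (a :* d :+ b :* c) :* e :=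
    a :* (c :* f :+ d :* e) :+ b :* (c :* e :+ :- (d :* f))) ≡.refl
  id-re = solve 2 (λ a b → con 1ℚ :* a :+ :- (con 0ℚ :* b) := a) ≡.refl
  id-im = solve 2 (λ a b → con 1ℚ :* b :+ con 0ℚ :* a := b) ≡.refl
  id-re′ = solve 2 (λ a b → a :* con 1ℚ :+ :- (b :* con 0ℚ) := a) ≡.refl
  id-im′ = solve 2 (λ a b → a :* con 0ℚ :+ b :* con 1ℚ := b) ≡.refl
  distˡ-re = solve 6 (λ a b c d e f → a :* (c :+ e) :+ :- (b :* (d :+ f)) :=
    (a :* c :+ :- (b :* d)) :+ (a :* e :+ :- (b :* f))) ≡.refl
  distˡ-im = solve 6 (λ a b c d e f → a :* (d :+ f) :+ b :* (c :+ e) :=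
    (a :* d :+ b :* c) :+ (a :* f :+ b :* e)) ≡.refl
  distʳ-re = solve 6 (λ a b c d e f → (c :+ e) :* a :+ :- ((d :+ f) :* b) :=
    (c :* a :+ :- (d :* b)) :+ (e :* a :+ :- (f :* b))) ≡.refl
  distʳ-im = solve 6 (λ a b c d e f → (c :+ e) :* b :+ (d :+ f) :* a :=
    (c :* b :+ d :* a) :+ (e :* b :+ f :* a)) ≡.refl
  comm-re = solve 4 (λ a b c d → a :* c :+ :- (b :* d) := c :* a :+ :- (d :* b)) ≡.refl
  comm-im = solve 4 (λ a b c d → a :* d :+ b :* c := c :* b :+ d :* a) ≡.refl

module ℂ-ring = CommutativeRing ℂ-ring

module ℂ-polynomials = Polynomials ℂ-ring
module ℝ-polynomials = Polynomials ℝ-ring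

open Determinants ℂ-ring using (Cancellable)

-- Apartness from zero and cancellation

Null : (ℕ → ℚ) → Set
Null s = ∀ ε → 0ℚ ℚ.< ε → ∃[ N ] (∀ n → N ℕ.≤ n → ℚ.∣ s n ∣ ℚ.< ε)

Null⇒∼0 : ∀ {s} → Null s → s ∼ (λ _ → 0ℚ)
Null⇒∼0 {s} null ε 0<ε with null ε 0<ε
... | N , h = N , λ n N≤n → ≡.subst (λ v → ℚ.∣ v ∣ ℚ.< ε) (≡.sym (ℚ.+-identityʳ (s n))) (h n N≤n)

∼0⇒Null : ∀ {s} → s ∼ (λ _ → 0ℚ) → Null s
∼0⇒Null {s} e ε 0<ε with e ε 0<ε
... | N , h = N , λ n N≤n → ≡.subst (λ v → ℚ.∣ v ∣ ℚ.< ε) (ℚ.+-identityʳ (s n)) (h n N≤n)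

-- Positive form of a nonzero limit: the bound is an explicit rational, from which quantitative
-- estimates can start.
Away : (ℕ → ℚ) → Set
Away s = Σ[ ε ∈ ℚ ] 0ℚ ℚ.< ε × ∃[ N ] (∀ n → N ℕ.≤ n → ε ℚ.≤ ℚ.∣ s n ∣)

-- Whether the limit is zero cannot be decided, but one rational comparison can: beyond `N` the
-- terms differ by less than ε/4, so comparing the single term at `N` with ε/2 settles the whole
-- tail.
away-or-small : ∀ {s} → IsCauchy s → ∀ ε → 0ℚ ℚ.< ε → Away s ⊎ ∃[ N ] (∀ n → N ℕ.≤ n → ℚ.∣ s n ∣ ℚ.< ε)
away-or-small {s} cs ε 0<ε with cs (½ ℚ.* (½ ℚ.* ε)) (half-pos _ (half-pos ε 0<ε))
... | N , h with ℚ.∣ s N ∣ ℚ.<? ½ ℚ.* ε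
... | yes small = inj₂ (N , λ n N≤n → ≡.subst (λ v → ℚ.∣ v ∣ ℚ.< ε) (cancel (s n) (s N))
    (sum-< (s n ℚ.- s N) (s N) ε (ℚ.<-trans (h n N N≤n ℕ.≤-refl) η<δ) small))
  where
  η = ½ ℚ.* (½ ℚ.* ε)
  η<δ : η ℚ.< ½ ℚ.* ε
  η<δ = <-by η (half-pos _ (half-pos ε 0<ε)) (halves (½ ℚ.* ε))
  cancel : ∀ a b → (a ℚ.- b) ℚ.+ b ≡ a
  cancel = solve 2 (λ a b → (a :- b) :+ b := a) ≡.refl
... | no big = inj₁ (η , half-pos _ (half-pos ε 0<ε) , N , λ n N≤n →
    let d = ℚ.∣ s N ℚ.- s n ∣
        δ≤ : η ℚ.+ η ℚ.≤ d ℚ.+ ℚ.∣ s n ∣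
        δ≤ = ℚ.≤-trans (ℚ.≤-trans (ℚ.≤-reflexive (halves (½ ℚ.* ε))) (ℚ.≮⇒≥ big))
               (≡.subst (λ v → ℚ.∣ v ∣ ℚ.≤ d ℚ.+ ℚ.∣ s n ∣) (cancel (s N) (s n)) (ℚ.∣p+q∣≤∣p∣+∣q∣ (s N ℚ.- s n) (s n)))
    in ≤-by ((d ℚ.+ ℚ.∣ s n ∣ ℚ.- (η ℚ.+ η)) ℚ.+ (η ℚ.- d))
         (0≤+ (0≤q-p δ≤) (0≤q-p (ℚ.<⇒≤ (h N n ℕ.≤-refl N≤n)))) (arith η d ℚ.∣ s n ∣))
  where
  η = ½ ℚ.* (½ ℚ.* ε)
  cancel : ∀ a b → (a ℚ.- b) ℚ.+ b ≡ a
  cancel = solve 2 (λ a b → (a :- b) :+ b := a) ≡.refl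
  arith : ∀ η d a → η ℚ.+ ((d ℚ.+ a ℚ.- (η ℚ.+ η)) ℚ.+ (η ℚ.- d)) ≡ a
  arith = solve 3 (λ η d a → η :+ ((d :+ a :- (η :+ η)) :+ (η :- d)) := a) ≡.refl

-- Tightness of apartness: the dichotomy holds for each ε separately, and its first alternative is
-- refuted.
¬away⇒null : ∀ {s} → IsCauchy s → ¬ Away s → Null s
¬away⇒null cs ¬away ε 0<ε with away-or-small cs ε 0<ε
... | inj₁ away  = contradiction away ¬away
... | inj₂ small = small

away-cancel : ∀ {s t} → Away s → Null (λ n → s n ℚ.* t n) → Null t
away-cancel {s} {t} (δ , 0<δ , M , δ≤s) null ε 0<ε with null (δ ℚ.* ε) (0<* 0<δ 0<ε)
... | N , h = M ℕ.⊔ N , λ n ≤n → ℚ.*-cancelˡ-<-nonNeg δ {{ℚ.nonNegative (ℚ.<⇒≤ 0<δ)}} (ℚ.≤-<-trans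
  (ℚ.*-monoʳ-≤-nonNeg ℚ.∣ t n ∣ {{ℚ.∣-∣-nonNeg (t n)}} (δ≤s n (≤-⊔ˡ ≤n)))
  (≡.subst (ℚ._< δ ℚ.* ε) (ℚ.∣p*q∣≡∣p∣*∣q∣ (s n) (t n)) (h n (≤-⊔ʳ {M} ≤n))))

away-square : ∀ {s t} → Away s → (∀ n → s n ℚ.* s n ℚ.≤ t n) → Away t
away-square {s} {t} (δ , 0<δ , N , δ≤s) s²≤t = δ ℚ.* δ , 0<* 0<δ 0<δ , N , λ n N≤n →
  let a = ℚ.∣ s n ∣
      δ≤a = δ≤s n N≤n
  in ℚ.≤-trans
    (≤-by ((a ℚ.- δ) ℚ.* (a ℚ.+ δ)) (0≤* (0≤q-p δ≤a) (0≤+ (ℚ.0≤∣p∣ (s n)) (ℚ.<⇒≤ 0<δ))) (arith δ a))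
    (ℚ.≤-trans (ℚ.≤-reflexive (≡.sym (p*p≡∣p∣*∣p∣ (s n)))) (ℚ.≤-trans (s²≤t n) (p≤∣p∣ (t n))))
  where
  arith : ∀ δ a → δ ℚ.* δ ℚ.+ (a ℚ.- δ) ℚ.* (a ℚ.+ δ) ≡ a ℚ.* a
  arith = solve 2 (λ δ a → δ :* δ :+ (a :- δ) :* (a :+ δ) := a :* a) ≡.refl

-- Multiplying z w ≈ 0 by the conjugate of z gives ∣z∣² w ≈ 0.
norm-cancellable : ∀ z → Away (λ n → seq (re z) n ℚ.* seq (re z) n ℚ.+ seq (im z) n ℚ.* seq (im z) n) → Cancellable z
norm-cancellable z away w (zw-re , zw-im) =
  Null⇒∼0 {seq (re w)} (away-cancel {norm} {seq (re w)} away (∼0⇒Null {λ n → norm n ℚ.* seq (re w) n}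
    (∼-trans {λ n → norm n ℚ.* seq (re w) n} {seq (re z * re zw + im z * im zw)} {λ _ → 0ℚ}
    (∼-reflexive λ n → norm-re (seq (re z) n) (seq (im z) n) (seq (re w) n) (seq (im w) n))
    (vanish (re z) (re zw) (im z) (im zw) zw-re zw-im)))) ,
  Null⇒∼0 {seq (im w)} (away-cancel {norm} {seq (im w)} away (∼0⇒Null {λ n → norm n ℚ.* seq (im w) n}
    (∼-trans {λ n → norm n ℚ.* seq (im w) n} {seq (re z * im zw + (- im z) * re zw)} {λ _ → 0ℚ}
    (∼-reflexive λ n → norm-im (seq (re z) n) (seq (im z) n) (seq (re w) n) (seq (im w) n))
    (vanish (re z) (im zw) (- im z) (re zw) zw-im zw-re))))
  where
  open ℝ-ring using (_*_; _+_; -_; 0#)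
  norm : ℕ → ℚ
  norm n = seq (re z) n ℚ.* seq (re z) n ℚ.+ seq (im z) n ℚ.* seq (im z) n
  zw : ℂ
  zw = z ℂ-ring.* w
  vanish : ∀ a b c d → b ≈ℝ 0# → d ≈ℝ 0# → a * b + c * d ≈ℝ 0#
  vanish a b c d b≈0 d≈0 = ℝ-ring.trans {a * b + c * d} {0# + 0#} {0#}
    (ℝ-ring.+-cong {a * b} {0#} {c * d} {0#} (DR.*-zero-factorʳ a b b≈0) (DR.*-zero-factorʳ c d d≈0))
    (ℝ-ring.+-identityˡ 0#)
    where module DR = Determinants ℝ-ring
  norm-re = solve 4 (λ a b c d → (a :* a :+ b :* b) :* c := a :* (a :* c :+ :- (b :* d)) :+ b :* (a :* d :+ b :* c)) ≡.refl
  norm-im = solve 4 (λ a b c d → (a :* a :+ b :* b) :* d := a :* (a :* d :+ b :* c) :+ (:- b) :* (a :* c :+ :- (b :* d))) ≡.refl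

away-re-cancellable : ∀ z → Away (seq (re z)) → Cancellable z
away-re-cancellable z away = norm-cancellable z (away-square {seq (re z)} away λ n →
  ≤-by (seq (im z) n ℚ.* seq (im z) n) (0≤p*p (seq (im z) n)) ≡.refl)

away-im-cancellable : ∀ z → Away (seq (im z)) → Cancellable z
away-im-cancellable z away = norm-cancellable z (away-square {seq (im z)} away λ n →
  ≤-by (seq (re z) n ℚ.* seq (re z) n) (0≤p*p (seq (re z) n)) (ℚ.+-comm (seq (im z) n ℚ.* seq (im z) n) _))

-- Turns a refutation into an equation: apartness of either coordinate from zero would already make
-- `z` cancellable.
¬cancellable⇒≈0 : ∀ z → ¬ Cancellable z → z ≈ℂ ℝ→ℂ (fromℚ 0ℚ)
¬cancellable⇒≈0 z ¬c =
  Null⇒∼0 {seq (re z)} (¬away⇒null (cauchy (re z)) (¬c ∘ away-re-cancellable z)) ,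
  Null⇒∼0 {seq (im z)} (¬away⇒null (cauchy (im z)) (¬c ∘ away-im-cancellable z))

-- The strict order of the reals

∣p∣<⇒p< : ∀ {p q} → ℚ.∣ p ∣ ℚ.< q → p ℚ.< q
∣p∣<⇒p< {p} h = ℚ.≤-<-trans (p≤∣p∣ p) h

∣p∣<⇒-p< : ∀ {p q} → ℚ.∣ p ∣ ℚ.< q → ℚ.- p ℚ.< q
∣p∣<⇒-p< {p} h = ℚ.≤-<-trans (-p≤∣p∣ p) h

<ℝ-respˡ : ∀ {x x′ y} → x ≈ℝ x′ → x <ℝ y → x′ <ℝ y
<ℝ-respˡ {x} {x′} {y} x≈x′ (ε , 0<ε , M , x<y) with x≈x′ (½ ℚ.* ε) (half-pos ε 0<ε)
... | N , h = ½ ℚ.* ε , half-pos ε 0<ε , M ℕ.⊔ N , λ n ≤n →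
  let a = seq x n
      a′ = seq x′ n
      b = seq y n
      δ = ½ ℚ.* ε
      x<y′ : a ℚ.+ (δ ℚ.+ δ) ℚ.< b
      x<y′ = ≡.subst (λ e → a ℚ.+ e ℚ.< b) (≡.sym (halves ε)) (x<y n (≤-⊔ˡ ≤n))
  in <-by ((b ℚ.- (a ℚ.+ (δ ℚ.+ δ))) ℚ.+ (δ ℚ.- (ℚ.- (a ℚ.- a′))))
       (0<+ (0<q-p x<y′) (0≤q-p (ℚ.<⇒≤ (∣p∣<⇒-p< (h n (≤-⊔ʳ {M} ≤n)))))) (arith a a′ b δ)
  where
  arith : ∀ a a′ b δ → a′ ℚ.+ δ ℚ.+ ((b ℚ.- (a ℚ.+ (δ ℚ.+ δ))) ℚ.+ (δ ℚ.- (ℚ.- (a ℚ.- a′)))) ≡ b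
  arith = solve 4 (λ a a′ b δ → a′ :+ δ :+ ((b :- (a :+ (δ :+ δ))) :+ (δ :- (:- (a :- a′)))) := b) ≡.refl

<ℝ-respʳ : ∀ {x y y′} → y ≈ℝ y′ → x <ℝ y → x <ℝ y′
<ℝ-respʳ {x} {y} {y′} y≈y′ (ε , 0<ε , M , x<y) with y≈y′ (½ ℚ.* ε) (half-pos ε 0<ε)
... | N , h = ½ ℚ.* ε , half-pos ε 0<ε , M ℕ.⊔ N , λ n ≤n →
  let a = seq x n
      b = seq y n
      b′ = seq y′ n
      δ = ½ ℚ.* ε
      x<y′ : a ℚ.+ (δ ℚ.+ δ) ℚ.< b
      x<y′ = ≡.subst (λ e → a ℚ.+ e ℚ.< b) (≡.sym (halves ε)) (x<y n (≤-⊔ˡ ≤n))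
  in <-by ((b ℚ.- (a ℚ.+ (δ ℚ.+ δ))) ℚ.+ (δ ℚ.- (b ℚ.- b′)))
       (0<+ (0<q-p x<y′) (0≤q-p (ℚ.<⇒≤ (∣p∣<⇒p< (h n (≤-⊔ʳ {M} ≤n)))))) (arith a b b′ δ)
  where
  arith : ∀ a b b′ δ → a ℚ.+ δ ℚ.+ ((b ℚ.- (a ℚ.+ (δ ℚ.+ δ))) ℚ.+ (δ ℚ.- (b ℚ.- b′))) ≡ b′
  arith = solve 4 (λ a b b′ δ → a :+ δ :+ ((b :- (a :+ (δ :+ δ))) :+ (δ :- (b :- b′))) := b′) ≡.refl

<ℝ-trans : ∀ {x y z} → x <ℝ y → y <ℝ z → x <ℝ z
<ℝ-trans {x} {y} {z} (ε , 0<ε , M , x<y) (δ , 0<δ , N , y<z) = ε , 0<ε , M ℕ.⊔ N , λ n ≤n →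
  ℚ.<-trans (x<y n (≤-⊔ˡ ≤n)) (ℚ.<-trans (<-by δ 0<δ ≡.refl) (y<z n (≤-⊔ʳ {M} ≤n)))

<ℝ-irrefl : ∀ {x} → ¬ x <ℝ x
<ℝ-irrefl {x} (ε , 0<ε , N , x<x) = ℚ.<-irrefl ≡.refl (ℚ.<-trans (<-by ε 0<ε ≡.refl) (x<x N ℕ.≤-refl))

<ℝ-≤ : ∀ {x p q} → x <ℝ fromℚ p → p ℚ.≤ q → x <ℝ fromℚ q
<ℝ-≤ (ε , 0<ε , N , x<p) p≤q = ε , 0<ε , N , λ n N≤n → ℚ.<-≤-trans (x<p n N≤n) p≤q

≤-<ℝ : ∀ {p q x} → p ℚ.≤ q → fromℚ q <ℝ x → fromℚ p <ℝ x
≤-<ℝ p≤q (ε , 0<ε , N , q<x) = ε , 0<ε , N , λ n N≤n → ℚ.≤-<-trans (ℚ.+-monoˡ-≤ ε p≤q) (q<x n N≤n)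

<ℝ⇒away : ∀ {x y} → x <ℝ y → Away (λ n → seq y n ℚ.- seq x n)
<ℝ⇒away {x} {y} (ε , 0<ε , N , x<y) = ε , 0<ε , N , λ n N≤n → ℚ.≤-trans
  (≤-by (seq y n ℚ.- (seq x n ℚ.+ ε)) (0≤q-p (ℚ.<⇒≤ (x<y n N≤n))) (arith (seq x n) (seq y n) ε)) (p≤∣p∣ (seq y n ℚ.- seq x n))
  where
  arith : ∀ a b ε → ε ℚ.+ (b ℚ.- (a ℚ.+ ε)) ≡ b ℚ.- a
  arith = solve 3 (λ a b ε → ε :+ (b :- (a :+ ε)) := b :- a) ≡.refl

away-flip : ∀ {s t : ℕ → ℚ} → Away (λ n → s n ℚ.- t n) → Away (λ n → t n ℚ.- s n)
away-flip {s} {t} (ε , 0<ε , N , h) = ε , 0<ε , N , λ n N≤n → ≡.subst (ε ℚ.≤_)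
  (≡.trans (≡.sym (ℚ.∣-p∣≡∣p∣ (s n ℚ.- t n))) (≡.cong ℚ.∣_∣ (flip (s n) (t n)))) (h n N≤n)
  where
  flip : ∀ a b → ℚ.- (a ℚ.- b) ≡ b ℚ.- a
  flip = solve 2 (λ a b → :- (a :- b) := b :- a) ≡.refl

-- Replaces trichotomy. If `z` is not recognised as apart from `x`, it is within half the gap of `x`
-- and so lies below `y` by the other half.
away-cotransitive : ∀ {x y} → x <ℝ y → ∀ z → Away (λ n → seq z n ℚ.- seq x n) ⊎ Away (λ n → seq z n ℚ.- seq y n)
away-cotransitive {x} {y} (ε , 0<ε , M , x<y) z
  with away-or-small (+-cauchy {seq z} (cauchy z) (neg-cauchy {seq x} (cauchy x))) (½ ℚ.* ε) (half-pos ε 0<ε)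
... | inj₁ away    = inj₁ away
... | inj₂ (N , h) = inj₂ (away-flip {seq y} {seq z} (<ℝ⇒away {z} {y} (½ ℚ.* ε , half-pos ε 0<ε , M ℕ.⊔ N , λ n ≤n →
  let a = seq x n
      b = seq y n
      c = seq z n
      δ = ½ ℚ.* ε
      x<y′ : a ℚ.+ (δ ℚ.+ δ) ℚ.< b
      x<y′ = ≡.subst (λ e → a ℚ.+ e ℚ.< b) (≡.sym (halves ε)) (x<y n (≤-⊔ˡ ≤n))
  in <-by ((b ℚ.- (a ℚ.+ (δ ℚ.+ δ))) ℚ.+ (δ ℚ.- (c ℚ.- a)))
       (0<+ (0<q-p x<y′) (0≤q-p (ℚ.<⇒≤ (∣p∣<⇒p< (h n (≤-⊔ʳ {M} ≤n)))))) (arith a b c δ))))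
  where
  arith : ∀ a b c δ → c ℚ.+ δ ℚ.+ ((b ℚ.- (a ℚ.+ (δ ℚ.+ δ))) ℚ.+ (δ ℚ.- (c ℚ.- a))) ≡ b
  arith = solve 4 (λ a b c δ → c :+ δ :+ ((b :- (a :+ (δ :+ δ))) :+ (δ :- (c :- a))) := b) ≡.refl

-- If the product tends to a nonzero `c` and `t` is eventually bounded by B, then `s` has absolute
-- value at least ∣c∣/(2B) eventually.
factor-away : ∀ {s t} → IsCauchy t → ∀ c → 0ℚ ℚ.< ℚ.∣ c ∣ → (λ n → s n ℚ.* t n) ∼ (λ _ → c) → Away s
factor-away {s} {t} ct c 0<c e =
  let B , 0<B , M , t≤B = eventually-bounded ct
      γ = ½ ℚ.* ℚ.∣ c ∣
      0<γ = half-pos ℚ.∣ c ∣ 0<c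
      N , h = e γ 0<γ
      δ , 0<δ , Bδ = scale B γ 0<B 0<γ
  in δ , 0<δ , M ℕ.⊔ N , λ n ≤n →
    let a = ℚ.∣ s n ∣
        b = ℚ.∣ t n ∣
        d = ℚ.∣ s n ℚ.* t n ℚ.- c ∣
        c≤ : γ ℚ.+ γ ℚ.≤ d ℚ.+ a ℚ.* b
        c≤ = ℚ.≤-trans (ℚ.≤-reflexive (halves ℚ.∣ c ∣)) (ℚ.≤-trans
          (≡.subst (λ v → ℚ.∣ v ∣ ℚ.≤ ℚ.∣ s n ℚ.* t n ∣ ℚ.+ d) (cancel (s n ℚ.* t n) c) (ℚ.∣p-q∣≤∣p∣+∣q∣ (s n ℚ.* t n) (s n ℚ.* t n ℚ.- c)))
          (ℚ.≤-reflexive (≡.trans (ℚ.+-comm _ d) (≡.cong (d ℚ.+_) (ℚ.∣p*q∣≡∣p∣*∣q∣ (s n) (t n))))))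
        γ≤ : γ ℚ.≤ a ℚ.* b
        γ≤ = ≤-by ((d ℚ.+ a ℚ.* b ℚ.- (γ ℚ.+ γ)) ℚ.+ (γ ℚ.- d))
          (0≤+ (0≤q-p c≤) (0≤q-p (ℚ.<⇒≤ (h n (≤-⊔ʳ {M} ≤n))))) (arith γ d (a ℚ.* b))
    in ℚ.*-cancelˡ-≤-pos B {{ℚ.positive 0<B}} (ℚ.≤-trans (ℚ.≤-reflexive Bδ) (ℚ.≤-trans γ≤
      (ℚ.≤-trans (ℚ.*-monoˡ-≤-nonNeg a {{ℚ.∣-∣-nonNeg (s n)}} (t≤B n (≤-⊔ˡ ≤n))) (ℚ.≤-reflexive (ℚ.*-comm a B)))))
  where
  cancel : ∀ a b → a ℚ.- (a ℚ.- b) ≡ b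
  cancel = solve 2 (λ a b → a :- (a :- b) := b) ≡.refl
  arith : ∀ η d a → η ℚ.+ ((d ℚ.+ a ℚ.- (η ℚ.+ η)) ℚ.+ (η ℚ.- d)) ≡ a
  arith = solve 3 (λ η d a → η :+ ((d :+ a :- (η :+ η)) :+ (η :- d)) := a) ≡.refl

-- Bisection

ι : ℕ → ℚ
ι n = ℤ.+ n ℚ./ 1

abstract
  ι-+ : ∀ m n → ι (m ℕ.+ n) ≡ ι m ℚ.+ ι n
  ι-+ m n = ℚ.toℚᵘ-injective (ℚᵘ.≃-trans (ℚ.toℚᵘ-fromℚᵘ (ℚᵘ.mkℚᵘ (ℤ.+ (m ℕ.+ n)) 0)) (ℚᵘ.≃-sym
    (ℚᵘ.≃-trans (ℚ.toℚᵘ-homo-+ (ι m) (ι n)) (ℚᵘ.≃-trans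
      (ℚᵘ.+-cong (ℚ.toℚᵘ-fromℚᵘ (ℚᵘ.mkℚᵘ (ℤ.+ m) 0)) (ℚ.toℚᵘ-fromℚᵘ (ℚᵘ.mkℚᵘ (ℤ.+ n) 0)))
      (ℚᵘ.*≡* (≡.cong (ℤ._* ℤ.1ℤ) (≡.cong₂ ℤ._+_ (ℤ.*-identityʳ (ℤ.+ m)) (ℤ.*-identityʳ (ℤ.+ n)))))))))

  ι-* : ∀ m n → ι (m ℕ.* n) ≡ ι m ℚ.* ι n
  ι-* zero    n = ≡.sym (ℚ.*-zeroˡ (ι n))
  ι-* (suc m) n = begin
    ι (n ℕ.+ m ℕ.* n)          ≡⟨ ι-+ n (m ℕ.* n) ⟩
    ι n ℚ.+ ι (m ℕ.* n)        ≡⟨ ≡.cong (ι n ℚ.+_) (ι-* m n) ⟩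
    ι n ℚ.+ ι m ℚ.* ι n        ≡⟨ factor-out (ι m) (ι n) ⟩
    (1ℚ ℚ.+ ι m) ℚ.* ι n       ≡⟨ ≡.cong (ℚ._* ι n) (ι-+ 1 m) ⟨
    ι (suc m) ℚ.* ι n          ∎
    where
    open ≡.≡-Reasoning
    factor-out : ∀ a b → b ℚ.+ a ℚ.* b ≡ (1ℚ ℚ.+ a) ℚ.* b
    factor-out = solve 2 (λ a b → b :+ a :* b := (con 1ℚ :+ a) :* b) ≡.refl

  0≤ι : ∀ n → 0ℚ ℚ.≤ ι n
  0≤ι n = ℚ.nonNegative⁻¹ (ι n) {{ℚ.normalize-nonNeg n 1}}

  ι-≤ : ∀ {m n} → m ℕ.≤ n → ι m ℚ.≤ ι n
  ι-≤ {m} {n} m≤n = ≤-by (ι (n ℕ.∸ m)) (0≤ι (n ℕ.∸ m))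
    (≡.trans (≡.sym (ι-+ m (n ℕ.∸ m))) (≡.cong ι (ℕ.m+[n∸m]≡n m≤n)))

  ι-< : ∀ {m n} → m ℕ.< n → ι m ℚ.< ι n
  ι-< {m} m<n = ℚ.<-≤-trans (<-by 1ℚ (ℚ.positive⁻¹ 1ℚ) (≡.trans (ℚ.+-comm (ι m) 1ℚ) (≡.sym (ι-+ 1 m)))) (ι-≤ m<n)

  archimedean : ∀ q → ∃[ N ] (q ℚ.≤ ι N)
  -- The denominator is at least 1, so the absolute value of the numerator is large enough.
  archimedean q@(mkℚ num d _) = ℤ.∣ num ∣ , ℚ.toℚᵘ-cancel-≤ (ℚᵘ.≤-respʳ-≃
    (ℚᵘ.≃-sym (ℚ.toℚᵘ-fromℚᵘ (ℚᵘ.mkℚᵘ (ℤ.+ ℤ.∣ num ∣) 0)))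
    (ℚᵘ.*≤* (≤-numerator num)))
    where
    ≤-numerator : ∀ num → num ℤ.* ℤ.+ 1 ℤ.≤ ℤ.+ ℤ.∣ num ∣ ℤ.* ℤ.+ suc d
    ≤-numerator (ℤ.+ n)    = ≡.subst₂ ℤ._≤_ (ℤ.pos-* n 1) (ℤ.pos-* n (suc d)) (ℤ.+≤+ (ℕ.*-monoʳ-≤ n (s≤s z≤n)))
    ≤-numerator (ℤ.-[1+ n ]) = ℤ.-≤+

2⁻_ : ℕ → ℚ
2⁻ zero  = 1ℚ
2⁻ suc n = ½ ℚ.* 2⁻ n

abstract
  0<2⁻ : ∀ n → 0ℚ ℚ.< 2⁻ n
  0<2⁻ zero    = ℚ.positive⁻¹ 1ℚ
  0<2⁻ (suc n) = half-pos (2⁻ n) (0<2⁻ n)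

  -- The crude bound 2^n ≥ n + 1; together with the Archimedean property it makes the widths of
  -- bisection arbitrarily small.
  2⁻n*[1+n]≤1 : ∀ n → 2⁻ n ℚ.* ι (suc n) ℚ.≤ 1ℚ
  2⁻n*[1+n]≤1 zero    = ℚ.≤-refl
  2⁻n*[1+n]≤1 (suc n) = ≡.subst (λ v → 2⁻ suc n ℚ.* v ℚ.≤ 1ℚ)
    (≡.trans (≡.cong (1ℚ ℚ.+_) (≡.sym (ι-+ 1 n))) (≡.sym (ι-+ 1 (suc n))))
    (step (2⁻ n) (ι n) (ℚ.<⇒≤ (0<2⁻ n)) (0≤ι n) (≡.subst (λ v → 2⁻ n ℚ.* v ℚ.≤ 1ℚ) (ι-+ 1 n) (2⁻n*[1+n]≤1 n)))
    where
    arith : ∀ P m → ½ ℚ.* P ℚ.* (1ℚ ℚ.+ (1ℚ ℚ.+ m)) ℚ.+ ((1ℚ ℚ.- P ℚ.* (1ℚ ℚ.+ m)) ℚ.+ ½ ℚ.* (P ℚ.* m)) ≡ 1ℚ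
    arith = solve 2 (λ P m → con ½ :* P :* (con 1ℚ :+ (con 1ℚ :+ m)) :+ ((con 1ℚ :- P :* (con 1ℚ :+ m)) :+ con ½ :* (P :* m)) := con 1ℚ) ≡.refl
    step : ∀ P m → 0ℚ ℚ.≤ P → 0ℚ ℚ.≤ m → P ℚ.* (1ℚ ℚ.+ m) ℚ.≤ 1ℚ → ½ ℚ.* P ℚ.* (1ℚ ℚ.+ (1ℚ ℚ.+ m)) ℚ.≤ 1ℚ
    step P m 0≤P 0≤m h = ≤-by ((1ℚ ℚ.- P ℚ.* (1ℚ ℚ.+ m)) ℚ.+ ½ ℚ.* (P ℚ.* m))
      (0≤+ (0≤q-p h) (0≤* (ℚ.<⇒≤ (ℚ.positive⁻¹ ½)) (0≤* 0≤P 0≤m))) (arith P m)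

  2⁻-null : ∀ c ε → 0ℚ ℚ.< c → 0ℚ ℚ.< ε → ∃[ N ] (2⁻ N ℚ.* c ℚ.< ε)
  2⁻-null c ε 0<c 0<ε =
    let δ , 0<δ , εδ≡c = scale ε c 0<ε 0<c
        N , δ≤N = archimedean δ
        P = 2⁻ N
        PN<1 : P ℚ.* ι N ℚ.< 1ℚ
        PN<1 = ℚ.<-≤-trans (ℚ.*-monoʳ-<-pos P {{ℚ.positive (0<2⁻ N)}} (ι-< (ℕ.n<1+n N))) (2⁻n*[1+n]≤1 N)
        Pδ<1 : P ℚ.* δ ℚ.< 1ℚ
        Pδ<1 = ℚ.≤-<-trans (ℚ.*-monoˡ-≤-nonNeg P {{ℚ.nonNegative (ℚ.<⇒≤ (0<2⁻ N))}} δ≤N) PN<1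
    in N , ≡.subst₂ ℚ._<_ (≡.trans (rearrange ε P δ) (≡.cong (P ℚ.*_) εδ≡c)) (ℚ.*-identityʳ ε)
      (ℚ.*-monoʳ-<-pos ε {{ℚ.positive 0<ε}} Pδ<1)
    where
    rearrange : ∀ ε P δ → ε ℚ.* (P ℚ.* δ) ≡ P ℚ.* (ε ℚ.* δ)
    rearrange = solve 3 (λ ε P δ → ε :* (P :* δ) := P :* (ε :* δ)) ≡.refl

-- Runs on rational arguments and rational values, because the midpoint test must be decidable.
module Bisection (g : ℚ → ℚ) (a b : ℚ) (a<b : a ℚ.< b) (ga≤0 : g a ℚ.≤ 0ℚ) (0≤gb : 0ℚ ℚ.≤ g b) where

  record Bracket (c : ℚ) : Set where
    field
      lower upper : ℚ
      width : upper ≡ lower ℚ.+ c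
      lower-value : g lower ℚ.≤ 0ℚ
      upper-value : 0ℚ ℚ.≤ g upper
  open Bracket

  bisect : ∀ {c} → 0ℚ ℚ.≤ c → (B : Bracket c) →
    Σ[ B′ ∈ Bracket (½ ℚ.* c) ] (lower B ℚ.≤ lower B′ × upper B′ ℚ.≤ upper B)
  bisect {c} 0≤c B with g (lower B ℚ.+ ½ ℚ.* c) ℚ.≤? 0ℚ
  ... | yes gm≤0 = record
      { lower = lower B ℚ.+ ½ ℚ.* c ; upper = upper B
      ; width = ≡.trans (width B) (≡.trans (≡.cong (lower B ℚ.+_) (≡.sym (halves c))) (≡.sym (ℚ.+-assoc (lower B) _ _)))
      ; lower-value = gm≤0 ; upper-value = upper-value B }
    , ≤-by (½ ℚ.* c) (0≤* (ℚ.<⇒≤ (ℚ.positive⁻¹ ½)) 0≤c) ≡.refl , ℚ.≤-refl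
  ... | no gm≰0 = record
      { lower = lower B ; upper = lower B ℚ.+ ½ ℚ.* c
      ; width = ≡.refl
      ; lower-value = lower-value B ; upper-value = ℚ.<⇒≤ (ℚ.≰⇒> gm≰0) }
    , ℚ.≤-refl , ≤-by (½ ℚ.* c) (0≤* (ℚ.<⇒≤ (ℚ.positive⁻¹ ½)) 0≤c)
        (≡.trans (≡.trans (ℚ.+-assoc (lower B) _ _) (≡.cong (lower B ℚ.+_) (halves c))) (≡.sym (width B)))

  size : ℕ → ℚ
  size zero    = b ℚ.- a
  size (suc n) = ½ ℚ.* size n

  0<size : ∀ n → 0ℚ ℚ.< size n
  0<size zero    = 0<q-p a<b
  0<size (suc n) = half-pos (size n) (0<size n)

  size≡ : ∀ n → size n ≡ 2⁻ n ℚ.* (b ℚ.- a)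
  size≡ zero    = ≡.sym (ℚ.*-identityˡ (b ℚ.- a))
  size≡ (suc n) = ≡.trans (≡.cong (½ ℚ.*_) (size≡ n)) (≡.sym (ℚ.*-assoc ½ (2⁻ n) (b ℚ.- a)))

  bracket : ∀ n → Bracket (size n)
  bracket zero    = record { lower = a ; upper = b ; width = arith a b ; lower-value = ga≤0 ; upper-value = 0≤gb }
    where
    arith : ∀ a b → b ≡ a ℚ.+ (b ℚ.- a)
    arith = solve 2 (λ a b → b := a :+ (b :- a)) ≡.refl
  bracket (suc n) = proj₁ (bisect (ℚ.<⇒≤ (0<size n)) (bracket n))

  l u : ℕ → ℚ
  l n = lower (bracket n)
  u n = upper (bracket n)

  l≤u : ∀ n → l n ℚ.≤ u n
  l≤u n = ≤-by (size n) (ℚ.<⇒≤ (0<size n)) (≡.sym (width (bracket n)))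

  l-mono : ∀ {m n} → m ℕ.≤′ n → l m ℚ.≤ l n
  l-mono ℕ.≤′-refl = ℚ.≤-refl
  l-mono {n = suc n} (ℕ.≤′-step m≤n) = ℚ.≤-trans (l-mono m≤n) (proj₁ (proj₂ (bisect (ℚ.<⇒≤ (0<size n)) (bracket n))))

  u-mono : ∀ {m n} → m ℕ.≤′ n → u n ℚ.≤ u m
  u-mono ℕ.≤′-refl = ℚ.≤-refl
  u-mono {n = suc n} (ℕ.≤′-step m≤n) = ℚ.≤-trans (proj₂ (proj₂ (bisect (ℚ.<⇒≤ (0<size n)) (bracket n)))) (u-mono m≤n)

  size-small : ∀ ε → 0ℚ ℚ.< ε → ∃[ N ] (size N ℚ.< ε)
  size-small ε 0<ε with 2⁻-null (b ℚ.- a) ε (0<q-p a<b) 0<ε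
  ... | N , h = N , ≡.subst (ℚ._< ε) (≡.sym (size≡ N)) h

  close : ∀ N p q → l N ℚ.≤ p → p ℚ.≤ u N → l N ℚ.≤ q → q ℚ.≤ u N → ℚ.∣ p ℚ.- q ∣ ℚ.≤ size N
  close N p q l≤p p≤u l≤q q≤u = ∣p∣≤
    (≤-by ((l N ℚ.+ size N ℚ.- p) ℚ.+ (q ℚ.- l N)) (0≤+ (0≤q-p (p≤′ p≤u)) (0≤q-p l≤q)) (arith₁ (l N) (size N) p q))
    (≤-by ((l N ℚ.+ size N ℚ.- q) ℚ.+ (p ℚ.- l N)) (0≤+ (0≤q-p (p≤′ q≤u)) (0≤q-p l≤p)) (arith₂ (l N) (size N) p q))
    where
    p≤′ : ∀ {p} → p ℚ.≤ u N → p ℚ.≤ l N ℚ.+ size N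
    p≤′ {p} = ≡.subst (p ℚ.≤_) (width (bracket N))
    arith₁ : ∀ l c p q → p ℚ.- q ℚ.+ ((l ℚ.+ c ℚ.- p) ℚ.+ (q ℚ.- l)) ≡ c
    arith₁ = solve 4 (λ l c p q → p :- q :+ ((l :+ c :- p) :+ (q :- l)) := c) ≡.refl
    arith₂ : ∀ l c p q → ℚ.- (p ℚ.- q) ℚ.+ ((l ℚ.+ c ℚ.- q) ℚ.+ (p ℚ.- l)) ≡ c
    arith₂ = solve 4 (λ l c p q → :- (p :- q) :+ ((l :+ c :- q) :+ (p :- l)) := c) ≡.refl

  l-inside : ∀ {N n} → N ℕ.≤ n → l N ℚ.≤ l n × l n ℚ.≤ u N
  l-inside {N} {n} N≤n = l-mono (ℕ.≤⇒≤′ N≤n) , ℚ.≤-trans (l≤u n) (u-mono (ℕ.≤⇒≤′ N≤n))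

  u-inside : ∀ {N n} → N ℕ.≤ n → l N ℚ.≤ u n × u n ℚ.≤ u N
  u-inside {N} {n} N≤n = ℚ.≤-trans (l-mono (ℕ.≤⇒≤′ N≤n)) (l≤u n) , u-mono (ℕ.≤⇒≤′ N≤n)

  l-close-l : ∀ N m n → N ℕ.≤ m → N ℕ.≤ n → ℚ.∣ l m ℚ.- l n ∣ ℚ.≤ size N
  l-close-l N m n N≤m N≤n = close N (l m) (l n) (proj₁ m-inside) (proj₂ m-inside) (proj₁ n-inside) (proj₂ n-inside)
    where
    m-inside = l-inside {N} {m} N≤m
    n-inside = l-inside {N} {n} N≤n

  u-close-u : ∀ N m n → N ℕ.≤ m → N ℕ.≤ n → ℚ.∣ u m ℚ.- u n ∣ ℚ.≤ size N
  u-close-u N m n N≤m N≤n = close N (u m) (u n) (proj₁ m-inside) (proj₂ m-inside) (proj₁ n-inside) (proj₂ n-inside)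
    where
    m-inside = u-inside {N} {m} N≤m
    n-inside = u-inside {N} {n} N≤n

  l-close-u : ∀ N n → N ℕ.≤ n → ℚ.∣ l n ℚ.- u n ∣ ℚ.≤ size N
  l-close-u N n N≤n = close N (l n) (u n) (proj₁ l-in) (proj₂ l-in) (proj₁ u-in) (proj₂ u-in)
    where
    l-in = l-inside {N} {n} N≤n
    u-in = u-inside {N} {n} N≤n

  l-cauchy : IsCauchy l
  l-cauchy ε 0<ε = proj₁ N-small , λ m n N≤m N≤n → ℚ.≤-<-trans (l-close-l (proj₁ N-small) m n N≤m N≤n) (proj₂ N-small)
    where N-small = size-small ε 0<ε

  u-cauchy : IsCauchy u
  u-cauchy ε 0<ε = proj₁ N-small , λ m n N≤m N≤n → ℚ.≤-<-trans (u-close-u (proj₁ N-small) m n N≤m N≤n) (proj₂ N-small)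
    where N-small = size-small ε 0<ε

  root : ℝ
  root = mkℝ l l-cauchy

  a≤root : ∀ n → a ℚ.≤ seq root n
  a≤root n = l-mono {0} {n} (ℕ.≤⇒≤′ z≤n)

  root≤b : ∀ n → seq root n ℚ.≤ b
  root≤b n = ℚ.≤-trans (l≤u n) (u-mono {0} {n} (ℕ.≤⇒≤′ z≤n))

  l≈u : root ≈ℝ mkℝ u u-cauchy
  l≈u ε 0<ε = proj₁ N-small , λ n N≤n → ℚ.≤-<-trans (l-close-u (proj₁ N-small) n N≤n) (proj₂ N-small)
    where N-small = size-small ε 0<ε

  -- Both endpoint sequences represent the root, so by continuity the values of `g` on them differ
  -- by a null sequence. As these values lie on opposite sides of zero, each is bounded by the
  -- difference.
  root-value : (∀ x y → x ≈ℝ y → (g ∘ seq x) ∼ (g ∘ seq y)) → Null (g ∘ seq root)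
  root-value g-continuous ε 0<ε = proj₁ N-small , λ n N≤n → ℚ.≤-<-trans
    (bound (g (l n)) (g (u n)) (lower-value (bracket n)) (upper-value (bracket n))) (proj₂ N-small n N≤n)
    where
    N-small = g-continuous root (mkℝ u u-cauchy) l≈u ε 0<ε
    bound : ∀ p q → p ℚ.≤ 0ℚ → 0ℚ ℚ.≤ q → ℚ.∣ p ∣ ℚ.≤ ℚ.∣ p ℚ.- q ∣
    bound p q p≤0 0≤q = ℚ.≤-trans
      (∣p∣≤ (≤-by (q ℚ.+ (0ℚ ℚ.- p) ℚ.+ (0ℚ ℚ.- p)) (0≤+ (0≤+ 0≤q (0≤q-p p≤0)) (0≤q-p p≤0)) (arith₀ p q)) (≤-by q 0≤q (arith p q)))
      (-p≤∣p∣ (p ℚ.- q))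
      where
      arith : ∀ p q → ℚ.- p ℚ.+ q ≡ ℚ.- (p ℚ.- q)
      arith = solve 2 (λ p q → :- p :+ q := :- (p :- q)) ≡.refl
      arith₀ : ∀ p q → p ℚ.+ (q ℚ.+ (0ℚ ℚ.- p) ℚ.+ (0ℚ ℚ.- p)) ≡ ℚ.- (p ℚ.- q)
      arith₀ = solve 2 (λ p q → p :+ (q :+ (con 0ℚ :- p) :+ (con 0ℚ :- p)) := :- (p :- q)) ≡.refl

-- Signs of cofactors

module ℚ-determinants = Determinants ℚ.+-*-commutativeRing
module ℚ-polynomials = Polynomials ℚ.+-*-commutativeRing
open ℚ-determinants using (∑; ∑-empty; ∑-suc; ∑-cong; *-distribˡ-∑; Bordered; shrink; cofactor; lowerRows; det-cofactor)
open ℚ-polynomials using (shifted; shifted-diagonal; shifted-off; shifted-triangular)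

∑-nonneg : ∀ {n} (f : Fin n → ℚ) → (∀ i → 0ℚ ℚ.≤ f i) → 0ℚ ℚ.≤ ∑ f
∑-nonneg {zero}  f 0≤f = ℚ.≤-reflexive (≡.sym (∑-empty f))
∑-nonneg {suc n} f 0≤f = ≡.subst (0ℚ ℚ.≤_) (≡.sym (∑-suc f)) (0≤+ (0≤f zero) (∑-nonneg (f ∘ suc) (0≤f ∘ suc)))

∑-mono : ∀ {n} (f g : Fin n → ℚ) → (∀ i → f i ℚ.≤ g i) → ∑ f ℚ.≤ ∑ g
∑-mono {zero}  f g f≤g = ℚ.≤-reflexive (≡.trans (∑-empty f) (≡.sym (∑-empty g)))
∑-mono {suc n} f g f≤g = ≡.subst₂ ℚ._≤_ (≡.sym (∑-suc f)) (≡.sym (∑-suc g))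
  (ℚ.+-mono-≤ (f≤g zero) (∑-mono (f ∘ suc) (g ∘ suc) (f≤g ∘ suc)))

∑-bound : ∀ {n} (f : Fin n → ℚ) c → (∀ i → f i ℚ.≤ c) → ∑ f ℚ.≤ ι n ℚ.* c
∑-bound {zero}  f c f≤c = ℚ.≤-reflexive (≡.trans (∑-empty f) (≡.sym (ℚ.*-zeroˡ c)))
∑-bound {suc n} f c f≤c = ≡.subst₂ ℚ._≤_ (≡.sym (∑-suc f))
  (≡.trans (arith (ι n) c) (≡.cong (ℚ._* c) (≡.sym (ι-+ 1 n))))
  (ℚ.+-mono-≤ (f≤c zero) (∑-bound (f ∘ suc) c (f≤c ∘ suc)))
  where
  arith : ∀ m c → c ℚ.+ m ℚ.* c ≡ (1ℚ ℚ.+ m) ℚ.* c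
  arith = solve 2 (λ m c → c :+ m :* c := (con 1ℚ :+ m) :* c) ≡.refl

-- The power (-1)^n defined by negation, so that `σ (suc n)` unfolds to a form that the ring solver
-- handles.
σ : ℕ → ℚ
σ zero    = 1ℚ
σ (suc n) = ℚ.- σ n

Offdiagonal : ℕ → Set
Offdiagonal m = Fin m → Fin m → ℚ

tailᵗ : ∀ {m} → Offdiagonal (suc m) → Offdiagonal m
tailᵗ t k l = t (suc k) (suc l)

record Shape {m} (G : Bordered m) (x : ℚ) (d : Fin m → ℚ) (t : Offdiagonal m) : Set where
  field
    first    : ∀ k → G k zero ≡ ℚ.- 1ℚ
    diagonal : ∀ k → G k (suc k) ≡ x ℚ.- d k
    upper    : ∀ k l → k Fin.< l → G k (suc l) ≡ ℚ.- t k l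
    t-nonneg : ∀ k l → 0ℚ ℚ.≤ t k l

open Shape

shrink-shape : ∀ {m} {G : Bordered (suc m)} {x d t} → Shape G x d t → Shape (shrink G) x (d ∘ suc) (tailᵗ t)
shrink-shape S = record
  { first    = λ k → first S (suc k)
  ; diagonal = λ k → diagonal S (suc k)
  ; upper    = λ k l k<l → upper S (suc k) (suc l) (s≤s k<l)
  ; t-nonneg = λ k l → t-nonneg S (suc k) (suc l)
  }

module _ {m} {G : Bordered (suc m)} {x d t} (S : Shape G x d t) where

  cofactor₀ : cofactor G 0F ≡ (x ℚ.- d 0F) ℚ.* cofactor (shrink G) 0F
  cofactor₀ = ≡.cong (ℚ._* _) (diagonal S 0F)

  cofactor₂ : ∀ j → cofactor G (suc (suc j)) ≡ (x ℚ.- d 0F) ℚ.* cofactor (shrink G) (suc j)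
  cofactor₂ j = ≡.cong (ℚ._* _) (diagonal S 0F)

  -- The minus of the recursion meets the border -1 and the entries -t, so every coefficient becomes
  -- nonnegative. All the sign arguments rest on this.
  cofactor₁ : cofactor G 1F ≡ cofactor (shrink G) 0F ℚ.+ ∑ λ l → t 0F (suc l) ℚ.* cofactor (shrink G) (suc l)
  cofactor₁ = begin
    ℚ.- ∑ (λ l → G 0F (punchIn 1F l) ℚ.* C l)
      ≡⟨ ≡.cong ℚ.-_ (∑-suc _) ⟩
    ℚ.- (G 0F 0F ℚ.* C 0F ℚ.+ ∑ (λ l → G 0F (suc (suc l)) ℚ.* C (suc l)))
      ≡⟨ ≡.cong₂ (λ a b → ℚ.- (a ℚ.* C 0F ℚ.+ b)) (first S 0F) (∑-cong λ l →
           ≡.trans (≡.cong (ℚ._* C (suc l)) (upper S 0F (suc l) (s≤s z≤n))) (push (t 0F (suc l)) (C (suc l)))) ⟩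
    ℚ.- (ℚ.- 1ℚ ℚ.* C 0F ℚ.+ ∑ (λ l → ℚ.- 1ℚ ℚ.* (t 0F (suc l) ℚ.* C (suc l))))
      ≡⟨ ≡.cong (λ a → ℚ.- (ℚ.- 1ℚ ℚ.* C 0F ℚ.+ a)) (*-distribˡ-∑ (ℚ.- 1ℚ) _) ⟨
    ℚ.- (ℚ.- 1ℚ ℚ.* C 0F ℚ.+ ℚ.- 1ℚ ℚ.* ∑ (λ l → t 0F (suc l) ℚ.* C (suc l)))
      ≡⟨ arith (C 0F) (∑ (λ l → t 0F (suc l) ℚ.* C (suc l))) ⟩
    C 0F ℚ.+ ∑ (λ l → t 0F (suc l) ℚ.* C (suc l)) ∎
    where
    open ≡.≡-Reasoning
    C = cofactor (shrink G)
    push : ∀ a b → (ℚ.- a) ℚ.* b ≡ ℚ.- 1ℚ ℚ.* (a ℚ.* b)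
    push = solve 2 (λ a b → (:- a) :* b := con (ℚ.- 1ℚ) :* (a :* b)) ≡.refl
    arith : ∀ a b → ℚ.- (ℚ.- 1ℚ ℚ.* a ℚ.+ ℚ.- 1ℚ ℚ.* b) ≡ a ℚ.+ b
    arith = solve 2 (λ a b → :- (con (ℚ.- 1ℚ) :* a :+ con (ℚ.- 1ℚ) :* b) := a :+ b) ≡.refl

-- `E` and `y` stand for the leading and the other cofactors of the rows below, up to sign; the
-- premises are the fields of `AboveSigns`. The conclusion keeps the entries `t` of the row from
-- overturning the sign contributed by the border.
Small : ∀ {m} → ℚ → (Fin (suc m) → ℚ) → Offdiagonal (suc m) → Set
Small {m} x d t = ∀ E (y : Fin m → ℚ) → 0ℚ ℚ.< E → (∀ l → 0ℚ ℚ.≤ y l) →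
  (∀ l → (d (suc l) ℚ.- x) ℚ.* y l ℚ.≤ E) → ∑ (λ l → t 0F (suc l) ℚ.* y l) ℚ.< E

data Above (x : ℚ) : ∀ {m} → (Fin m → ℚ) → Offdiagonal m → Set where
  []  : ∀ {d t} → Above x {0} d t
  row : ∀ {m d t} → x ℚ.< d 0F → Small x d t → Above x {m} (d ∘ suc) (tailᵗ t) → Above x {suc m} d t

-- The last index counts the rows below the row whose diagonal entry vanishes.
data Pivot (x : ℚ) : ∀ {m} → (Fin m → ℚ) → Offdiagonal m → ℕ → Set where
  here  : ∀ {m d t} → d 0F ≡ x → Small x d t → Above x {m} (d ∘ suc) (tailᵗ t) → Pivot x {suc m} d t m
  there : ∀ {m d t r} → d 0F ℚ.< x → Pivot x {m} (d ∘ suc) (tailᵗ t) r → Pivot x {suc m} d t r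

-- Diagonal dominance of each row, with the 1 accounting for the border entry -1.
data Dominated (x : ℚ) : ∀ {m} → (Fin m → ℚ) → Offdiagonal m → Set where
  []  : ∀ {d t} → Dominated x {0} d t
  row : ∀ {m d t} → 1ℚ ℚ.+ ∑ (λ l → t 0F (suc l)) ℚ.≤ x ℚ.- d 0F → Dominated x {m} (d ∘ suc) (tailᵗ t) →
        Dominated x {suc m} d t

-- The field `bounded` strengthens the induction: it limits each later cofactor to the fraction 1/(d
-- j - x) of the leading one, which is the premise of `Small`.
record AboveSigns {m} (G : Bordered m) (x : ℚ) (d : Fin m → ℚ) : Set where
  field
    leading  : 0ℚ ℚ.< σ m ℚ.* cofactor G zero
    nonneg   : ∀ j → 0ℚ ℚ.≤ ℚ.- σ m ℚ.* cofactor G (suc j)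
    bounded  : ∀ j → (d j ℚ.- x) ℚ.* (ℚ.- σ m ℚ.* cofactor G (suc j)) ℚ.≤ σ m ℚ.* cofactor G zero

open AboveSigns

-- With E = σ D′ and y = −σ V′ the new cofactor is, up to sign, E − ∑ t y, which is positive by smallness.
module _ {m} {G : Bordered (suc m)} {x d t} (S : Shape G x d t)
  (IH : AboveSigns (shrink G) x (d ∘ suc)) (small : Small x d t) where
  private
    E = σ m ℚ.* cofactor (shrink G) 0F
    y : Fin m → ℚ
    y l = ℚ.- σ m ℚ.* cofactor (shrink G) (suc l)
    T = ∑ λ l → t 0F (suc l) ℚ.* y l

  σ*cofactor₁ : σ m ℚ.* cofactor G 1F ≡ E ℚ.- T
  σ*cofactor₁ = begin
    σ m ℚ.* cofactor G 1F
      ≡⟨ ≡.cong (σ m ℚ.*_) (cofactor₁ S) ⟩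
    σ m ℚ.* (C 0F ℚ.+ U)
      ≡⟨ arith (σ m) (C 0F) U ⟩
    E ℚ.- (ℚ.- σ m ℚ.* U)
      ≡⟨ ≡.cong (λ v → E ℚ.- v) (*-distribˡ-∑ (ℚ.- σ m) _) ⟩
    E ℚ.- ∑ (λ l → ℚ.- σ m ℚ.* (t 0F (suc l) ℚ.* C (suc l)))
      ≡⟨ ≡.cong (λ v → E ℚ.- v) (∑-cong λ l → swap (ℚ.- σ m) (t 0F (suc l)) (C (suc l))) ⟩
    E ℚ.- T ∎
    where
    open ≡.≡-Reasoning
    C = cofactor (shrink G)
    U = ∑ λ l → t 0F (suc l) ℚ.* C (suc l)
    arith : ∀ s a b → s ℚ.* (a ℚ.+ b) ≡ s ℚ.* a ℚ.- (ℚ.- s ℚ.* b)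
    arith = solve 3 (λ s a b → s :* (a :+ b) := s :* a :- ((:- s) :* b)) ≡.refl
    swap : ∀ a b c → a ℚ.* (b ℚ.* c) ≡ b ℚ.* (a ℚ.* c)
    swap = solve 3 (λ a b c → a :* (b :* c) := b :* (a :* c)) ≡.refl

  0<σ*cofactor₁ : 0ℚ ℚ.< σ m ℚ.* cofactor G 1F
  0<σ*cofactor₁ = ≡.subst (0ℚ ℚ.<_) (≡.sym σ*cofactor₁) (0<q-p (small E y (leading IH) (nonneg IH) (bounded IH)))

  σ*cofactor₁≤E : σ m ℚ.* cofactor G 1F ℚ.≤ E
  σ*cofactor₁≤E = ≡.subst (ℚ._≤ E) (≡.sym σ*cofactor₁)
    (≤-by T (∑-nonneg _ λ l → 0≤* (t-nonneg S 0F (suc l)) (nonneg IH l)) (arith E T))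
    where
    arith : ∀ a b → a ℚ.- b ℚ.+ b ≡ a
    arith = solve 2 (λ a b → a :- b :+ b := a) ≡.refl

-- The new row multiplies the old cofactors, except that of column 1, by x - d 0 < 0, and the extra
-- sign in `σ` absorbs this. The new cofactor of column 1 lies between 0 and the old leading one up
-- to sign; multiplied by d 0 - x this is the new instance of `bounded`.
above-signs : ∀ {m} {G : Bordered m} {x d t} → Shape G x d t → Above x d t → AboveSigns G x d
above-signs S []                 = record { leading = ℚ.positive⁻¹ 1ℚ ; nonneg = λ () ; bounded = λ () }
above-signs {suc m} {G} {x} {d} {t} S (row x<d small above) = record
  { leading = ≡.subst (0ℚ ℚ.<_) (≡.sym leading≡) (0<* 0<w (leading IH))
  ; nonneg  = λ
    { zero    → ≡.subst (0ℚ ℚ.≤_) (≡.sym first≡) (ℚ.<⇒≤ (0<σ*cofactor₁ S IH small))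
    ; (suc j) → ≡.subst (0ℚ ℚ.≤_) (≡.sym (later≡ j)) (0≤* (ℚ.<⇒≤ 0<w) (nonneg IH j))
    }
  ; bounded = λ
    { zero    → ≡.subst₂ ℚ._≤_ (≡.cong (w ℚ.*_) (≡.sym first≡)) (≡.sym leading≡) (mono (σ*cofactor₁≤E S IH small))
    ; (suc j) → ≡.subst₂ ℚ._≤_ (≡.trans (swap w (d (suc j) ℚ.- x) _) (≡.cong ((d (suc j) ℚ.- x) ℚ.*_) (≡.sym (later≡ j))))
                  (≡.sym leading≡) (mono (bounded IH j))
    }
  }
  where
  IH = above-signs (shrink-shape S) above
  w = d 0F ℚ.- x
  0<w : 0ℚ ℚ.< w
  0<w = 0<q-p x<d
  mono : ∀ {p q} → p ℚ.≤ q → w ℚ.* p ℚ.≤ w ℚ.* q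
  mono = ℚ.*-monoˡ-≤-nonNeg w {{ℚ.nonNegative (ℚ.<⇒≤ 0<w)}}
  swap : ∀ a b c → a ℚ.* (b ℚ.* c) ≡ b ℚ.* (a ℚ.* c)
  swap = solve 3 (λ a b c → a :* (b :* c) := b :* (a :* c)) ≡.refl
  leading≡ : σ (suc m) ℚ.* cofactor G 0F ≡ w ℚ.* (σ m ℚ.* cofactor (shrink G) 0F)
  leading≡ = ≡.trans (≡.cong (σ (suc m) ℚ.*_) (cofactor₀ S)) (arith (σ m) x (d 0F) (cofactor (shrink G) 0F))
    where
    arith : ∀ s x d c → ℚ.- s ℚ.* ((x ℚ.- d) ℚ.* c) ≡ (d ℚ.- x) ℚ.* (s ℚ.* c)
    arith = solve 4 (λ s x d c → (:- s) :* ((x :- d) :* c) := (d :- x) :* (s :* c)) ≡.refl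
  first≡ : ℚ.- σ (suc m) ℚ.* cofactor G 1F ≡ σ m ℚ.* cofactor G 1F
  first≡ = arith (σ m) (cofactor G 1F)
    where
    arith : ∀ s c → ℚ.- (ℚ.- s) ℚ.* c ≡ s ℚ.* c
    arith = solve 2 (λ s c → :- (:- s) :* c := s :* c) ≡.refl
  later≡ : ∀ j → ℚ.- σ (suc m) ℚ.* cofactor G (suc (suc j)) ≡ w ℚ.* (ℚ.- σ m ℚ.* cofactor (shrink G) (suc j))
  later≡ j = ≡.trans (≡.cong (ℚ.- σ (suc m) ℚ.*_) (cofactor₂ S j)) (arith (σ m) x (d 0F) (cofactor (shrink G) (suc j)))
    where
    arith : ∀ s x d c → ℚ.- (ℚ.- s) ℚ.* ((x ℚ.- d) ℚ.* c) ≡ (d ℚ.- x) ℚ.* (ℚ.- s ℚ.* c)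
    arith = solve 4 (λ s x d c → :- (:- s) :* ((x :- d) :* c) := (d :- x) :* ((:- s) :* c)) ≡.refl

record PivotSigns {m} (G : Bordered m) (r : ℕ) : Set where
  field
    leading≡0 : cofactor G zero ≡ 0ℚ
    nonneg    : ∀ j → 0ℚ ℚ.≤ σ r ℚ.* cofactor G (suc j)
    positive  : 0ℚ ℚ.< ∑ λ j → σ r ℚ.* cofactor G (suc j)

-- In the pivot row the factor x - d 0 is zero and leaves only the cofactor of column 1, with the
-- sign dictated by the rows below. Each row above multiplies the surviving cofactors by a positive
-- factor and adds one that is a nonnegative combination, so the sum stays positive.
pivot-signs : ∀ {m} {G : Bordered m} {x d t r} → Shape G x d t → Pivot x d t r → PivotSigns G r
pivot-signs {suc m} {G} {x} {d} {t} S (here d≡x small above) = record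
  { leading≡0 = ≡.trans (cofactor₀ S) (vanish _)
  ; nonneg = nonneg′
  ; positive = ≡.subst (0ℚ ℚ.<_) (≡.sym (∑-suc _)) (0<+ 0<V (∑-nonneg _ (nonneg′ ∘ suc)))
  }
  where
  vanish : ∀ c → (x ℚ.- d 0F) ℚ.* c ≡ 0ℚ
  vanish c = ≡.trans (≡.cong (λ v → (x ℚ.- v) ℚ.* c) d≡x) (arith x c)
    where
    arith : ∀ x c → (x ℚ.- x) ℚ.* c ≡ 0ℚ
    arith = solve 2 (λ x c → (x :- x) :* c := con 0ℚ) ≡.refl
  0<V : 0ℚ ℚ.< σ m ℚ.* cofactor G 1F
  0<V = 0<σ*cofactor₁ S (above-signs (shrink-shape S) above) small
  nonneg′ : ∀ j → 0ℚ ℚ.≤ σ m ℚ.* cofactor G (suc j)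
  nonneg′ zero    = ℚ.<⇒≤ 0<V
  nonneg′ (suc j) = ℚ.≤-reflexive (≡.sym (≡.trans (≡.cong (σ m ℚ.*_) (≡.trans (cofactor₂ S j) (vanish _))) (ℚ.*-zeroʳ (σ m))))
pivot-signs {suc m} {G} {x} {d} {t} {r} S (there d<x pivot) = record
  { leading≡0 = ≡.trans (cofactor₀ S) (≡.trans (≡.cong (w ℚ.*_) IH.leading≡0) (ℚ.*-zeroʳ w))
  ; nonneg = λ { zero → 0≤V ; (suc j) → ≡.subst (0ℚ ℚ.≤_) (≡.sym (later≡ j)) (0≤* (ℚ.<⇒≤ 0<w) (IH.nonneg j)) }
  ; positive = ≡.subst (0ℚ ℚ.<_) (≡.sym (≡.trans (∑-suc _) (ℚ.+-comm (σ r ℚ.* cofactor G 1F) _))) (0<+ 0<tail 0≤V)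
  }
  where
  module IH = PivotSigns (pivot-signs (shrink-shape S) pivot)
  C = cofactor (shrink G)
  w = x ℚ.- d 0F
  0<w : 0ℚ ℚ.< w
  0<w = 0<q-p d<x
  swap : ∀ a b c → a ℚ.* (b ℚ.* c) ≡ b ℚ.* (a ℚ.* c)
  swap = solve 3 (λ a b c → a :* (b :* c) := b :* (a :* c)) ≡.refl
  later≡ : ∀ j → σ r ℚ.* cofactor G (suc (suc j)) ≡ w ℚ.* (σ r ℚ.* C (suc j))
  later≡ j = ≡.trans (≡.cong (σ r ℚ.*_) (cofactor₂ S j)) (swap (σ r) w (C (suc j)))
  first≡ : σ r ℚ.* cofactor G 1F ≡ ∑ λ l → t 0F (suc l) ℚ.* (σ r ℚ.* C (suc l))
  first≡ = ≡.trans (≡.cong (σ r ℚ.*_) (≡.trans (cofactor₁ S) (≡.trans (≡.cong (ℚ._+ U) IH.leading≡0) (ℚ.+-identityˡ U))))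
    (≡.trans (*-distribˡ-∑ (σ r) _) (∑-cong λ l → swap (σ r) (t 0F (suc l)) (C (suc l))))
    where
    U = ∑ λ l → t 0F (suc l) ℚ.* C (suc l)
  0≤V : 0ℚ ℚ.≤ σ r ℚ.* cofactor G 1F
  0≤V = ≡.subst (0ℚ ℚ.≤_) (≡.sym first≡) (∑-nonneg _ λ l → 0≤* (t-nonneg S 0F (suc l)) (IH.nonneg l))
  0<tail : 0ℚ ℚ.< ∑ λ j → σ r ℚ.* cofactor G (suc (suc j))
  0<tail = ≡.subst (0ℚ ℚ.<_) (≡.trans (*-distribˡ-∑ w _) (∑-cong λ j → ≡.sym (later≡ j))) (0<* 0<w IH.positive)

record DominatedSigns {m} (G : Bordered m) : Set where
  field
    leading : 0ℚ ℚ.< cofactor G zero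
    nonneg  : ∀ j → 0ℚ ℚ.≤ cofactor G (suc j)
    bounded : ∀ j → cofactor G (suc j) ℚ.≤ cofactor G zero

-- With D the old leading cofactor, the new cofactor of column 1 is at most (1 + ∑ t) D, and by
-- dominance at most (x - d 0) D, the new leading one.
dominated-signs : ∀ {m} {G : Bordered m} {x d t} → Shape G x d t → Dominated x d t → DominatedSigns G
dominated-signs S [] = record { leading = ℚ.positive⁻¹ 1ℚ ; nonneg = λ () ; bounded = λ () }
dominated-signs {suc m} {G} {x} {d} {t} S (row 1+t≤w dominated) = record
  { leading = ≡.subst (0ℚ ℚ.<_) (≡.sym (cofactor₀ S)) (0<* 0<w IH.leading)
  ; nonneg  = λ
    { zero    → ≡.subst (0ℚ ℚ.≤_) (≡.sym (cofactor₁ S)) (0≤+ (ℚ.<⇒≤ IH.leading) (∑-nonneg _ λ l → 0≤* (t-nonneg S 0F (suc l)) (IH.nonneg l)))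
    ; (suc j) → ≡.subst (0ℚ ℚ.≤_) (≡.sym (cofactor₂ S j)) (0≤* (ℚ.<⇒≤ 0<w) (IH.nonneg j))
    }
  ; bounded = λ
    { zero    → ≡.subst₂ ℚ._≤_ (≡.sym (cofactor₁ S)) (≡.sym (cofactor₀ S)) V≤D
    ; (suc j) → ≡.subst₂ ℚ._≤_ (≡.sym (cofactor₂ S j)) (≡.sym (cofactor₀ S))
        (ℚ.*-monoˡ-≤-nonNeg w {{ℚ.nonNegative (ℚ.<⇒≤ 0<w)}} (IH.bounded j))
    }
  }
  where
  module IH = DominatedSigns (dominated-signs (shrink-shape S) dominated)
  C = cofactor (shrink G)
  w = x ℚ.- d 0F
  T = ∑ λ l → t 0F (suc l)
  0<w : 0ℚ ℚ.< w
  0<w = ℚ.<-≤-trans (0<+ (ℚ.positive⁻¹ 1ℚ) (∑-nonneg _ λ l → t-nonneg S 0F (suc l))) 1+t≤w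
  V≤D : C 0F ℚ.+ ∑ (λ l → t 0F (suc l) ℚ.* C (suc l)) ℚ.≤ w ℚ.* C 0F
  V≤D = ℚ.≤-trans
    (ℚ.+-monoʳ-≤ (C 0F) (∑-mono _ (λ l → C 0F ℚ.* t 0F (suc l)) λ l → ≡.subst (t 0F (suc l) ℚ.* C (suc l) ℚ.≤_) (ℚ.*-comm (t 0F (suc l)) (C 0F))
      (ℚ.*-monoˡ-≤-nonNeg (t 0F (suc l)) {{ℚ.nonNegative (t-nonneg S 0F (suc l))}} (IH.bounded l))))
    (ℚ.≤-trans (ℚ.≤-reflexive (≡.trans (≡.cong (C 0F ℚ.+_) (≡.sym (*-distribˡ-∑ (C 0F) _))) (arith (C 0F) T)))
      (ℚ.*-monoʳ-≤-nonNeg (C 0F) {{ℚ.nonNegative (ℚ.<⇒≤ IH.leading)}} 1+t≤w))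
    where
    arith : ∀ c t → c ℚ.+ c ℚ.* t ≡ (1ℚ ℚ.+ t) ℚ.* c
    arith = solve 2 (λ c t → c :+ c :* t := (con 1ℚ :+ t) :* c) ≡.refl

-- Fibonacci numbers

fib-positive : ∀ n → 1 ℕ.≤ fib (suc n)
fib-positive zero          = s≤s z≤n
fib-positive (suc zero)    = s≤s z≤n
fib-positive (suc (suc n)) = ℕ.≤-trans (fib-positive (suc n)) (ℕ.m≤m+n _ _)

fib-step : ∀ n → fib n ℕ.≤ fib (suc n)
fib-step zero          = z≤n
fib-step (suc zero)    = ℕ.≤-refl
fib-step (suc (suc n)) = ℕ.m≤m+n _ _

fib-mono : ∀ {m n} → m ℕ.≤ n → fib m ℕ.≤ fib n
fib-mono {m} m≤n = go (ℕ.≤⇒≤′ m≤n)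
  where
  go : ∀ {n} → m ℕ.≤′ n → fib m ℕ.≤ fib n
  go ℕ.≤′-refl                 = ℕ.≤-refl
  go {suc n} (ℕ.≤′-step m≤n) = ℕ.≤-trans (go m≤n) (fib-step n)

fib-strict : ∀ {m n} → 2 ℕ.≤ m → m ℕ.< n → fib m ℕ.< fib n
fib-strict {suc (suc m)} (s≤s (s≤s z≤n)) m<n = ℕ.<-≤-trans (ℕ.m<m+n _ (fib-positive m)) (fib-mono m<n)

fib-double : ∀ n → 2 ℕ.* fib n ℕ.≤ fib (2 ℕ.+ n)
fib-double n = ℕ.+-mono-≤ (fib-step n) (ℕ.≤-reflexive (ℕ.+-identityʳ (fib n)))

-- Passing to the next multiple of `j` advances the index by at least 2, which at least doubles the
-- Fibonacci number. The base case is 3 F(j) ≤ F(j+3) ≤ F(2j).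
fib-growth : ∀ {j} → 2 ℕ.≤ j → ∀ p → fib j ℕ.* 2 ℕ.^ suc p ℕ.+ fib j ℕ.≤ fib ((2 ℕ.+ p) ℕ.* j)
fib-growth {suc zero} (s≤s ()) _
-- For j = 2 the index j + 3 exceeds 2j; here the claim is the equality 3 = F(4).
fib-growth {suc (suc zero)} 2≤j zero = ℕ.≤-refl
fib-growth {j@(suc (suc (suc i)))} 2≤j zero = begin
  fib j ℕ.* 2 ℕ.+ fib j                ≡⟨ ≡.cong (ℕ._+ fib j) (ℕ.*-comm (fib j) 2) ⟩
  2 ℕ.* fib j ℕ.+ fib j                ≤⟨ ℕ.+-mono-≤ (fib-double j) (fib-step j) ⟩
  fib (2 ℕ.+ j) ℕ.+ fib (1 ℕ.+ j)      ≤⟨ fib-mono (ℕ.≤-trans (ℕ.≤-reflexive (ℕ.+-comm 3 j)) (ℕ.+-monoʳ-≤ j {3} (s≤s (s≤s (s≤s z≤n))))) ⟩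
  fib (j ℕ.+ (j ℕ.+ 0))                ∎
  where open ℕ.≤-Reasoning
fib-growth {j} 2≤j (suc p) = begin
  fib j ℕ.* 2 ℕ.^ suc (suc p) ℕ.+ fib j            ≤⟨ ℕ.+-monoʳ-≤ _ (ℕ.m≤m+n (fib j) (fib j)) ⟩
  fib j ℕ.* (2 ℕ.* P) ℕ.+ (fib j ℕ.+ fib j)        ≡⟨ arith (fib j) P ⟩
  2 ℕ.* (fib j ℕ.* P ℕ.+ fib j)                    ≤⟨ ℕ.*-monoʳ-≤ 2 (fib-growth 2≤j p) ⟩
  2 ℕ.* fib ((2 ℕ.+ p) ℕ.* j)                      ≤⟨ fib-double ((2 ℕ.+ p) ℕ.* j) ⟩
  fib (2 ℕ.+ (2 ℕ.+ p) ℕ.* j)                      ≤⟨ fib-mono (ℕ.+-monoˡ-≤ _ 2≤j) ⟩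
  fib ((3 ℕ.+ p) ℕ.* j)                            ∎
  where
  open ℕ.≤-Reasoning
  P = 2 ℕ.^ suc p
  arith : ∀ f P → f ℕ.* (2 ℕ.* P) ℕ.+ (f ℕ.+ f) ≡ 2 ℕ.* (f ℕ.* P ℕ.+ f)
  arith = ℕS.solve 2 (λ f P → f ℕS.:* (ℕS.con 2 ℕS.:* P) ℕS.:+ (f ℕS.:+ f) ℕS.:= ℕS.con 2 ℕS.:* (f ℕS.:* P ℕS.:+ f)) ≡.refl

multipleEntry : ℕ → ℕ → ℚ
multipleEntry i j = ι (if does (i ∣? j) then fib i else 0)

multipleEntry-cases : ∀ i j → multipleEntry i j ≡ 0ℚ ⊎ (multipleEntry i j ≡ ι (fib i) × i ∣ j)
multipleEntry-cases i j with i ∣? j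
... | yes i∣j = inj₂ (≡.refl , i∣j)
... | no  _   = inj₁ ≡.refl

multipleEntry-nonneg : ∀ i j → 0ℚ ℚ.≤ multipleEntry i j
multipleEntry-nonneg i j = 0≤ι (if does (i ∣? j) then fib i else 0)

multipleEntry-≤ : ∀ i j → multipleEntry i j ℚ.≤ ι (fib i)
multipleEntry-≤ i j with multipleEntry-cases i j
... | inj₁ eq       = ℚ.≤-trans (ℚ.≤-reflexive eq) (0≤ι (fib i))
... | inj₂ (eq , _) = ℚ.≤-reflexive eq

-- Since F(p j) − F(j) ≥ 2^(p−1) F(j), the terms of the sum over the multiples p j > q j of j
-- are dominated by a geometric series.
multiples-small : ∀ {j} → 2 ℕ.≤ j → ∀ {x} → x ℚ.≤ ι (fib j) → ∀ {E} → 0ℚ ℚ.< E →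
  ∀ {m} (ρ : Fin m → ℕ) N q → (∀ i → ρ i ≡ suc N ℕ.+ toℕ i) → suc q ℕ.* j ℕ.≤ N →
  (y : Fin m → ℚ) → (∀ l → 0ℚ ℚ.≤ y l) → (∀ l → (ι (fib (ρ l)) ℚ.- x) ℚ.* y l ℚ.≤ E) →
  ι (2 ℕ.^ q) ℚ.* ∑ (λ l → multipleEntry j (ρ l) ℚ.* y l) ℚ.< E
multiples-small {j} 2≤j x≤ 0<E {zero} ρ N q ρ≡ q≤ y 0≤y y≤ =
  ≡.subst (ℚ._< _) (≡.sym (≡.trans (≡.cong (ι (2 ℕ.^ q) ℚ.*_) (∑-empty _)) (ℚ.*-zeroʳ (ι (2 ℕ.^ q))))) 0<E
multiples-small {j} 2≤j {x} x≤ {E} 0<E {suc m} ρ N q ρ≡ q≤ y 0≤y y≤ with multipleEntry-cases j (ρ zero)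
... | inj₁ ≡0 = ≡.subst (ℚ._< E) (≡.cong (ι (2 ℕ.^ q) ℚ.*_) (≡.sym sum≡))
  (multiples-small 2≤j x≤ 0<E (ρ ∘ suc) (suc N) q (λ i → ≡.trans (ρ≡ (suc i)) (ℕ.+-suc (suc N) (toℕ i)))
    (ℕ.≤-trans q≤ (ℕ.n≤1+n N)) (y ∘ suc) (0≤y ∘ suc) (y≤ ∘ suc))
  where
  sum≡ : ∑ (λ l → multipleEntry j (ρ l) ℚ.* y l) ≡ ∑ (λ l → multipleEntry j (ρ (suc l)) ℚ.* y (suc l))
  sum≡ = ≡.trans (∑-suc _) (≡.trans
    (≡.cong (ℚ._+ S) (≡.trans (≡.cong (ℚ._* y zero) ≡0) (ℚ.*-zeroˡ (y zero)))) (ℚ.+-identityˡ S))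
    where S = ∑ λ l → multipleEntry j (ρ (suc l)) ℚ.* y (suc l)
-- The head term times 2^(q+1) is at most `E` by growth, and the remaining sum times 2^(q+1) is less
-- than `E` by induction at `suc q`; the average of the two bounds is the claim for 2^q.
... | inj₂ (≡fib , divides p ρ≡pj) = ≡.subst (ℚ._< E) (≡.cong (a ℚ.*_) (≡.sym (∑-suc _)))
  (<-by (½ ℚ.* (E ℚ.- ι 2 ℚ.* a ℚ.* S) ℚ.+ ½ ℚ.* (E ℚ.- ι 2 ℚ.* a ℚ.* h))
    (0<+ (0<* (ℚ.positive⁻¹ ½) (0<q-p IH)) (0≤* (ℚ.<⇒≤ (ℚ.positive⁻¹ ½)) (0≤q-p head≤))) (arith a h S E))
  where
  a = ι (2 ℕ.^ q)
  h = multipleEntry j (ρ zero) ℚ.* y zero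
  S = ∑ λ l → multipleEntry j (ρ (suc l)) ℚ.* y (suc l)
  sucN≡pj : suc N ≡ p ℕ.* j
  sucN≡pj = ≡.trans (≡.sym (ℕ.+-identityʳ (suc N))) (≡.trans (≡.sym (ρ≡ zero)) ρ≡pj)
  -- From (q+1) j ≤ N < N+1 = p j the multiplier p is at least q+2, so the growth estimate for (q+2)
  -- j applies to it.
  1+q<p : suc q ℕ.< p
  1+q<p = ℕ.*-cancelʳ-< j (suc q) p (ℕ.<-≤-trans (s≤s q≤) (ℕ.≤-reflexive sucN≡pj))
  IH : ι 2 ℚ.* a ℚ.* S ℚ.< E
  IH = ≡.subst (λ v → v ℚ.* S ℚ.< E) (ι-* 2 (2 ℕ.^ q))
    (multiples-small 2≤j x≤ 0<E (ρ ∘ suc) (suc N) (suc q) (λ i → ≡.trans (ρ≡ (suc i)) (ℕ.+-suc (suc N) (toℕ i)))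
      (ℕ.≤-trans (ℕ.*-monoˡ-≤ j 1+q<p) (ℕ.≤-reflexive (≡.sym sucN≡pj))) (y ∘ suc) (0≤y ∘ suc) (y≤ ∘ suc))
  growth : fib j ℕ.* 2 ℕ.^ suc q ℕ.+ fib j ℕ.≤ fib (ρ zero)
  growth = ℕ.≤-trans (fib-growth 2≤j q) (fib-mono (ℕ.≤-trans (ℕ.*-monoˡ-≤ j 1+q<p) (ℕ.≤-reflexive (≡.sym ρ≡pj))))
  growth-ℚ : ι 2 ℚ.* a ℚ.* ι (fib j) ℚ.≤ ι (fib (ρ zero)) ℚ.- x
  growth-ℚ = ≤-by ((ι (fib (ρ zero)) ℚ.- (ι (fib j) ℚ.* (ι 2 ℚ.* a) ℚ.+ ι (fib j))) ℚ.+ (ι (fib j) ℚ.- x))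
    (0≤+ (0≤q-p (≡.subst (ℚ._≤ ι (fib (ρ zero)))
      (≡.trans (ι-+ (fib j ℕ.* 2 ℕ.^ suc q) (fib j)) (≡.cong (ℚ._+ ι (fib j))
        (≡.trans (ι-* (fib j) (2 ℕ.^ suc q)) (≡.cong (ι (fib j) ℚ.*_) (ι-* 2 (2 ℕ.^ q)))))) (ι-≤ growth))) (0≤q-p x≤))
    (arith′ (ι 2 ℚ.* a) (ι (fib j)) (ι (fib (ρ zero))) x)
    where
    arith′ : ∀ b f g x → b ℚ.* f ℚ.+ ((g ℚ.- (f ℚ.* b ℚ.+ f)) ℚ.+ (f ℚ.- x)) ≡ g ℚ.- x
    arith′ = solve 4 (λ b f g x → b :* f :+ ((g :- (f :* b :+ f)) :+ (f :- x)) := g :- x) ≡.refl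
  head≤ : ι 2 ℚ.* a ℚ.* h ℚ.≤ E
  head≤ = ℚ.≤-trans (ℚ.≤-reflexive (≡.trans (≡.cong (λ v → ι 2 ℚ.* a ℚ.* (v ℚ.* y zero)) ≡fib)
      (≡.sym (ℚ.*-assoc (ι 2 ℚ.* a) (ι (fib j)) (y zero)))))
    (ℚ.≤-trans (ℚ.*-monoʳ-≤-nonNeg (y zero) {{ℚ.nonNegative (0≤y zero)}} growth-ℚ) (y≤ zero))
  arith : ∀ a h S E → a ℚ.* (h ℚ.+ S) ℚ.+ (½ ℚ.* (E ℚ.- ι 2 ℚ.* a ℚ.* S) ℚ.+ ½ ℚ.* (E ℚ.- ι 2 ℚ.* a ℚ.* h)) ≡ E
  arith = solve 4 (λ a h S E → a :* (h :+ S) :+ (con ½ :* (E :- con (ι 2) :* a :* S) :+ con ½ :* (E :- con (ι 2) :* a :* h)) := E) ≡.refl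

fibᵈ : ∀ {m} → (Fin m → ℕ) → Fin m → ℚ
fibᵈ ρ i = ι (fib (ρ i))

fibᵗ : ∀ {m} → (Fin m → ℕ) → Offdiagonal m
fibᵗ ρ i j = multipleEntry (ρ i) (ρ j)

Consecutive : ∀ {m} → (Fin m → ℕ) → ℕ → Set
Consecutive ρ r = ∀ i → ρ i ≡ r ℕ.+ toℕ i

consecutive-tail : ∀ {m} {ρ : Fin (suc m) → ℕ} {r} → Consecutive ρ r → Consecutive (ρ ∘ suc) (suc r)
consecutive-tail {r = r} ρ≡ i = ≡.trans (ρ≡ (suc i)) (ℕ.+-suc r (toℕ i))

consecutive-head : ∀ {m} {ρ : Fin (suc m) → ℕ} {r} → Consecutive ρ r → ρ zero ≡ r
consecutive-head {r = r} ρ≡ = ≡.trans (ρ≡ zero) (ℕ.+-identityʳ r)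

fib-small : ∀ {m} (ρ : Fin (suc m) → ℕ) {r} → Consecutive ρ r → 2 ℕ.≤ r → ∀ {x} → x ℚ.≤ ι (fib r) → Small x (fibᵈ ρ) (fibᵗ ρ)
fib-small ρ ρ≡ 2≤r x≤ E y 0<E 0≤y y≤ with consecutive-head ρ≡
... | ≡.refl = ≡.subst (ℚ._< E) (ℚ.*-identityˡ _)
  -- The series starts at q = 0: the only multiple passed so far is the index of the row itself.
  (multiples-small 2≤r x≤ 0<E (ρ ∘ suc) (ρ zero) 0 (consecutive-tail ρ≡) (ℕ.≤-reflexive (ℕ.*-identityˡ (ρ zero))) y 0≤y y≤)

fib-above : ∀ {m} (ρ : Fin m → ℕ) {r} → Consecutive ρ r → 2 ℕ.≤ r → ∀ {x} → x ℚ.< ι (fib r) → Above x (fibᵈ ρ) (fibᵗ ρ)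
fib-above {zero}  ρ ρ≡ 2≤r x< = []
fib-above {suc m} ρ {r} ρ≡ 2≤r {x} x< = row (≡.subst (λ v → x ℚ.< ι (fib v)) (≡.sym (consecutive-head ρ≡)) x<)
  (fib-small ρ ρ≡ 2≤r (ℚ.<⇒≤ x<))
  (fib-above (ρ ∘ suc) (consecutive-tail ρ≡) (ℕ.≤-trans 2≤r (ℕ.n≤1+n r)) (ℚ.<-≤-trans x< (ι-≤ (fib-step r))))

-- From index 2 on the Fibonacci numbers increase strictly, so the rows before `k` have smaller
-- diagonal entries and the rows after it larger ones.
fib-pivot : ∀ {m} (ρ : Fin m → ℕ) {r} → Consecutive ρ r → 2 ℕ.≤ r → (k : Fin m) →
  Pivot (ι (fib (ρ k))) (fibᵈ ρ) (fibᵗ ρ) (m ℕ.∸ suc (toℕ k))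
fib-pivot {suc m} ρ {r} ρ≡ 2≤r zero = here ≡.refl
  (fib-small ρ ρ≡ 2≤r (ι-≤ (ℕ.≤-reflexive (≡.cong fib (consecutive-head ρ≡)))))
  (fib-above (ρ ∘ suc) (consecutive-tail ρ≡) (ℕ.≤-trans 2≤r (ℕ.n≤1+n r))
    (ι-< (≡.subst (λ v → fib v ℕ.< fib (suc r)) (≡.sym (consecutive-head ρ≡)) (fib-strict 2≤r (ℕ.n<1+n r)))))
fib-pivot {suc m} ρ {r} ρ≡ 2≤r (suc k) = there
  (ι-< (fib-strict (≡.subst (2 ℕ.≤_) (≡.sym (consecutive-head ρ≡)) 2≤r)
    (≡.subst₂ ℕ._<_ (≡.sym (ρ≡ zero)) (≡.sym (ρ≡ (suc k))) (ℕ.+-monoʳ-< r (s≤s z≤n)))))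
  (fib-pivot (ρ ∘ suc) (consecutive-tail ρ≡) (ℕ.≤-trans 2≤r (ℕ.n≤1+n r)) k)

-- Here M = n − 1.
rightBound : ℕ → ℕ
rightBound M = 2 ℕ.+ (M ℕ.+ (fib (suc M) ℕ.+ M ℕ.* fib (suc M)))

fib-dominated : ∀ M {m} (ρ : Fin m → ℕ) → m ℕ.≤ M → (∀ i → ρ i ℕ.≤ suc M) →
  Dominated (ι (rightBound M)) (fibᵈ ρ) (fibᵗ ρ)
fib-dominated M {zero}  ρ m≤M ρ≤ = []
fib-dominated M {suc m} ρ m<M ρ≤ = row bound (fib-dominated M (ρ ∘ suc) (ℕ.≤-trans (ℕ.n≤1+n m) m<M) (ρ≤ ∘ suc))
  where
  Φ = fib (suc M)
  sum≤ : ∑ (λ l → fibᵗ ρ zero (suc l)) ℚ.≤ ι (M ℕ.* Φ)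
  sum≤ = ℚ.≤-trans (∑-bound _ (ι Φ) λ l → ℚ.≤-trans (multipleEntry-≤ (ρ zero) (ρ (suc l))) (ι-≤ (fib-mono (ρ≤ zero))))
    (ℚ.≤-trans (ℚ.≤-reflexive (≡.sym (ι-* m Φ))) (ι-≤ (ℕ.*-monoˡ-≤ Φ (ℕ.≤-trans (ℕ.n≤1+n m) m<M))))
  d≤ : ι (fib (ρ zero)) ℚ.≤ ι Φ
  d≤ = ι-≤ (fib-mono (ρ≤ zero))
  split : ι (rightBound M) ≡ ι 2 ℚ.+ (ι M ℚ.+ (ι Φ ℚ.+ ι (M ℕ.* Φ)))
  split = ≡.trans (ι-+ 2 (M ℕ.+ (Φ ℕ.+ M ℕ.* Φ)))
    (≡.cong (ι 2 ℚ.+_) (≡.trans (ι-+ M (Φ ℕ.+ M ℕ.* Φ)) (≡.cong (ι M ℚ.+_) (ι-+ Φ (M ℕ.* Φ)))))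
  -- In `rightBound` the summand Φ covers the diagonal entry and M·Φ the rest of the row. The
  -- summand 2 + M covers the border, and later the first row of the whole matrix.
  bound : 1ℚ ℚ.+ ∑ (λ l → fibᵗ ρ zero (suc l)) ℚ.≤ ι (rightBound M) ℚ.- ι (fib (ρ zero))
  bound = ≡.subst (λ v → 1ℚ ℚ.+ S ℚ.≤ v ℚ.- f) (≡.sym split)
    (≤-by (1ℚ ℚ.+ ι M ℚ.+ ((ι Φ ℚ.- f) ℚ.+ (ι (M ℕ.* Φ) ℚ.- S)))
      (0≤+ (0≤+ (ℚ.<⇒≤ (ℚ.positive⁻¹ 1ℚ)) (0≤ι M)) (0≤+ (0≤q-p d≤) (0≤q-p sum≤)))
      (arith S (ι M) (ι Φ) f (ι (M ℕ.* Φ))))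
    where
    S = ∑ (λ l → fibᵗ ρ zero (suc l))
    f = ι (fib (ρ zero))
    arith : ∀ S M Φ f T → 1ℚ ℚ.+ S ℚ.+ (1ℚ ℚ.+ M ℚ.+ ((Φ ℚ.- f) ℚ.+ (T ℚ.- S))) ≡ ι 2 ℚ.+ (M ℚ.+ (Φ ℚ.+ T)) ℚ.- f
    arith = solve 5 (λ S M Φ f T → con 1ℚ :+ S :+ (con 1ℚ :+ M :+ ((Φ :- f) :+ (T :- S))) := con (ι 2) :+ (M :+ (Φ :+ T)) :- f) ≡.refl

-- The sign of χ at the separating points

entry : ∀ {n} → Fin n → Fin n → ℕ
entry i j = fibonacciRedhefferEntry (index i) (index j)

entry-diagonal : ∀ {m} (k : Fin m) → entry (suc k) (suc k) ≡ fib (2 ℕ.+ toℕ k)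
entry-diagonal k = ≡.cong (if_then fib (2 ℕ.+ toℕ k) else 0) (dec-true ((2 ℕ.+ toℕ k) ∣? (2 ℕ.+ toℕ k)) ∣-refl)

entry-lower : ∀ {m} {k l : Fin m} → l Fin.< k → entry (suc k) (suc l) ≡ 0
entry-lower {k = k} {l} l<k = ≡.cong (if_then fib (2 ℕ.+ toℕ k) else 0)
  (dec-false ((2 ℕ.+ toℕ k) ∣? (2 ℕ.+ toℕ l)) λ k∣l → ℕ.<⇒≱ (s≤s (s≤s l<k)) (∣⇒≤ k∣l))

entry-top : ∀ {m} (l : Fin (suc m)) → entry zero l ≡ 1
entry-top zero    = ≡.refl
entry-top (suc l) = ≡.cong (if_then 1 else 0) (dec-true (1 ∣? (2 ℕ.+ toℕ l)) (1∣ _))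

module RationalCharacteristic (m : ℕ) where

  ℚ-matrix : Matrix ℚ (suc m)
  ℚ-matrix i j = ι (entry i j)

  χ : ℚ → ℚ
  χ x = det (CommutativeRing.rawRing ℚ.+-*-commutativeRing) (shifted ℚ-matrix x)

  ρ : Fin m → ℕ
  ρ k = 2 ℕ.+ toℕ k

  G : ℚ → Bordered m
  G x = lowerRows (shifted ℚ-matrix x)

  shape : ∀ x → Shape (G x) x (fibᵈ ρ) (fibᵗ ρ)
  shape x = record
    { first    = λ k → shifted-off ℚ-matrix x {suc k} {zero} (λ ())
    ; diagonal = λ k → ≡.trans (shifted-diagonal ℚ-matrix x (suc k)) (≡.cong (λ v → x ℚ.- ι v) (entry-diagonal k))
    ; upper    = λ k l k<l → shifted-off ℚ-matrix x {suc k} {suc l} λ eq → ℕ.<-irrefl (≡.cong toℕ (Fin.suc-injective eq)) k<l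
    ; t-nonneg = λ k l → multipleEntry-nonneg (ρ k) (ρ l)
    }

  -- The first row of the matrix consists of ones, since 1 divides every column number.
  χ≡ : ∀ x → χ x ≡ (x ℚ.- 1ℚ) ℚ.* cofactor (G x) zero ℚ.- ∑ (λ j → cofactor (G x) (suc j))
  χ≡ x = begin
    χ x
      ≡⟨ det-cofactor N (shifted-triangular ℚ-matrix (λ k l l<k → ≡.cong ι (entry-lower l<k)) x) ⟩
    ∑ (λ j → N zero j ℚ.* C j)
      ≡⟨ ∑-suc _ ⟩
    N zero zero ℚ.* C zero ℚ.+ ∑ (λ j → N zero (suc j) ℚ.* C (suc j))
      ≡⟨ ≡.cong₂ ℚ._+_ (≡.cong (ℚ._* C zero) (shifted-diagonal ℚ-matrix x zero))
           (∑-cong λ j → ≡.cong (ℚ._* C (suc j))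
             (≡.trans (shifted-off ℚ-matrix x {zero} {suc j} (λ ())) (≡.cong (λ v → ℚ.- ι v) (entry-top (suc j))))) ⟩
    (x ℚ.- 1ℚ) ℚ.* C zero ℚ.+ ∑ (λ j → ℚ.- 1ℚ ℚ.* C (suc j))
      ≡⟨ ≡.cong ((x ℚ.- 1ℚ) ℚ.* C zero ℚ.+_) (≡.trans (≡.sym (*-distribˡ-∑ (ℚ.- 1ℚ) _)) (neg (∑ (C ∘ suc)))) ⟩
    (x ℚ.- 1ℚ) ℚ.* C zero ℚ.- ∑ (λ j → C (suc j)) ∎
    where
    open ≡.≡-Reasoning
    N = shifted ℚ-matrix x
    C = cofactor (G x)
    neg : ∀ a → ℚ.- 1ℚ ℚ.* a ≡ ℚ.- a
    neg = solve 1 (λ a → con (ℚ.- 1ℚ) :* a := :- a) ≡.refl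

  -- At x = -m each d j - x is at least 1, so every signed cofactor is at most the leading one, `E`.
  -- The m of them sum to at most mE, which the corner factor 1 + m exceeds by `E`.
  χ-left : 0ℚ ℚ.< σ (suc m) ℚ.* χ (ℚ.- ι m)
  χ-left = ≡.subst (0ℚ ℚ.<_) (≡.sym (≡.trans (≡.cong (σ (suc m) ℚ.*_) (χ≡ x)) rewritten))
    (ℚ.<-≤-trans S.leading (≤-by (ι m ℚ.* E ℚ.- Y) (0≤q-p Y≤) (arith (ι m) E Y)))
    where
    x = ℚ.- ι m
    C = cofactor (G x)
    x<1 : x ℚ.< ι 1
    x<1 = <-by (1ℚ ℚ.+ ι m) (0<+ (ℚ.positive⁻¹ 1ℚ) (0≤ι m)) (arith₀ (ι m))
      where
      arith₀ : ∀ a → ℚ.- a ℚ.+ (1ℚ ℚ.+ a) ≡ 1ℚ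
      arith₀ = solve 1 (λ a → :- a :+ (con 1ℚ :+ a) := con 1ℚ) ≡.refl
    module S = AboveSigns (above-signs (shape x) (fib-above ρ (λ _ → ≡.refl) ℕ.≤-refl x<1))
    E = σ m ℚ.* C zero
    y : Fin m → ℚ
    y j = ℚ.- σ m ℚ.* C (suc j)
    Y = ∑ y
    y≤ : ∀ j → y j ℚ.≤ E
    y≤ j = ℚ.≤-trans (≤-by ((fibᵈ ρ j ℚ.- ι 1 ℚ.+ ι m) ℚ.* y j)
        (0≤* (0≤+ (0≤q-p (ι-≤ (fib-positive (suc (toℕ j))))) (0≤ι m)) (S.nonneg j)) (arith₁ (fibᵈ ρ j) (ι m) (y j))) (S.bounded j)
      where
      arith₁ : ∀ d m y → y ℚ.+ (d ℚ.- 1ℚ ℚ.+ m) ℚ.* y ≡ (d ℚ.- (ℚ.- m)) ℚ.* y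
      arith₁ = solve 3 (λ d m y → y :+ (d :- con 1ℚ :+ m) :* y := (d :- (:- m)) :* y) ≡.refl
    Y≤ : Y ℚ.≤ ι m ℚ.* E
    Y≤ = ∑-bound y E y≤
    rewritten : σ (suc m) ℚ.* ((x ℚ.- 1ℚ) ℚ.* C zero ℚ.- ∑ (λ j → C (suc j))) ≡ (1ℚ ℚ.+ ι m) ℚ.* E ℚ.- Y
    rewritten = ≡.trans (arith₂ (σ m) (ι m) (C zero) (∑ (λ j → C (suc j))))
      (≡.cong (λ v → (1ℚ ℚ.+ ι m) ℚ.* E ℚ.- v) (*-distribˡ-∑ (ℚ.- σ m) _))
      where
      arith₂ : ∀ s m c v → ℚ.- s ℚ.* ((ℚ.- m ℚ.- 1ℚ) ℚ.* c ℚ.- v) ≡ (1ℚ ℚ.+ m) ℚ.* (s ℚ.* c) ℚ.- (ℚ.- s ℚ.* v)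
      arith₂ = solve 4 (λ s m c v → (:- s) :* ((:- m :- con 1ℚ) :* c :- v) := (con 1ℚ :+ m) :* (s :* c) :- ((:- s) :* v)) ≡.refl
    arith : ∀ m E Y → E ℚ.+ (m ℚ.* E ℚ.- Y) ≡ (1ℚ ℚ.+ m) ℚ.* E ℚ.- Y
    arith = solve 3 (λ m E Y → E :+ (m :* E :- Y) := (con 1ℚ :+ m) :* E :- Y) ≡.refl

  -- The leading cofactor vanishes here, so χ is minus the sum of the others; this minus accounts
  -- for the additional sign compared with the pivot count.
  χ-fib : ∀ (k : Fin m) → 0ℚ ℚ.< σ (m ℕ.∸ toℕ k) ℚ.* χ (ι (fib (ρ k)))
  χ-fib k = ≡.subst (0ℚ ℚ.<_) (≡.sym (≡.trans (≡.cong₂ ℚ._*_ (≡.cong σ m∸k) (χ≡ x)) rewritten)) P.positive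
    where
    x = ι (fib (ρ k))
    r = m ℕ.∸ suc (toℕ k)
    C = cofactor (G x)
    m∸k : m ℕ.∸ toℕ k ≡ suc r
    m∸k = ℕ.+-∸-assoc 1 (Fin.toℕ<n k)
    module P = PivotSigns (pivot-signs (shape x) (fib-pivot ρ (λ _ → ≡.refl) ℕ.≤-refl k))
    rewritten : σ (suc r) ℚ.* ((x ℚ.- 1ℚ) ℚ.* C zero ℚ.- ∑ (λ j → C (suc j))) ≡ ∑ (λ j → σ r ℚ.* C (suc j))
    rewritten = ≡.trans (≡.cong (λ v → σ (suc r) ℚ.* ((x ℚ.- 1ℚ) ℚ.* v ℚ.- ∑ (λ j → C (suc j)))) P.leading≡0)
      (≡.trans (arith (σ r) x (∑ (λ j → C (suc j)))) (*-distribˡ-∑ (σ r) _))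
      where
      arith : ∀ s x v → ℚ.- s ℚ.* ((x ℚ.- 1ℚ) ℚ.* 0ℚ ℚ.- v) ≡ s ℚ.* v
      arith = solve 3 (λ s x v → (:- s) :* ((x :- con 1ℚ) :* con 0ℚ :- v) := s :* v) ≡.refl

  χ-right : 0ℚ ℚ.< χ (ι (rightBound m))
  χ-right = ≡.subst (0ℚ ℚ.<_) (≡.sym (χ≡ x)) (ℚ.<-≤-trans S.leading
    (≤-by ((x ℚ.- (ι 2 ℚ.+ ι m)) ℚ.* C zero ℚ.+ (ι m ℚ.* C zero ℚ.- V))
      (0≤+ (0≤* (0≤q-p 2+m≤x) (ℚ.<⇒≤ S.leading)) (0≤q-p V≤)) (arith x (ι m) (C zero) V)))
    where
    x = ι (rightBound m)
    C = cofactor (G x)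
    V = ∑ λ j → C (suc j)
    module S = DominatedSigns (dominated-signs (shape x) (fib-dominated m ρ ℕ.≤-refl (λ k → s≤s (Fin.toℕ<n k))))
    V≤ : V ℚ.≤ ι m ℚ.* C zero
    V≤ = ∑-bound (λ j → C (suc j)) (C zero) S.bounded
    2+m≤x : ι 2 ℚ.+ ι m ℚ.≤ x
    2+m≤x = ℚ.≤-trans (ℚ.≤-reflexive (≡.sym (ι-+ 2 m))) (ι-≤ (ℕ.+-monoʳ-≤ 2 (ℕ.m≤m+n m _)))
    arith : ∀ x m c v → c ℚ.+ ((x ℚ.- (ι 2 ℚ.+ m)) ℚ.* c ℚ.+ (m ℚ.* c ℚ.- v)) ≡ (x ℚ.- 1ℚ) ℚ.* c ℚ.- v
    arith = solve 4 (λ x m c v → c :+ ((x :- (con (ι 2) :+ m)) :* c :+ (m :* c :- v)) := (x :- con 1ℚ) :* c :- v) ≡.refl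

-- Isolating the eigenvalues

module _ {c₁ ℓ₁ c₂ ℓ₂} (R : RawRing c₁ ℓ₁) (CS : CommutativeRing c₂ ℓ₂)
  {f : RawRing.Carrier R → CommutativeRing.Carrier CS}
  (f-natural : PreservesOperations R (CommutativeRing.rawRing CS) f) where
  private
    module R = RawRing R
    module S = CommutativeRing CS
  open PreservesOperations f-natural

  det-shifted-natural : ∀ {n} (M : Matrix R.Carrier n) x →
    f (det R (λ i j → eval R (charMatrix R M i j) x)) S.≈
    det S.rawRing (Polynomials.shifted CS (λ i j → f (M i j)) (f x))
  det-shifted-natural M x = S.trans (det-natural R CS f-natural (λ i j → eval R (charMatrix R M i j) x))
    (Determinants.det-cong CS {M = λ i j → f (eval R (charMatrix R M i j) x)}
      {N = Polynomials.shifted CS (λ i j → f (M i j)) (f x)} λ i j → S.trans (+-homo _ _) (S.+-cong (-‿homo _)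
      (S.trans (*-homo _ _) (S.*-congˡ (S.trans (+-homo _ _) (S.+-cong (if-natural (does (i Fin.≟ j)))
        (S.trans (*-homo _ _) (S.*-congˡ 0#-homo))))))))
    where
    if-natural : ∀ b → f (if b then R.1# else R.0#) S.≈ (if b then S.1# else S.0#)
    if-natural true  = 1#-homo
    if-natural false = 0#-homo

seq-natural : ∀ n → PreservesOperations ℝ-rawRing (CommutativeRing.rawRing ℚ.+-*-commutativeRing) (λ x → seq x n)
seq-natural n = record
  { +-homo = λ x y → ≡.refl ; *-homo = λ x y → ≡.refl ; -‿homo = λ x → ≡.refl ; 0#-homo = ≡.refl ; 1#-homo = ≡.refl }

ℝ→ℂ-natural : PreservesOperations ℝ-rawRing ℂ-rawRing ℝ→ℂ
ℝ→ℂ-natural = record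
  { +-homo = λ x y → same (λ n → seq x n ℚ.+ seq y n) , same (λ _ → 0ℚ)
  ; *-homo = λ x y → ∼-reflexive (λ n → re-arith (seq x n) (seq y n)) , ∼-reflexive (λ n → im-arith (seq x n) (seq y n))
  ; -‿homo = λ x → same (λ n → ℚ.- seq x n) , same (λ _ → 0ℚ)
  ; 0#-homo = same (λ _ → 0ℚ) , same (λ _ → 0ℚ)
  ; 1#-homo = same (λ _ → 1ℚ) , same (λ _ → 0ℚ)
  }
  where
  same : ∀ s → s ∼ s
  same s = ∼-reflexive {s} {s} λ _ → ≡.refl
  re-arith : ∀ a b → a ℚ.* b ≡ a ℚ.* b ℚ.+ ℚ.- (0ℚ ℚ.* 0ℚ)
  re-arith = solve 2 (λ a b → a :* b := a :* b :+ :- (con 0ℚ :* con 0ℚ)) ≡.refl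
  im-arith : ∀ a b → 0ℚ ≡ a ℚ.* 0ℚ ℚ.+ 0ℚ ℚ.* b
  im-arith = solve 2 (λ a b → con 0ℚ := a :* con 0ℚ :+ con 0ℚ :* b) ≡.refl

∣σ∣≡1 : ∀ k → ℚ.∣ σ k ∣ ≡ 1ℚ
∣σ∣≡1 zero    = ≡.refl
∣σ∣≡1 (suc k) = ≡.trans (ℚ.∣-p∣≡∣p∣ (σ k)) (∣σ∣≡1 k)

p≢0⇒0<∣p∣ : ∀ {p} → p ≢ 0ℚ → 0ℚ ℚ.< ℚ.∣ p ∣
p≢0⇒0<∣p∣ {p} p≢0 = ℚ.≰⇒> λ ∣p∣≤0 → p≢0 (ℚ.∣p∣≡0⇒p≡0 p (ℚ.≤-antisym ∣p∣≤0 (ℚ.0≤∣p∣ p)))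

away⇒<ℝ : ∀ {a x} → (∀ n → a ℚ.≤ seq x n) → Away (λ n → seq x n ℚ.- a) → fromℚ a <ℝ x
away⇒<ℝ {a} {x} a≤x (ε , 0<ε , N , ε≤) = ½ ℚ.* ε , half-pos ε 0<ε , N , λ n N≤n →
  let ε≤x-a : ε ℚ.≤ seq x n ℚ.- a
      ε≤x-a = ≡.subst (ε ℚ.≤_) (ℚ.0≤p⇒∣p∣≡p (0≤q-p (a≤x n))) (ε≤ n N≤n)
  in <-by (½ ℚ.* ε ℚ.+ (seq x n ℚ.- a ℚ.- ε)) (0<+ (half-pos ε 0<ε) (0≤q-p ε≤x-a)) (arith a (seq x n) ε)
  where
  arith : ∀ a x ε → a ℚ.+ ½ ℚ.* ε ℚ.+ (½ ℚ.* ε ℚ.+ (x ℚ.- a ℚ.- ε)) ≡ x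
  arith = solve 3 (λ a x ε → a :+ con ½ :* ε :+ (con ½ :* ε :+ (x :- a :- ε)) := x) ≡.refl

away⇒>ℝ : ∀ {b x} → (∀ n → seq x n ℚ.≤ b) → Away (λ n → seq x n ℚ.- b) → x <ℝ fromℚ b
away⇒>ℝ {b} {x} x≤b away = go (away-flip {seq x} {λ _ → b} away)
  where
  arith : ∀ a x ε → a ℚ.+ ½ ℚ.* ε ℚ.+ (½ ℚ.* ε ℚ.+ (x ℚ.- a ℚ.- ε)) ≡ x
  arith = solve 3 (λ a x ε → a :+ con ½ :* ε :+ (con ½ :* ε :+ (x :- a :- ε)) := x) ≡.refl
  go : Away (λ n → b ℚ.- seq x n) → x <ℝ fromℚ b
  go (ε , 0<ε , N , ε≤) = ½ ℚ.* ε , half-pos ε 0<ε , N , λ n N≤n →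
    let ε≤b-x : ε ℚ.≤ b ℚ.- seq x n
        ε≤b-x = ≡.subst (ε ℚ.≤_) (ℚ.0≤p⇒∣p∣≡p (0≤q-p (x≤b n))) (ε≤ n N≤n)
    in <-by (½ ℚ.* ε ℚ.+ (b ℚ.- seq x n ℚ.- ε)) (0<+ (half-pos ε 0<ε) (0≤q-p ε≤b-x)) (arith (seq x n) b ε)

punchIn-elim : ∀ {n} (P : Fin (suc n) → Set) i → P i → (∀ j → P (punchIn i j)) → ∀ j → P j
punchIn-elim P i Pi Pj j with i Fin.≟ j
... | yes ≡.refl = Pi
... | no i≢j     = ≡.subst P (Fin.punchIn-punchOut i≢j) (Pj (Fin.punchOut i≢j))

-- One unsettled candidate is carried along; comparing it with a further index settles one of the
-- two, and the other becomes the candidate.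
locate : ∀ {n} (P : Fin (suc n) → Set) → (∀ i j → i Fin.< j → P i ⊎ P j) → ∃[ i ] (∀ j → P (punchIn i j))
locate {zero}  P cotransitive = zero , λ ()
locate {suc n} P cotransitive with locate (P ∘ suc) (λ i j i<j → cotransitive (suc i) (suc j) (s≤s i<j))
... | i , others with cotransitive zero (suc i) (s≤s z≤n)
...   | inj₁ P₀ = suc i , λ { zero → P₀ ; (suc j) → others j }
...   | inj₂ Pᵢ = zero , punchIn-elim (P ∘ suc) i Pᵢ others

-- Strict increase from the bottom gives f i ≥ i, and from the top f i ≤ i.
strictlyMonotone⇒id : ∀ {n} (f : Fin n → Fin n) → (∀ i j → i Fin.< j → f i Fin.< f j) → ∀ i → f i ≡ i
strictlyMonotone⇒id {n} f mono i = Fin.toℕ-injective (ℕ.≤-antisym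
  (ℕ.+-cancelʳ-≤ _ _ _ (ℕ.≤-trans (upper-bound (n ℕ.∸ suc (toℕ i)) i (complement i)) (ℕ.≤-reflexive (≡.sym (complement i)))))
  (lower-bound (toℕ i) i ≡.refl))
  where
  complement : ∀ i → toℕ i ℕ.+ suc (n ℕ.∸ suc (toℕ i)) ≡ n
  complement i = ≡.trans (ℕ.+-suc (toℕ i) _) (ℕ.m+[n∸m]≡n (Fin.toℕ<n i))
  lower-bound : ∀ k i → toℕ i ≡ k → k ℕ.≤ toℕ (f i)
  lower-bound zero    i i≡k = z≤n
  lower-bound (suc k) i i≡k = ℕ.≤-<-trans (lower-bound k i′ i′≡k) (mono i′ i (ℕ.≤-reflexive (≡.trans (≡.cong suc i′≡k) (≡.sym i≡k))))
    where
    k<n : k ℕ.< n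
    k<n = ℕ.<-trans (ℕ.≤-reflexive (≡.sym i≡k)) (Fin.toℕ<n i)
    i′ = Fin.fromℕ< k<n
    i′≡k = Fin.toℕ-fromℕ< k<n
  upper-bound : ∀ d i → toℕ i ℕ.+ suc d ≡ n → toℕ (f i) ℕ.+ suc d ℕ.≤ n
  upper-bound zero    i i≡ = ℕ.≤-trans (ℕ.≤-reflexive (ℕ.+-comm (toℕ (f i)) 1)) (Fin.toℕ<n (f i))
  upper-bound (suc d) i i≡ = ℕ.≤-trans (ℕ.≤-reflexive (ℕ.+-suc (toℕ (f i)) (suc d)))
    (ℕ.≤-trans (ℕ.+-monoˡ-≤ (suc d) (mono i i′ (ℕ.≤-reflexive (≡.sym i′≡)))) (upper-bound d i′ i′≡′))
    where
    1+i<n : suc (toℕ i) ℕ.< n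
    1+i<n = ℕ.≤-trans (ℕ.≤-trans (ℕ.+-monoʳ-≤ 2 (ℕ.m≤m+n (toℕ i) d))
      (ℕ.≤-reflexive (≡.sym (≡.trans (ℕ.+-suc (toℕ i) (suc d)) (≡.cong suc (ℕ.+-suc (toℕ i) d)))))) (ℕ.≤-reflexive i≡)
    i′ = Fin.fromℕ< 1+i<n
    i′≡ : toℕ i′ ≡ suc (toℕ i)
    i′≡ = Fin.toℕ-fromℕ< 1+i<n
    i′≡′ : toℕ i′ ℕ.+ suc d ≡ n
    i′≡′ = ≡.trans (≡.cong (ℕ._+ suc d) i′≡) (≡.trans (≡.sym (ℕ.+-suc (toℕ i) (suc d))) i≡)

1≉0 : ¬ (ℝ→ℂ (fromℚ 1ℚ) ≈ℂ ℝ→ℂ (fromℚ 0ℚ))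
1≉0 (e , _) with e 1ℚ (ℚ.positive⁻¹ 1ℚ)
... | N , h = ℚ.<-irrefl ≡.refl (h N ℕ.≤-refl)

module Eigenvalues (m : ℕ) where
  open RationalCharacteristic m

  ℝ-matrix : Matrix ℝ (suc m)
  ℝ-matrix i j = fromℕ (entry i j)

  χℝ : ℝ → ℝ
  χℝ x = det ℝ-rawRing (ℝ-polynomials.shifted ℝ-matrix x)

  -- Reduces real values of χ to rational ones; the n-th term preserves the ring operations
  -- definitionally.
  seq-χℝ : ∀ x n → seq (χℝ x) n ≡ χ (seq x n)
  seq-χℝ x n = det-shifted-natural ℝ-rawRing ℚ.+-*-commutativeRing (seq-natural n) ℝ-matrix x

  -- Provides the continuity that bisection requires.
  χℝ-cong : ∀ x y → x ≈ℝ y → χℝ x ≈ℝ χℝ y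
  χℝ-cong x y x≈y = Determinants.det-cong ℝ-ring {M = ℝ-polynomials.shifted ℝ-matrix x} {N = ℝ-polynomials.shifted ℝ-matrix y} λ i j →
    ℝ-polynomials.eval-cong (charMatrix ℝ-rawRing ℝ-matrix i j) (charMatrix ℝ-rawRing ℝ-matrix i j) {x} {y}
      (λ k → ℝ-ring.refl {coeff ℝ-rawRing (charMatrix ℝ-rawRing ℝ-matrix i j) k}) x≈y

  -- χℝ x − χ a is a multiple of x − a, so a root of χℝ is apart from a whenever χ a ≠ 0.
  root-away : ∀ x → χℝ x ≈ℝ fromℚ 0ℚ → ∀ a → χ a ≢ 0ℚ → Away (λ n → seq x n ℚ.- a)
  root-away x root a χa≢0 = factor-away {λ n → seq x n ℚ.- a} {seq q} (cauchy q) (ℚ.- χ a)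
    (≡.subst (0ℚ ℚ.<_) (≡.sym (ℚ.∣-p∣≡∣p∣ (χ a))) (p≢0⇒0<∣p∣ χa≢0))
    (∼-trans {seq ((x - c) * q)} {seq (- χℝ c)} {λ _ → ℚ.- χ a}
      (+-inverseˡ-unique ((x - c) * q) (χℝ c)
        (trans {(x - c) * q + χℝ c} {⟦ p ⟧ x} {0#}
          (trans {(x - c) * q + χℝ c} {(x - c) * q + ⟦ p ⟧ c} {⟦ p ⟧ x}
            (+-cong {(x - c) * q} {(x - c) * q} {χℝ c} {⟦ p ⟧ c} (refl {(x - c) * q}) (sym {⟦ p ⟧ c} {χℝ c} (eval-charPoly ℝ-matrix c)))
            (sym {⟦ p ⟧ x} {(x - c) * q + ⟦ p ⟧ c} (division-eval p c x)))
          (trans {⟦ p ⟧ x} {χℝ x} {0#} (eval-charPoly ℝ-matrix x) root)))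
      (∼-reflexive {seq (- χℝ c)} {λ _ → ℚ.- χ a} λ n → ≡.cong ℚ.-_ (seq-χℝ c n)))
    where
    open ℝ-ring using (_+_; _*_; _-_; -_; 0#; refl; sym; trans; +-cong)
    open ℝ-polynomials using (⟦_⟧; eval-charPoly; division-eval; quotient)
    open Algebra.Properties.Ring ℝ-ring.ring using (+-inverseˡ-unique)
    c : ℝ
    c = fromℚ a
    p : Polynomial ℝ-rawRing
    p = charPoly ℝ-rawRing ℝ-matrix
    q : ℝ
    q = ⟦ quotient p c ⟧ x

  -- Bisection only places the root in the closed interval; since χ does not vanish at the
  -- endpoints, the root is apart from them and the inequalities become strict.
  root-between : ∀ k a b → a ℚ.< b → σ k ℚ.* χ a ℚ.< 0ℚ → 0ℚ ℚ.< σ k ℚ.* χ b →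
    Σ[ x ∈ ℝ ] χℝ x ≈ℝ fromℚ 0ℚ × fromℚ a <ℝ x × x <ℝ fromℚ b
  root-between k a b a<b χa<0 0<χb = root , χ≈0 ,
    away⇒<ℝ {a} {root} a≤root (root-away root χ≈0 a χa≢0) ,
    away⇒>ℝ {b} {root} root≤b (root-away root χ≈0 b χb≢0)
    where
    -- The factor `σ k` makes the sign change run from negative to positive.
    open Bisection (λ q → σ k ℚ.* χ q) a b a<b (ℚ.<⇒≤ χa<0) (ℚ.<⇒≤ 0<χb)
    vanish : ∀ q → χ q ≡ 0ℚ → σ k ℚ.* χ q ≡ 0ℚ
    vanish q eq = ≡.trans (≡.cong (σ k ℚ.*_) eq) (ℚ.*-zeroʳ (σ k))
    χa≢0 : χ a ≢ 0ℚ
    χa≢0 eq = ℚ.<-irrefl (vanish a eq) χa<0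
    χb≢0 : χ b ≢ 0ℚ
    χb≢0 eq = ℚ.<-irrefl (≡.sym (vanish b eq)) 0<χb
    σχ : ℝ → ℝ
    σχ x = fromℚ (σ k) ℝ-ring.* χℝ x
    seq-σχ : ∀ x n → seq (σχ x) n ≡ σ k ℚ.* χ (seq x n)
    seq-σχ x n = ≡.cong (σ k ℚ.*_) (seq-χℝ x n)
    continuous : ∀ x y → x ≈ℝ y → (λ n → σ k ℚ.* χ (seq x n)) ∼ (λ n → σ k ℚ.* χ (seq y n))
    continuous x y x≈y = ∼-trans {λ n → σ k ℚ.* χ (seq x n)} {seq (σχ x)} {λ n → σ k ℚ.* χ (seq y n)}
      (∼-reflexive λ n → ≡.sym (seq-σχ x n))
      (∼-trans {seq (σχ x)} {seq (σχ y)} {λ n → σ k ℚ.* χ (seq y n)}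
        (ℝ-ring.*-cong {fromℚ (σ k)} {fromℚ (σ k)} {χℝ x} {χℝ y} (ℝ-ring.refl {fromℚ (σ k)}) (χℝ-cong x y x≈y))
        (∼-reflexive λ n → seq-σχ y n))
    χ≈0 : χℝ root ≈ℝ fromℚ 0ℚ
    χ≈0 = ∼-trans {seq (χℝ root)} {λ n → χ (seq root n)} {λ _ → 0ℚ} (∼-reflexive λ n → seq-χℝ root n)
      (Null⇒∼0 {λ n → χ (seq root n)} (away-cancel {λ _ → σ k} {λ n → χ (seq root n)}
        (1ℚ , ℚ.positive⁻¹ 1ℚ , 0 , λ _ _ → ℚ.≤-reflexive (≡.sym (∣σ∣≡1 k))) (root-value continuous)))

  point : ℕ → ℚ
  point zero    = ℚ.- ι m
  point (suc i) = if does (i ℕ.<? m) then ι (fib (2 ℕ.+ i)) else ι (rightBound m)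

  point-fib : ∀ {i} → i ℕ.< m → point (suc i) ≡ ι (fib (2 ℕ.+ i))
  point-fib {i} i<m = ≡.cong (if_then ι (fib (2 ℕ.+ i)) else ι (rightBound m)) (dec-true (i ℕ.<? m) i<m)

  point-right : point (suc m) ≡ ι (rightBound m)
  point-right = ≡.cong (if_then ι (fib (2 ℕ.+ m)) else ι (rightBound m)) (dec-false (m ℕ.<? m) (ℕ.<-irrefl ≡.refl))

  χ-point : ∀ i → i ℕ.≤ suc m → 0ℚ ℚ.< σ (suc m ℕ.∸ i) ℚ.* χ (point i)
  χ-point zero    _         = χ-left
  χ-point (suc i) (s≤s i≤m) with ℕ.m≤n⇒m<n∨m≡n i≤m
  ... | inj₁ i<m = ≡.subst₂ (λ a b → 0ℚ ℚ.< σ (m ℕ.∸ a) ℚ.* χ b) k≡i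
      (≡.trans (≡.cong (λ v → ι (fib (2 ℕ.+ v))) k≡i) (≡.sym (point-fib i<m))) (χ-fib (Fin.fromℕ< i<m))
    where
    k≡i : toℕ (Fin.fromℕ< i<m) ≡ i
    k≡i = Fin.toℕ-fromℕ< i<m
  ... | inj₂ ≡.refl = ≡.subst₂ (λ a b → 0ℚ ℚ.< σ a ℚ.* χ b) (≡.sym (ℕ.n∸n≡0 m)) (≡.sym point-right)
      (≡.subst (0ℚ ℚ.<_) (≡.sym (ℚ.*-identityˡ (χ (ι (rightBound m))))) χ-right)

  point-next : ∀ i → i ℕ.≤ m → ι (fib (suc i)) ℚ.≤ point (suc i)
  point-next i i≤m with ℕ.m≤n⇒m<n∨m≡n i≤m
  ... | inj₁ i<m    = ≡.subst (ι (fib (suc i)) ℚ.≤_) (≡.sym (point-fib i<m)) (ι-≤ (fib-step (suc i)))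
  ... | inj₂ ≡.refl = ≡.subst (ι (fib (suc i)) ℚ.≤_) (≡.sym point-right)
      (ι-≤ (ℕ.m≤n⇒m≤o+n 2 (ℕ.m≤n⇒m≤o+n m (ℕ.m≤m+n (fib (suc m)) _))))

  point-< : ∀ i → i ℕ.≤ m → point i ℚ.< point (suc i)
  point-< zero    0≤m = ℚ.<-≤-trans (<-by (1ℚ ℚ.+ ι m) (0<+ (ℚ.positive⁻¹ 1ℚ) (0≤ι m)) (arith (ι m))) (point-next 0 0≤m)
    where
    arith : ∀ a → ℚ.- a ℚ.+ (1ℚ ℚ.+ a) ≡ 1ℚ
    arith = solve 1 (λ a → :- a :+ (con 1ℚ :+ a) := con 1ℚ) ≡.refl
  point-< (suc i) i<m with ℕ.m≤n⇒m<n∨m≡n i<m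
  ... | inj₁ 1+i<m  = ≡.subst₂ ℚ._<_ (≡.sym (point-fib i<m)) (≡.sym (point-fib 1+i<m))
      (ι-< (fib-strict {2 ℕ.+ i} {3 ℕ.+ i} (s≤s (s≤s z≤n)) (ℕ.n<1+n (2 ℕ.+ i))))
  ... | inj₂ ≡.refl = ≡.subst₂ ℚ._<_ (≡.sym (point-fib i<m)) (≡.sym point-right)
      (ι-< (s≤s (ℕ.m≤n⇒m≤o+n 1 (ℕ.m≤n⇒m≤o+n (suc i) (ℕ.m≤m+n (fib (2 ℕ.+ i)) _)))))

  point-≤ : ∀ {i j} → i ℕ.≤ j → j ℕ.≤ suc m → point i ℚ.≤ point j
  point-≤ {i} i≤j j≤1+m = go (ℕ.≤⇒≤′ i≤j) j≤1+m
    where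
    go : ∀ {j} → i ℕ.≤′ j → j ℕ.≤ suc m → point i ℚ.≤ point j
    go ℕ.≤′-refl               _         = ℚ.≤-refl
    go {suc j} (ℕ.≤′-step i≤j) (s≤s j≤m) = ℚ.≤-trans (go i≤j (ℕ.≤-trans j≤m (ℕ.n≤1+n m))) (ℚ.<⇒≤ (point-< j j≤m))

  abstract
    -- The signs at neighbouring points are opposite because `σ (suc m ∸ i)` is the negative of
    -- `σ (m ∸ i)`. Abstract, so that later goals do not unfold the bisection.
    isolated : ∀ (i : Fin (suc m)) →
      Σ[ x ∈ ℝ ] χℝ x ≈ℝ fromℚ 0ℚ × fromℚ (point (toℕ i)) <ℝ x × x <ℝ fromℚ (point (suc (toℕ i)))
    isolated i = root-between (m ℕ.∸ toℕ i) (point (toℕ i)) (point (suc (toℕ i))) (point-< (toℕ i) i≤m)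
      (negative (σ (m ℕ.∸ toℕ i)) (χ (point (toℕ i))) (≡.subst (λ k → 0ℚ ℚ.< σ k ℚ.* χ (point (toℕ i))) (ℕ.+-∸-assoc 1 i≤m)
        (χ-point (toℕ i) (ℕ.≤-trans i≤m (ℕ.n≤1+n m)))))
      (χ-point (suc (toℕ i)) (s≤s i≤m))
      where
      i≤m : toℕ i ℕ.≤ m
      i≤m = ℕ.≤-pred (Fin.toℕ<n i)
      negative : ∀ s v → 0ℚ ℚ.< ℚ.- s ℚ.* v → s ℚ.* v ℚ.< 0ℚ
      negative s v 0< = <-by (ℚ.- s ℚ.* v) 0< (arith s v)
        where
        arith : ∀ s v → s ℚ.* v ℚ.+ ℚ.- s ℚ.* v ≡ 0ℚ
        arith = solve 2 (λ s v → s :* v :+ (:- s) :* v := con 0ℚ) ≡.refl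

  eigenvalue : Fin (suc m) → ℝ
  eigenvalue i = proj₁ (isolated i)

  eigenvalue-root : ∀ i → χℝ (eigenvalue i) ≈ℝ fromℚ 0ℚ
  eigenvalue-root i = proj₁ (proj₂ (isolated i))

  point<eigenvalue : ∀ i → fromℚ (point (toℕ i)) <ℝ eigenvalue i
  point<eigenvalue i = proj₁ (proj₂ (proj₂ (isolated i)))

  eigenvalue<point : ∀ i → eigenvalue i <ℝ fromℚ (point (suc (toℕ i)))
  eigenvalue<point i = proj₂ (proj₂ (proj₂ (isolated i)))

  eigenvalue-increasing : ∀ i j → i Fin.< j → eigenvalue i <ℝ eigenvalue j
  eigenvalue-increasing i j i<j = <ℝ-trans {eigenvalue i} {fromℚ (point (toℕ j))} {eigenvalue j}
    (<ℝ-≤ {eigenvalue i} (eigenvalue<point i) (point-≤ i<j (ℕ.<⇒≤ (Fin.toℕ<n j)))) (point<eigenvalue j)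

cancellable-cong : ∀ {z w} → z ≈ℂ w → Cancellable z → Cancellable w
cancellable-cong {z} {w} z≈w c v wv≈0 = c v (ℂ-ring.trans {z ℂ-ring.* v} {w ℂ-ring.* v} {ℂ-ring.0#}
  (ℂ-ring.*-cong {z} {w} {v} {v} z≈w (ℂ-ring.refl {v})) wv≈0)

cancellable⇒≉0 : ∀ {z} → Cancellable z → ¬ (z ≈ℂ ℂ-ring.0#)
cancellable⇒≉0 {z} c z≈0 = 1≉0 (c ℂ-ring.1# (ℂ-ring.trans {z ℂ-ring.* ℂ-ring.1#} {z} {ℂ-ring.0#} (ℂ-ring.*-identityʳ z) z≈0))

increasing-reflects : ∀ {n} (x : Fin n → ℝ) → (∀ i j → i Fin.< j → x i <ℝ x j) → ∀ i j → x i <ℝ x j → i Fin.< j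
increasing-reflects x increasing i j xᵢ<xⱼ with Fin.<-cmp i j
... | tri< i<j _ _    = i<j
... | tri≈ _ ≡.refl _ = contradiction xᵢ<xⱼ (<ℝ-irrefl {x i})
... | tri> _ _ j<i    = contradiction (<ℝ-trans {x i} {x j} {x i} xᵢ<xⱼ (increasing j i j<i)) (<ℝ-irrefl {x i})

-- The spectrum of the complex matrix

module Spectrum (m : ℕ) where
  open Eigenvalues m
  open ℂ-polynomials using (⟦_⟧; ∏[X-_]; splitting; charPoly-monic; eval-charPoly; eval-cong; X-_;
    ∏-remove; eval-∏-cancellable; eigenvector-annihilated; root-isEigenvalue; _≈ₚ_; _*ₚ_)

  M : Matrix ℂ (suc m)
  M = fibonacciRedheffer (suc m)

  p : Polynomial ℂ-rawRing
  p = charPoly ℂ-rawRing M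

  M-triangular : Determinants.IsTriangular ℂ-ring (Determinants.lowerRows ℂ-ring M)
  M-triangular k l l<k = ≡.subst (λ e → ℝ→ℂ (fromℕ e) ≈ℂ ℂ-ring.0#) (≡.sym (entry-lower l<k)) (ℂ-ring.refl {ℂ-ring.0#})

  x : Fin (suc m) → ℂ
  x i = ℝ→ℂ (eigenvalue i)

  x-root : ∀ i → ⟦ p ⟧ (x i) ≈ℂ ℂ-ring.0#
  x-root i = ℂ-ring.trans {⟦ p ⟧ (x i)} {ℝ→ℂ (χℝ (eigenvalue i))} {ℂ-ring.0#}
    (ℂ-ring.trans {⟦ p ⟧ (x i)} {det ℂ-rawRing (ℂ-polynomials.shifted M (x i))} {ℝ→ℂ (χℝ (eigenvalue i))}
      (eval-charPoly M (x i))
      (ℂ-ring.sym {ℝ→ℂ (χℝ (eigenvalue i))} {det ℂ-rawRing (ℂ-polynomials.shifted M (x i))}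
        (det-shifted-natural ℝ-rawRing ℂ-ring ℝ→ℂ-natural ℝ-matrix (eigenvalue i))))
    (eigenvalue-root i , ℝ-ring.refl {fromℚ 0ℚ})

  factorisation : p ≈ₚ ∏[X- x ]
  factorisation = splitting (suc m) p (charPoly-monic M M-triangular) x x-root λ i j i<j →
    away-re-cancellable (x j ℂ-ring.- x i) (<ℝ⇒away {eigenvalue i} {eigenvalue j} (eigenvalue-increasing i j i<j))

  apart-from-two : ∀ z i j → i Fin.< j → Cancellable (z ℂ-ring.- x i) ⊎ Cancellable (z ℂ-ring.- x j)
  apart-from-two z i j i<j = Sum.map (away-re-cancellable (z ℂ-ring.- x i)) (away-re-cancellable (z ℂ-ring.- x j))
    (away-cotransitive {eigenvalue i} {eigenvalue j} (eigenvalue-increasing i j i<j) (re z))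

  -- Cotransitivity leaves one root from which `z` is not known to be apart. If `z` were apart from
  -- it as well, the product of all linear factors would be cancellable at `z` and the eigenvector
  -- zero; tightness turns this into equality.
  eigenvalue-located : ∀ z → IsEigenvalue ℂ-rawRing M z →
    ∃[ i ] (z ≈ℂ x i × (∀ j → Cancellable (z ℂ-ring.- x (punchIn i j))))
  eigenvalue-located z (v , v≉0 , Mv≈zv) = i , z≈x , apart
    where
    located = locate (λ i → Cancellable (z ℂ-ring.- x i)) (apart-from-two z)
    i = proj₁ located
    apart : ∀ j → Cancellable (z ℂ-ring.- x (punchIn i j))
    apart = proj₂ located
    ¬apart : ¬ Cancellable (z ℂ-ring.- x i)
    ¬apart zᵢ = v≉0 λ k → cancellable-cong {⟦ ∏[X- x ] ⟧ z} {⟦ p ⟧ z}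
      (ℂ-ring.sym {⟦ p ⟧ z} {⟦ ∏[X- x ] ⟧ z} (eval-cong p ∏[X- x ] {z} {z} factorisation (ℂ-ring.refl {z})))
      (eval-∏-cancellable x z (punchIn-elim (λ j → Cancellable (z ℂ-ring.- x j)) i zᵢ apart))
      (v k) (eigenvector-annihilated M M-triangular z v Mv≈zv k)
    z≈x : z ≈ℂ x i
    z≈x = Algebra.Properties.Ring.x∙y⁻¹≈ε⇒x≈y ℂ-ring.ring z (x i) (¬cancellable⇒≈0 (z ℂ-ring.- x i) ¬apart)

  -- The diagonal entries below the first row are separating points, and each root lies strictly
  -- between two neighbouring ones.
  x-apart-diagonal : ∀ i k → Cancellable (x i ℂ-ring.- M (suc k) (suc k))
  x-apart-diagonal i k = ≡.subst (λ e → Cancellable (x i ℂ-ring.- ℝ→ℂ (fromℚ e)))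
    (≡.trans (point-fib (Fin.toℕ<n k)) (≡.cong ι (≡.sym (entry-diagonal k))))
    (away-re-cancellable (x i ℂ-ring.- ℝ→ℂ (fromℚ (point (suc (toℕ k))))) away)
    where
    away : Away (λ n → seq (eigenvalue i) n ℚ.- point (suc (toℕ k)))
    away with ℕ.≤-<-connex (suc (toℕ k)) (toℕ i)
    ... | inj₁ k<i = <ℝ⇒away {fromℚ (point (suc (toℕ k)))} {eigenvalue i}
      (≤-<ℝ {point (suc (toℕ k))} {point (toℕ i)} {eigenvalue i} (point-≤ k<i (ℕ.<⇒≤ (Fin.toℕ<n i))) (point<eigenvalue i))
    ... | inj₂ i≤k = away-flip {λ _ → point (suc (toℕ k))} {seq (eigenvalue i)} (<ℝ⇒away {eigenvalue i} {fromℚ (point (suc (toℕ k)))}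
      (<ℝ-≤ {eigenvalue i} (eigenvalue<point i) (point-≤ i≤k (s≤s (ℕ.<⇒≤ (Fin.toℕ<n k))))))

  root⇒eigenvalue : ∀ z i → z ≈ℂ x i → IsEigenvalue ℂ-rawRing M z
  root⇒eigenvalue z i z≈x = root-isEigenvalue M M-triangular 1≉0 z
    (λ k → cancellable-cong {x i ℂ-ring.- M (suc k) (suc k)} {z ℂ-ring.- M (suc k) (suc k)}
      (ℂ-ring.+-cong {x i} {z} {ℂ-ring.- M (suc k) (suc k)} {ℂ-ring.- M (suc k) (suc k)}
        (ℂ-ring.sym {z} {x i} z≈x) (ℂ-ring.refl {ℂ-ring.- M (suc k) (suc k)}))
      (x-apart-diagonal i k))
    (ℂ-ring.trans {⟦ p ⟧ z} {⟦ p ⟧ (x i)} {ℂ-ring.0#}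
      (eval-cong p p {z} {x i} (λ k → ℂ-ring.refl {coeff ℂ-rawRing p k}) z≈x) (x-root i))

  -- The cofactor of X - z is the product over the remaining roots, from all of which `z` is apart.
  eigenvalue-simple : ∀ z → IsEigenvalue ℂ-rawRing M z → HasAlgebraicMultiplicity ℂ-rawRing M z 1
  eigenvalue-simple z isEigenvalue =
    q , p≈ , cancellable⇒≉0 {⟦ q ⟧ z} (eval-∏-cancellable (λ j → x (punchIn i j)) z (proj₂ (proj₂ located)))
    where
    located = eigenvalue-located z isEigenvalue
    i = proj₁ located
    z≈x : z ≈ℂ x i
    z≈x = proj₁ (proj₂ located)
    q : Polynomial ℂ-rawRing
    q = ∏[X- (λ j → x (punchIn i j)) ]
    X-z¹ : Polynomial ℂ-rawRing
    -- The form to which the first power of X - z unfolds.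
    X-z¹ = (X- z) *ₚ (ℂ-ring.1# ∷ [])
    linear : (X- z) ≈ₚ (X- x i)
    linear zero          = ℂ-ring.-‿cong {z} {x i} z≈x
    linear (suc zero)    = ℂ-ring.refl {ℂ-ring.1#}
    linear (suc (suc k)) = ℂ-ring.refl {ℂ-ring.0#}
    module P = ℂ-polynomials.P
    p≈ : p ≈ₚ X-z¹ *ₚ q
    p≈ = P.trans {p} {∏[X- x ]} {X-z¹ *ₚ q} factorisation
      (P.trans {∏[X- x ]} {(X- x i) *ₚ q} {X-z¹ *ₚ q} (∏-remove x i)
        (P.*-cong {X- x i} {X-z¹} {q} {q}
          (P.sym {X-z¹} {X- x i} (P.trans {X-z¹} {X- z} {X- x i} (P.*-identityʳ (X- z)) linear)) (P.refl {q})))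

  eigenvalue-increasingEigenvalues : IncreasingEigenvalues M eigenvalue
  eigenvalue-increasingEigenvalues = eigenvalue-increasing , λ z → mk⇔ (to z) (from z)
    where
    to : ∀ z → IsEigenvalue ℂ-rawRing M z → ∃[ i ] z ≈ℂ ℝ→ℂ (eigenvalue i)
    to z isEigenvalue = proj₁ located , proj₁ (proj₂ located)
      where located = eigenvalue-located z isEigenvalue
    from : ∀ z → (∃[ i ] z ≈ℂ ℝ→ℂ (eigenvalue i)) → IsEigenvalue ℂ-rawRing M z
    from z root = root⇒eigenvalue z (proj₁ root) (proj₂ root)

  -- The bounds are claimed for every increasing enumeration. Each `y i` equals some constructed
  -- root, and the order forces this matching to be strictly increasing, hence the identity.
  eigenvalues-unique : ∀ y → IncreasingEigenvalues M y → ∀ i → y i ≈ℝ eigenvalue i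
  eigenvalues-unique y (y-increasing , y-eigenvalues) i =
    ≡.subst (λ j → y i ≈ℝ eigenvalue j) (strictlyMonotone⇒id τ τ-mono i) (y≈ i)
    where
    matched : ∀ i → ∃[ j ] (ℝ→ℂ (y i) ≈ℂ x j × (∀ l → Cancellable (ℝ→ℂ (y i) ℂ-ring.- x (punchIn j l))))
    matched i = eigenvalue-located (ℝ→ℂ (y i)) (Equivalence.from (y-eigenvalues (ℝ→ℂ (y i))) (i , ℂ-ring.refl {ℝ→ℂ (y i)}))
    τ : Fin (suc m) → Fin (suc m)
    τ i = proj₁ (matched i)
    y≈ : ∀ i → y i ≈ℝ eigenvalue (τ i)
    y≈ i = proj₁ (proj₁ (proj₂ (matched i)))
    τ-mono : ∀ i j → i Fin.< j → τ i Fin.< τ j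
    τ-mono i j i<j = increasing-reflects eigenvalue eigenvalue-increasing (τ i) (τ j)
      (<ℝ-respʳ {eigenvalue (τ i)} {y j} {eigenvalue (τ j)} (y≈ j)
        (<ℝ-respˡ {y i} {eigenvalue (τ i)} {y j} (y≈ i) (y-increasing i j i<j)))

  module _ (y : Fin (suc m) → ℝ) (y-eigenvalues : IncreasingEigenvalues M y) where

    above-fib : ∀ i {k} → toℕ i ≡ suc k → fromℕ (fib (2 ℕ.+ k)) <ℝ y i
    above-fib i {k} i≡ = <ℝ-respʳ {fromℕ (fib (2 ℕ.+ k))} {eigenvalue i} {y i}
      (ℝ-ring.sym {y i} {eigenvalue i} (eigenvalues-unique y y-eigenvalues i))
      (≡.subst (λ q → fromℚ q <ℝ eigenvalue i) (≡.trans (≡.cong point i≡) (point-fib k<m)) (point<eigenvalue i))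
      where
      k<m : k ℕ.< m
      k<m = ℕ.≤-pred (≡.subst (ℕ._< suc m) i≡ (Fin.toℕ<n i))

    below-fib : ∀ i → toℕ i ℕ.< m → y i <ℝ fromℕ (fib (2 ℕ.+ toℕ i))
    below-fib i i<m = <ℝ-respˡ {eigenvalue i} {y i} {fromℕ (fib (2 ℕ.+ toℕ i))}
      (ℝ-ring.sym {y i} {eigenvalue i} (eigenvalues-unique y y-eigenvalues i))
      (≡.subst (λ q → eigenvalue i <ℝ fromℚ q) (point-fib i<m) (eigenvalue<point i))

theorem5 : ∀ (n : ℕ) → 1 ≤ n →
    (∀ z → IsEigenvalue ℂ-rawRing (fibonacciRedheffer n) z →
    IsReal z × HasAlgebraicMultiplicity ℂ-rawRing (fibonacciRedheffer n) z 1) ×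
    (∃[ x ] IncreasingEigenvalues (fibonacciRedheffer n) x) ×
    (2 ≤ n → ∀ (x : Fin n → ℝ) → IncreasingEigenvalues (fibonacciRedheffer n) x →
    (∀ i → index i ≡ 1 → x i <ℝ fromℕ 1) ×
    (∀ i → 2 ≤ index i → index i < n →
    fromℕ (fib (index i)) <ℝ x i × x i <ℝ fromℕ (fib (suc (index i)))) ×
    (∀ i → index i ≡ n → fromℕ (fib n) <ℝ x i))
theorem5 (suc m) _ =
  (λ z isEigenvalue → proj₂ (proj₁ (proj₂ (eigenvalue-located z isEigenvalue))) , eigenvalue-simple z isEigenvalue) ,
  (eigenvalue , eigenvalue-increasingEigenvalues) ,
  λ { (s≤s 1≤m) y y-eigenvalues → bounds 1≤m y y-eigenvalues }
  where
  open Eigenvalues m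
  open Spectrum m
  bounds : 1 ≤ m → ∀ y → IncreasingEigenvalues M y →
    (∀ i → index i ≡ 1 → y i <ℝ fromℕ 1) ×
    (∀ i → 2 ≤ index i → index i < suc m →
      fromℕ (fib (index i)) <ℝ y i × y i <ℝ fromℕ (fib (suc (index i)))) ×
    (∀ i → index i ≡ suc m → fromℕ (fib (suc m)) <ℝ y i)
  bounds 1≤m y y-eigenvalues = lowest , middle , highest
    where
    -- The bound 1 is F(2), the separating point supplied by the second row, so `1 ≤ m` enters here;
    -- the 1×1 matrix has the eigenvalue 1 itself.
    lowest : ∀ i → index i ≡ 1 → y i <ℝ fromℕ 1
    lowest i i≡1 = ≡.subst (λ k → y i <ℝ fromℕ (fib (2 ℕ.+ k))) (ℕ.suc-injective i≡1)
      (below-fib y y-eigenvalues i (≡.subst (_< m) (≡.sym (ℕ.suc-injective i≡1)) 1≤m))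
    middle : ∀ i → 2 ≤ index i → index i < suc m →
      fromℕ (fib (index i)) <ℝ y i × y i <ℝ fromℕ (fib (suc (index i)))
    middle (suc i) 2≤i (s≤s i<m) = above-fib y y-eigenvalues (suc i) ≡.refl , below-fib y y-eigenvalues (suc i) i<m
    middle zero (s≤s ()) _
    highest : ∀ i → index i ≡ suc m → fromℕ (fib (suc m)) <ℝ y i
    highest zero    i≡m = contradiction (≡.subst (1 ≤_) (≡.sym (ℕ.suc-injective i≡m)) 1≤m) λ ()
    highest (suc i) i≡m = ≡.subst (λ k → fromℕ (fib k) <ℝ y (suc i)) i≡m (above-fib y y-eigenvalues (suc i) ≡.refl)
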